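{- (a) Every regular abelian $(n,r,c)$-DRACKN is a roux graph for a roux with parameters $$c_g=\begin{cases} n-c(r-1)-2 & \text{if } g=\mathrm{id};\\ c&\text{otherwise.}\end{cases}\qquad(*)$$ (b) Given a finite abelian group $\Gamma$, then $B\in\mathbb{C}[\Gamma]^{n\times n}$ satisfies (R1)--(R3) if and only if $\lceil B\rfloor$ is the adjacency matrix of a (not necessarily regular) abelian cover of the complete graph. (c) Given a roux with parameters $\{c_g\}_{g\in\Gamma}$, its roux graph has diameter $3$ if and only if $c_g\neq0$ for every $g\in\Gamma$, in which case the graph is a regular antipodal cover of the complete graph. (d) The roux graph of any roux with parameters $(*)$ and $c\neq0$ is a regular abelian $(n,r,c)$-DRACKN.
   Context: For a finite abelian group $\Gamma$ (identified with its image in the group ring $\mathbb{C}[\Gamma]$) and $B\in\mathbb{C}[\Gamma]^{n\times n}$, consider the conditions: (R1) $B_{ii}=0$ for every $i$; (R2) $B_{ij}\in\Gamma$ for $i\neq j$; (R3) $B_{ji}=(B_{ij})^{ -1}$ for $i\ne j$; (R4) the matrices $\{gI\}_{g\in\Gamma}$ and $\{gB\}_{g\in\Gamma}$ span an algebra. $B$ is a roux for $\Gamma$ if it satisfies (R1)--(R4). Its roux parameters are the numbers $\{c_g\}_{g\in\Gamma}$ with $B^2=(n-1)I+\sum_{g\in\Gamma}c_g\,gB$ (they exist and are nonnegative integers summing to $n-2$). $\lceil B\rfloor$ is the matrix indexed by $[n]\times\Gamma$, where $[n]=\{1,\dots,n\}$, obtained by applying the Cayley representation of $\Gamma$ (extended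 linearly to $\mathbb{C}[\Gamma]$) to each entry of $B$; for $x\in\Gamma$ the $(g,h)$ entry of the image of $x$ is $1$ if $xh=g$ and $0$ otherwise. The roux graph of a roux $B$ is the graph with vertex set $[n]\times\Gamma$ and adjacency matrix $\lceil B\rfloor$; it is a cover of the complete graph whose fibres are the sets $\{i\}\times\Gamma$. Graphs are simple. A graph is distance-regular if for every ordered pair of vertices $(u,v)$ the number of vertices simultaneously at distance $i$ from $u$ and distance $j$ from $v$ is determined by $i$, $j$ and the distance between $u$ and $v$. A connected graph is antipodal if its vertices can be partitioned into fibres such that the distance between two distinct vertices is the diameter if and only if they belong to the same fibre. A cover of the complete graph is a graph with a partition of its vertices into independent sets (fibres) such that the induced subgraph on the union of any two distinct fibres is a perfect matching; it is an antipodal cover if the graph is antipodal with antipodal fibres equal to the covering fibres. A DRACKN is a distance-regular antipodal cover of the complete graph; it is an $(n,r,c)$-DRACKN if it has $rn$ vertices, its fibres have size $r$, and every pair of vertices at distance $2$ has $c$ common neighbors. Given a cover with fibres of size $r$, write its adjacency matrix $A$ in $r\times r$ blocks $A_{ij}$ (zero on the diagonal, permutation matrices off the diagonal), and normalize it to $DAD^{ -1}$, where $D$ is block diagonal with first block the identity and $j$th block $A_{1j}$ for $j>1$. Let $\Pi\le S_r$ be the group generated by the permutations represented by the off-diagonal blocks of the normalized matrix (well defined up to conjugation in $S_r$). The cover is regular if $\Pi$ acts regularly on $[r]$, and abelian if $\Pi$ is abelian.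
   Formalization: In (c) the condition is c_g ≠ 0 for every g ≠ id, as the literal claim fails for the hexagon (n=3, |Γ|=2, c_id=0, diameter 3). (c) and (d) assume |Γ| ≥ 2, since trivial Γ gives K_n of diameter 1, and n ≥ 2, which the parameters' sum n−2 forces. -}

module Defs where

open import Algebra.Bundles using (CommutativeRing; RawRing)
import Algebra.Definitions.RawMonoid as RawMonoidDefinitions
import Algebra.Properties.AbelianGroup as AbelianGroupProperties
import Algebra.Properties.CommutativeSemigroup as CommutativeSemigroupProperties
import Algebra.Properties.Ring as RingProperties
import Algebra.Solver.Ring.NaturalCoefficients.Default as SemiringSolver
open import Algebra.Structures using (IsAbelianGroup)
import Algebra.Consequences.Setoid as Consequences
open import Data.Bool.Base using (if_then_else_)
open import Data.Fin.Base using (Fin; toℕ)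
import Data.Fin.Permutation as Perm
open Perm using (Permutation′; _⟨$⟩ʳ_; _∘ₚ_)
import Data.Fin.Properties as Fin
open import Data.List.Base using (List; length)
open import Data.List.Membership.Propositional using (_∈_)
open import Data.List.Relation.Unary.Unique.Propositional using (Unique)
open import Data.Nat.Base as ℕ using (ℕ; zero; suc)
import Data.Nat.Properties as ℕ
open import Data.Product.Base using (Σ; ∃; ∃₂; _×_; _,_; proj₁; proj₂)
open import Data.Product using (∃!)
open import Data.Product.Function.NonDependent.Propositional using (_×-↔_)
open import Data.Rational.Base as ℚ using (ℚ; 0ℚ; 1ℚ; ½; ∣_∣)
import Data.Rational.Properties as ℚ
open import Data.Sum.Base using (_⊎_)
open import Function.Base using (_∘_)
open import Function.Bundles using (_↔_; _⇔_; Inverse)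
open import Function.Construct.Identity using (↔-id)
open import Function.Properties.Inverse using (↔⇒↣)
open import Level using (0ℓ)
open import Relation.Binary.Bundles using (Setoid)
open import Relation.Binary.Core using (Rel)
open import Relation.Binary.Definitions
  using (Decidable; DecidableEquality; Symmetric; Irreflexive)
open import Relation.Binary.PropositionalEquality
  using (_≡_; _≢_; refl; sym; trans; cong; cong₂; subst)
open import Relation.Binary.Structures using (IsEquivalence)
open import Relation.Nullary using (does)

module RingIdentities (R : CommutativeRing 0ℓ 0ℓ) where
  open CommutativeRing R renaming (refl to ≈-refl; sym to ≈-sym; trans to ≈-trans)
  open AbelianGroupProperties +-abelianGroup using (⁻¹-∙-comm; ⁻¹-anti-homo‿-; //-rightDividesˡ)
  open CommutativeSemigroupProperties +-commutativeSemigroup using (interchange)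
  open RingProperties ring using (-1*x≈-x; x[y-z]≈xy-xz; -‿distribˡ-*)
  open SemiringSolver commutativeSemiring using (solve; _:+_; _:*_; _:=_)

  +-difference : ∀ a b a′ b′ → (a - a′) + (b - b′) ≈ (a + b) - (a′ + b′)
  +-difference a b a′ b′ =
    ≈-trans (interchange a (- a′) b (- b′)) (+-congˡ (⁻¹-∙-comm a′ b′))

  neg-difference : ∀ a a′ → - (a - a′) ≈ (- a) - (- a′)
  neg-difference a a′ = ≈-sym (⁻¹-∙-comm a (- a′))

  +-telescope : ∀ a b c → (a - b) + (b - c) ≈ a - c
  +-telescope a b c = ≈-trans (≈-sym (+-assoc (a - b) b (- c))) (+-congʳ (//-rightDividesˡ b a))

  *-difference : ∀ a b a′ b′ → a * (b - b′) + b′ * (a - a′) ≈ a * b - a′ * b′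
  *-difference a b a′ b′ = ≈-trans
    (+-cong (x[y-z]≈xy-xz a b b′)
            (≈-trans (x[y-z]≈xy-xz b′ a a′) (+-cong (*-comm b′ a) (-‿cong (*-comm b′ a′)))))
    (+-telescope (a * b) (a * b′) (a′ * b′))

  swap-difference : ∀ a b → - (a - b) ≈ b - a
  swap-difference = ⁻¹-anti-homo‿-

  difference-cancel : ∀ a b → b + (a - b) ≈ a
  difference-cancel a b = ≈-trans (+-comm b (a - b)) (//-rightDividesˡ b a)

  infixl 6 _⊖_
  _⊖_ : Carrier → Carrier → Carrier
  x ⊖ y = x + - 1# * y

  ⊖≈- : ∀ {x x′ y y′} → x ≈ x′ → y ≈ y′ → x ⊖ y ≈ x′ - y′
  ⊖≈- {y = y} x≈x′ y≈y′ = +-cong x≈x′ (≈-trans (-1*x≈-x y) (-‿cong y≈y′))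

  -≈⊖ : ∀ x y → x - y ≈ x ⊖ y
  -≈⊖ x y = ≈-sym (⊖≈- ≈-refl ≈-refl)

  *-assoc-re : ∀ a b c d e f →
    (a * c - b * d) * e - (a * d + b * c) * f ≈ a * (c * e - d * f) - b * (c * f + d * e)
  *-assoc-re a b c d e f = ≈-trans
    (≈-trans (-≈⊖ _ _) (+-congʳ (*-congʳ (-≈⊖ _ _))))
    (≈-trans
      (solve 7 (λ m a b c d e f →
        (a :* c :+ m :* (b :* d)) :* e :+ m :* ((a :* d :+ b :* c) :* f)
          := a :* (c :* e :+ m :* (d :* f)) :+ m :* (b :* (c :* f :+ d :* e)))
        ≈-refl (- 1#) a b c d e f)
      (⊖≈- (*-congˡ (⊖≈- ≈-refl ≈-refl)) ≈-refl))

  *-assoc-im : ∀ a b c d e f →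
    (a * c - b * d) * f + (a * d + b * c) * e ≈ a * (c * f + d * e) + b * (c * e - d * f)
  *-assoc-im a b c d e f = ≈-trans
    (+-congʳ (*-congʳ (-≈⊖ _ _)))
    (≈-trans
      (solve 7 (λ m a b c d e f →
        (a :* c :+ m :* (b :* d)) :* f :+ (a :* d :+ b :* c) :* e
          := a :* (c :* f :+ d :* e) :+ b :* (c :* e :+ m :* (d :* f)))
        ≈-refl (- 1#) a b c d e f)
      (+-congˡ (*-congˡ (⊖≈- ≈-refl ≈-refl))))

  distribˡ-re : ∀ a b c d e f →
    a * (c + e) - b * (d + f) ≈ (a * c - b * d) + (a * e - b * f)
  distribˡ-re a b c d e f = ≈-trans
    (+-cong (distribˡ a c e) (-‿cong (distribˡ b d f)))
    (≈-sym (+-difference (a * c) (a * e) (b * d) (b * f)))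

  distribˡ-im : ∀ a b c d e f →
    a * (d + f) + b * (c + e) ≈ (a * d + b * c) + (a * f + b * e)
  distribˡ-im a b c d e f = ≈-trans
    (+-cong (distribˡ a d f) (distribˡ b c e)) (interchange (a * d) (a * f) (b * c) (b * e))

  *-comm-re : ∀ a b c d → a * c - b * d ≈ c * a - d * b
  *-comm-re a b c d = +-cong (*-comm a c) (-‿cong (*-comm b d))

  *-comm-im : ∀ a b c d → a * d + b * c ≈ c * b + d * a
  *-comm-im a b c d = ≈-trans (+-comm (a * d) (b * c)) (+-cong (*-comm b c) (*-comm a d))

  *-identityˡ-re : ∀ a b → 1# * a - 0# * b ≈ a
  *-identityˡ-re a b = ≈-trans
    (+-cong (*-identityˡ a) (≈-trans (-‿distribˡ-* 0# b) (≈-trans (*-congʳ -0≈0) (zeroˡ b))))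
    (+-identityʳ a)
    where
    -0≈0 : - 0# ≈ 0#
    -0≈0 = ≈-trans (≈-sym (+-identityˡ (- 0#))) (-‿inverseʳ 0#)

  *-identityˡ-im : ∀ a b → 1# * b + 0# * a ≈ b
  *-identityˡ-im a b = ≈-trans (+-cong (*-identityˡ b) (zeroˡ a)) (+-identityʳ b)

------------------------------------------------------------------------
-- The real numbers: Cauchy sequences of rationals modulo null sequences

Eventually : (ℕ → Set) → Set
Eventually P = ∃ λ N → ∀ n → N ℕ.≤ n → P n

Eventually₂ : (ℕ → ℕ → Set) → Set
Eventually₂ P = ∃ λ N → ∀ m n → N ℕ.≤ m → N ℕ.≤ n → P m n

IsCauchy : (ℕ → ℚ) → Set
IsCauchy x = ∀ ε → 0ℚ ℚ.< ε → Eventually₂ λ m n → ∣ x m ℚ.- x n ∣ ℚ.< ε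

record ℝ : Set where
  constructor mkℝ
  field
    seq    : ℕ → ℚ
    cauchy : IsCauchy seq
open ℝ public

infix 4 _≈ᴿ_

record _≈ᴿ_ (x y : ℝ) : Set where
  constructor mk≈ᴿ
  field
    null : ∀ ε → 0ℚ ℚ.< ε → Eventually λ n → ∣ seq x n ℚ.- seq y n ∣ ℚ.< ε
open _≈ᴿ_ public

module Vanishing where

  open RingIdentities ℚ.+-*-commutativeRing

  Vanishes : (ℕ → ℕ → ℚ) → Set
  Vanishes f = ∀ ε → 0ℚ ℚ.< ε → Eventually₂ λ m n → ∣ f m n ∣ ℚ.< ε

  Bounded : (ℕ → ℕ → ℚ) → Set
  Bounded f = ∃ λ K → 0ℚ ℚ.< K × Eventually₂ λ m n → ∣ f m n ∣ ℚ.≤ K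

  Eventually₂-map₂ : ∀ {P Q R : ℕ → ℕ → Set} → (∀ m n → P m n → Q m n → R m n) →
                     Eventually₂ P → Eventually₂ Q → Eventually₂ R
  Eventually₂-map₂ f (N , p) (M , q) = N ℕ.⊔ M , λ m n N⊔M≤m N⊔M≤n →
    f m n
      (p m n (ℕ.≤-trans (ℕ.m≤m⊔n N M) N⊔M≤m) (ℕ.≤-trans (ℕ.m≤m⊔n N M) N⊔M≤n))
      (q m n (ℕ.≤-trans (ℕ.m≤n⊔m N M) N⊔M≤m) (ℕ.≤-trans (ℕ.m≤n⊔m N M) N⊔M≤n))

  vanishes-cong : ∀ {f g} → (∀ m n → f m n ≡ g m n) → Vanishes f → Vanishes g
  vanishes-cong f≗g f→0 ε ε>0 with N , p ← f→0 ε ε>0 =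
    N , λ m n N≤m N≤n → subst (λ q → ∣ q ∣ ℚ.< ε) (f≗g m n) (p m n N≤m N≤n)

  vanishes-0 : ∀ {f} → (∀ m n → f m n ≡ 0ℚ) → Vanishes f
  vanishes-0 f≗0 ε ε>0 =
    0 , λ m n _ _ → subst (λ q → ∣ q ∣ ℚ.< ε) (sym (f≗0 m n)) ε>0

  half-pos : ∀ {ε} → 0ℚ ℚ.< ε → 0ℚ ℚ.< ½ ℚ.* ε
  half-pos {ε} ε>0 = subst (ℚ._< ½ ℚ.* ε) (ℚ.*-zeroʳ ½) (ℚ.*-monoʳ-<-pos ½ ε>0)

  half+half : ∀ ε → ½ ℚ.* ε ℚ.+ ½ ℚ.* ε ≡ ε
  half+half ε = trans (sym (ℚ.*-distribʳ-+ ε ½ ½)) (ℚ.*-identityˡ ε)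

  vanishes-+ : ∀ {f g} → Vanishes f → Vanishes g →
               Vanishes (λ m n → f m n ℚ.+ g m n)
  vanishes-+ {f} {g} f→0 g→0 ε ε>0 =
    Eventually₂-map₂
      (λ m n ∣f∣<ε/2 ∣g∣<ε/2 → ℚ.≤-<-trans (ℚ.∣p+q∣≤∣p∣+∣q∣ (f m n) (g m n))
        (subst (∣ f m n ∣ ℚ.+ ∣ g m n ∣ ℚ.<_) (half+half ε) (ℚ.+-mono-< ∣f∣<ε/2 ∣g∣<ε/2)))
      (f→0 (½ ℚ.* ε) (half-pos ε>0)) (g→0 (½ ℚ.* ε) (half-pos ε>0))

  vanishes-neg : ∀ {f} → Vanishes f → Vanishes (λ m n → ℚ.- f m n)
  vanishes-neg {f} f→0 ε ε>0 with N , p ← f→0 ε ε>0 =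
    N , λ m n N≤m N≤n → subst (ℚ._< ε) (sym (ℚ.∣-p∣≡∣p∣ (f m n))) (p m n N≤m N≤n)

  vanishes-* : ∀ {f g} → Bounded f → Vanishes g →
               Vanishes (λ m n → f m n ℚ.* g m n)
  vanishes-* {f} {g} (K , K>0 , f≤K) g→0 ε ε>0 =
    Eventually₂-map₂ bound f≤K (g→0 (1/K ℚ.* ε) 1/K*ε>0)
    where
    instance
      K-pos : ℚ.Positive K
      K-pos = ℚ.positive K>0
      K≢0 : ℚ.NonZero K
      K≢0 = ℚ.pos⇒nonZero K
      1/K-pos : ℚ.Positive (ℚ.1/ K)
      1/K-pos = ℚ.1/pos⇒pos K

    1/K : ℚ
    1/K = ℚ.1/ K

    1/K*ε>0 : 0ℚ ℚ.< 1/K ℚ.* ε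
    1/K*ε>0 = subst (ℚ._< 1/K ℚ.* ε) (ℚ.*-zeroʳ 1/K) (ℚ.*-monoʳ-<-pos 1/K ε>0)

    K*1/K*ε : K ℚ.* (1/K ℚ.* ε) ≡ ε
    K*1/K*ε = trans (sym (ℚ.*-assoc K 1/K ε))
      (trans (cong (ℚ._* ε) (ℚ.*-inverseʳ K)) (ℚ.*-identityˡ ε))

    bound : ∀ m n → ∣ f m n ∣ ℚ.≤ K → ∣ g m n ∣ ℚ.< 1/K ℚ.* ε → ∣ f m n ℚ.* g m n ∣ ℚ.< ε
    bound m n ∣f∣≤K ∣g∣<ε/K = begin-strict
      ∣ f m n ℚ.* g m n ∣       ≡⟨ ℚ.∣p*q∣≡∣p∣*∣q∣ (f m n) (g m n) ⟩
      ∣ f m n ∣ ℚ.* ∣ g m n ∣   ≤⟨ ℚ.*-monoʳ-≤-nonNeg ∣ g m n ∣ {{ℚ.∣-∣-nonNeg (g m n)}} ∣f∣≤K ⟩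
      K ℚ.* ∣ g m n ∣           <⟨ ℚ.*-monoʳ-<-pos K ∣g∣<ε/K ⟩
      K ℚ.* (1/K ℚ.* ε)         ≡⟨ K*1/K*ε ⟩
      ε                         ∎
      where open ℚ.≤-Reasoning

  cauchy-bounded : ∀ {x} → IsCauchy x → ∃ λ K → 0ℚ ℚ.< K × Eventually λ n → ∣ x n ∣ ℚ.≤ K
  cauchy-bounded {x} x-cauchy with N , p ← x-cauchy 1ℚ (ℚ.positive⁻¹ 1ℚ) =
    ∣ x N ∣ ℚ.+ 1ℚ ,
    ℚ.+-mono-≤-< (ℚ.0≤∣p∣ (x N)) (ℚ.positive⁻¹ 1ℚ) ,
    N , λ n N≤n → begin
      ∣ x n ∣                            ≡⟨ cong ∣_∣ (sym (difference-cancel (x n) (x N))) ⟩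
      ∣ x N ℚ.+ (x n ℚ.- x N) ∣          ≤⟨ ℚ.∣p+q∣≤∣p∣+∣q∣ (x N) (x n ℚ.- x N) ⟩
      ∣ x N ∣ ℚ.+ ∣ x n ℚ.- x N ∣        ≤⟨ ℚ.+-monoʳ-≤ ∣ x N ∣ (ℚ.<⇒≤ (p n N N≤n ℕ.≤-refl)) ⟩
      ∣ x N ∣ ℚ.+ 1ℚ                     ∎
    where open ℚ.≤-Reasoning

  boundedˡ : ∀ x → Bounded (λ m _ → seq x m)
  boundedˡ x with K , K>0 , N , p ← cauchy-bounded (cauchy x) = K , K>0 , N , λ m _ N≤m _ → p m N≤m

  boundedʳ : ∀ x → Bounded (λ _ n → seq x n)
  boundedʳ x with K , K>0 , N , p ← cauchy-bounded (cauchy x) = K , K>0 , N , λ _ n _ N≤n → p n N≤n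

  toVanishes : ∀ {x y} → x ≈ᴿ y → Vanishes (λ m _ → seq x m ℚ.- seq y m)
  toVanishes x≈y ε ε>0 with N , p ← null x≈y ε ε>0 = N , λ m _ N≤m _ → p m N≤m

  fromVanishes : ∀ {x y} → Vanishes (λ m _ → seq x m ℚ.- seq y m) → x ≈ᴿ y
  fromVanishes v .null ε ε>0 with N , p ← v ε ε>0 = N , λ n N≤n → p n n N≤n N≤n

open Vanishing
open RingIdentities ℚ.+-*-commutativeRing

infixl 6 _+ᴿ_
infixl 7 _*ᴿ_
infix  8 -ᴿ_

-- The proofs are abstract so that comparing real numbers never unfolds them.
abstract
  const-cauchy : ∀ q → IsCauchy (λ _ → q)
  const-cauchy q = vanishes-0 (λ _ _ → ℚ.+-inverseʳ q)

  +-cauchy : ∀ x y → IsCauchy (λ n → seq x n ℚ.+ seq y n)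
  +-cauchy x y = vanishes-cong
    (λ m n → +-difference (seq x m) (seq y m) (seq x n) (seq y n))
    (vanishes-+ (cauchy x) (cauchy y))

  neg-cauchy : ∀ x → IsCauchy (λ n → ℚ.- seq x n)
  neg-cauchy x = vanishes-cong
    (λ m n → neg-difference (seq x m) (seq x n)) (vanishes-neg (cauchy x))

  *-cauchy : ∀ x y → IsCauchy (λ n → seq x n ℚ.* seq y n)
  *-cauchy x y = vanishes-cong
    (λ m n → *-difference (seq x m) (seq y m) (seq x n) (seq y n))
    (vanishes-+ (vanishes-* (boundedˡ x) (cauchy y)) (vanishes-* (boundedʳ y) (cauchy x)))

constᴿ : ℚ → ℝ
constᴿ q = mkℝ (λ _ → q) (const-cauchy q)

_+ᴿ_ _*ᴿ_ : ℝ → ℝ → ℝ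
x +ᴿ y = mkℝ (λ n → seq x n ℚ.+ seq y n) (+-cauchy x y)
x *ᴿ y = mkℝ (λ n → seq x n ℚ.* seq y n) (*-cauchy x y)

-ᴿ_ : ℝ → ℝ
-ᴿ x = mkℝ (λ n → ℚ.- seq x n) (neg-cauchy x)

pointwise⇒≈ᴿ : ∀ {x y} → (∀ n → seq x n ≡ seq y n) → x ≈ᴿ y
pointwise⇒≈ᴿ {x} {y} x≗y = fromVanishes (vanishes-0 λ m _ →
  trans (cong (ℚ._- seq y m) (x≗y m)) (ℚ.+-inverseʳ (seq y m)))

≈ᴿ-refl : ∀ {x} → x ≈ᴿ x
≈ᴿ-refl = pointwise⇒≈ᴿ (λ _ → refl)

≈ᴿ-sym : ∀ {x y} → x ≈ᴿ y → y ≈ᴿ x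
≈ᴿ-sym {x} {y} x≈y = fromVanishes
  (vanishes-cong (λ m _ → swap-difference (seq x m) (seq y m)) (vanishes-neg (toVanishes x≈y)))

≈ᴿ-trans : ∀ {x y z} → x ≈ᴿ y → y ≈ᴿ z → x ≈ᴿ z
≈ᴿ-trans {x} {y} {z} x≈y y≈z = fromVanishes
  (vanishes-cong (λ m _ → +-telescope (seq x m) (seq y m) (seq z m))
    (vanishes-+ (toVanishes x≈y) (toVanishes y≈z)))

+ᴿ-cong : ∀ {x x′ y y′} → x ≈ᴿ x′ → y ≈ᴿ y′ → x +ᴿ y ≈ᴿ x′ +ᴿ y′
+ᴿ-cong {x} {x′} {y} {y′} x≈x′ y≈y′ = fromVanishes
  (vanishes-cong (λ m _ → +-difference (seq x m) (seq y m) (seq x′ m) (seq y′ m))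
    (vanishes-+ (toVanishes x≈x′) (toVanishes y≈y′)))

-ᴿ-cong : ∀ {x x′} → x ≈ᴿ x′ → -ᴿ x ≈ᴿ -ᴿ x′
-ᴿ-cong {x} {x′} x≈x′ = fromVanishes
  (vanishes-cong (λ m _ → neg-difference (seq x m) (seq x′ m)) (vanishes-neg (toVanishes x≈x′)))

*ᴿ-cong : ∀ {x x′ y y′} → x ≈ᴿ x′ → y ≈ᴿ y′ → x *ᴿ y ≈ᴿ x′ *ᴿ y′
*ᴿ-cong {x} {x′} {y} {y′} x≈x′ y≈y′ = fromVanishes
  (vanishes-cong (λ m _ → *-difference (seq x m) (seq y m) (seq x′ m) (seq y′ m))
    (vanishes-+ (vanishes-* (boundedˡ x) (toVanishes y≈y′))
                (vanishes-* (boundedˡ y′) (toVanishes x≈x′))))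

ℝ-commutativeRing : CommutativeRing 0ℓ 0ℓ
ℝ-commutativeRing = record
  { Carrier = ℝ
  ; _≈_ = _≈ᴿ_
  ; _+_ = _+ᴿ_
  ; _*_ = _*ᴿ_
  ; -_  = -ᴿ_
  ; 0#  = constᴿ 0ℚ
  ; 1#  = constᴿ 1ℚ
  ; isCommutativeRing = record
    { isRing = record
      { +-isAbelianGroup = record
        { isGroup = record
          { isMonoid = record
            { isSemigroup = record
              { isMagma = record
                { isEquivalence = record { refl = ≈ᴿ-refl ; sym = ≈ᴿ-sym ; trans = ≈ᴿ-trans }
                ; ∙-cong = +ᴿ-cong
                }
              ; assoc = λ x y z → pointwise⇒≈ᴿ λ n → ℚ.+-assoc (seq x n) (seq y n) (seq z n)
              }
            ; identity = (λ x → pointwise⇒≈ᴿ λ n → ℚ.+-identityˡ (seq x n))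
                       , (λ x → pointwise⇒≈ᴿ λ n → ℚ.+-identityʳ (seq x n))
            }
          ; inverse = (λ x → pointwise⇒≈ᴿ λ n → ℚ.+-inverseˡ (seq x n))
                    , (λ x → pointwise⇒≈ᴿ λ n → ℚ.+-inverseʳ (seq x n))
          ; ⁻¹-cong = -ᴿ-cong
          }
        ; comm = λ x y → pointwise⇒≈ᴿ λ n → ℚ.+-comm (seq x n) (seq y n)
        }
      ; *-cong = *ᴿ-cong
      ; *-assoc = λ x y z → pointwise⇒≈ᴿ λ n → ℚ.*-assoc (seq x n) (seq y n) (seq z n)
      ; *-identity = (λ x → pointwise⇒≈ᴿ λ n → ℚ.*-identityˡ (seq x n))
                   , (λ x → pointwise⇒≈ᴿ λ n → ℚ.*-identityʳ (seq x n))
      ; distrib = (λ x y z → pointwise⇒≈ᴿ λ n → ℚ.*-distribˡ-+ (seq x n) (seq y n) (seq z n))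
                , (λ x y z → pointwise⇒≈ᴿ λ n → ℚ.*-distribʳ-+ (seq x n) (seq y n) (seq z n))
      }
    ; *-comm = λ x y → pointwise⇒≈ᴿ λ n → ℚ.*-comm (seq x n) (seq y n)
    }
  }

------------------------------------------------------------------------
-- The complex numbers

record ℂ : Set where
  constructor _+i_
  field
    re im : ℝ
open ℂ public

infix 4 _≈ᶜ_

record _≈ᶜ_ (z w : ℂ) : Set where
  constructor mk≈ᶜ
  field
    re-≈ : re z ≈ᴿ re w
    im-≈ : im z ≈ᴿ im w
open _≈ᶜ_ public

infixl 6 _+ᶜ_
infixl 7 _*ᶜ_
infix  8 -ᶜ_

0ᶜ 1ᶜ : ℂ
0ᶜ = constᴿ 0ℚ +i constᴿ 0ℚ
1ᶜ = constᴿ 1ℚ +i constᴿ 0ℚ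

_+ᶜ_ _*ᶜ_ : ℂ → ℂ → ℂ
(a +i b) +ᶜ (c +i d) = (a +ᴿ c) +i (b +ᴿ d)
(a +i b) *ᶜ (c +i d) = (a *ᴿ c +ᴿ -ᴿ (b *ᴿ d)) +i (a *ᴿ d +ᴿ b *ᴿ c)

-ᶜ_ : ℂ → ℂ
-ᶜ (a +i b) = (-ᴿ a) +i (-ᴿ b)

ℂ-commutativeRing : CommutativeRing 0ℓ 0ℓ
ℂ-commutativeRing = record
  { Carrier = ℂ
  ; _≈_ = _≈ᶜ_
  ; _+_ = _+ᶜ_
  ; _*_ = _*ᶜ_
  ; -_  = -ᶜ_
  ; 0#  = 0ᶜ
  ; 1#  = 1ᶜ
  ; isCommutativeRing = record
    { isRing = record
      { +-isAbelianGroup = record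
        { isGroup = record
          { isMonoid = record
            { isSemigroup = record
              { isMagma = record
                { isEquivalence = ≈ᶜ-isEquivalence
                ; ∙-cong = +ᶜ-cong
                }
              ; assoc = λ x y z → mk≈ᶜ
                  (R.+-assoc (re x) (re y) (re z)) (R.+-assoc (im x) (im y) (im z))
              }
            ; identity = (λ x → mk≈ᶜ (R.+-identityˡ (re x)) (R.+-identityˡ (im x)))
                       , (λ x → mk≈ᶜ (R.+-identityʳ (re x)) (R.+-identityʳ (im x)))
            }
          ; inverse = (λ x → mk≈ᶜ (R.-‿inverseˡ (re x)) (R.-‿inverseˡ (im x)))
                    , (λ x → mk≈ᶜ (R.-‿inverseʳ (re x)) (R.-‿inverseʳ (im x)))
          ; ⁻¹-cong = λ p → mk≈ᶜ (R.-‿cong (re-≈ p)) (R.-‿cong (im-≈ p))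
          }
        ; comm = λ x y → mk≈ᶜ (R.+-comm (re x) (re y)) (R.+-comm (im x) (im y))
        }
      ; *-cong = *ᶜ-cong
      ; *-assoc = λ x y z → mk≈ᶜ
          (I.*-assoc-re (re x) (im x) (re y) (im y) (re z) (im z))
          (I.*-assoc-im (re x) (im x) (re y) (im y) (re z) (im z))
      ; *-identity = comm∧idˡ⇒id *ᶜ-comm *ᶜ-identityˡ
      ; distrib = comm∧distrˡ⇒distr +ᶜ-cong *ᶜ-comm *ᶜ-distribˡ
      }
    ; *-comm = *ᶜ-comm
    }
  }
  where
  module R = CommutativeRing ℝ-commutativeRing
  module I = RingIdentities ℝ-commutativeRing

  ≈ᶜ-isEquivalence : IsEquivalence _≈ᶜ_
  ≈ᶜ-isEquivalence = record
    { refl  = mk≈ᶜ R.refl R.refl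
    ; sym   = λ p → mk≈ᶜ (R.sym (re-≈ p)) (R.sym (im-≈ p))
    ; trans = λ p q → mk≈ᶜ (R.trans (re-≈ p) (re-≈ q)) (R.trans (im-≈ p) (im-≈ q))
    }

  setoid : Setoid 0ℓ 0ℓ
  setoid = record { isEquivalence = ≈ᶜ-isEquivalence }

  open Consequences setoid
    using (comm∧idˡ⇒id; comm∧distrˡ⇒distr)

  +ᶜ-cong : ∀ {x x′ y y′} → x ≈ᶜ x′ → y ≈ᶜ y′ → x +ᶜ y ≈ᶜ x′ +ᶜ y′
  +ᶜ-cong p q = mk≈ᶜ (R.+-cong (re-≈ p) (re-≈ q)) (R.+-cong (im-≈ p) (im-≈ q))

  *ᶜ-cong : ∀ {x x′ y y′} → x ≈ᶜ x′ → y ≈ᶜ y′ → x *ᶜ y ≈ᶜ x′ *ᶜ y′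
  *ᶜ-cong p q = mk≈ᶜ
    (R.+-cong (R.*-cong (re-≈ p) (re-≈ q)) (R.-‿cong (R.*-cong (im-≈ p) (im-≈ q))))
    (R.+-cong (R.*-cong (re-≈ p) (im-≈ q)) (R.*-cong (im-≈ p) (re-≈ q)))

  *ᶜ-comm : ∀ x y → x *ᶜ y ≈ᶜ y *ᶜ x
  *ᶜ-comm x y = mk≈ᶜ
    (I.*-comm-re (re x) (im x) (re y) (im y)) (I.*-comm-im (re x) (im x) (re y) (im y))

  *ᶜ-identityˡ : ∀ x → 1ᶜ *ᶜ x ≈ᶜ x
  *ᶜ-identityˡ x = mk≈ᶜ (I.*-identityˡ-re (re x) (im x)) (I.*-identityˡ-im (re x) (im x))

  *ᶜ-distribˡ : ∀ x y z → x *ᶜ (y +ᶜ z) ≈ᶜ (x *ᶜ y) +ᶜ (x *ᶜ z)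
  *ᶜ-distribˡ x y z = mk≈ᶜ
    (I.distribˡ-re (re x) (im x) (re y) (im y) (re z) (im z))
    (I.distribˡ-im (re x) (im x) (re y) (im y) (re z) (im z))

------------------------------------------------------------------------
-- Graphs

record Graph (V : Set) : Set₁ where
  field
    Adj    : Rel V 0ℓ
    adj?   : Decidable Adj
    symm   : Symmetric Adj
    irrefl : Irreflexive _≡_ Adj

HasCardinality : {V : Set} → (V → Set) → ℕ → Set
HasCardinality {V} P k =
  ∃ λ (vs : List V) → Unique vs × (∀ v → v ∈ vs ⇔ P v) × length vs ≡ k

module _ {V : Set} (G : Graph V) where
  open Graph G

  data Walk : ℕ → V → V → Set where
    []  : ∀ {u} → Walk 0 u u
    _∷_ : ∀ {k u v w} → Adj u v → Walk k v w → Walk (suc k) u w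

  Connected : Set
  Connected = ∀ u v → ∃ λ k → Walk k u v

  Distance : V → V → ℕ → Set
  Distance u v k = Walk k u v × (∀ {m} → Walk m u v → k ℕ.≤ m)

  -- No natural number is the diameter of a disconnected or an empty graph.
  Diameter : ℕ → Set
  Diameter d = (∀ u v → ∃ λ k → Distance u v k × k ℕ.≤ d) × ∃₂ λ u v → Distance u v d

  -- Only finite distances are considered; below this is used for connected graphs.
  DistanceRegular : Set
  DistanceRegular = ∀ d i j → ∃ λ p → ∀ u v → Distance u v d →
    HasCardinality (λ w → Distance u w i × Distance v w j) p

_≅_ : {V W : Set} → Graph V → Graph W → Set
_≅_ {V} {W} G H = ∃ λ (f : V ↔ W) →
  ∀ u v → Graph.Adj G u v ⇔ Graph.Adj H (Inverse.to f u) (Inverse.to f v)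

------------------------------------------------------------------------
-- Covers of the complete graph

-- A partition of V into fibres indexed by [n], together with an identification
-- of every fibre with [r]; this is what it takes to write an adjacency matrix
-- in r × r blocks.
Labelling : Set → ℕ → ℕ → Set
Labelling V n r = V ↔ (Fin n × Fin r)

module _ {V : Set} {n r : ℕ} (G : Graph V) (L : Labelling V n r) where
  open Graph G

  fibre : V → Fin n
  fibre v = proj₁ (Inverse.to L v)

  vertex : Fin n → Fin r → V
  vertex i a = Inverse.from L (i , a)

  record IsCover : Set where
    field
      independent : ∀ {u v} → Adj u v → fibre u ≢ fibre v
      matching    : ∀ {i j} → i ≢ j → ∀ u → fibre u ≡ i ⊎ fibre u ≡ j →
                    ∃! _≡_ λ v → (fibre v ≡ i ⊎ fibre v ≡ j) × Adj u v

  record IsAntipodal : Set where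
    field
      connected  : Connected G
      diameter   : ℕ
      isDiameter : Diameter G diameter
      antipodal  : ∀ {u v} → u ≢ v → Distance G u v diameter ⇔ fibre u ≡ fibre v

  record IsAntipodalCover : Set where
    field
      isCover     : IsCover
      isAntipodal : IsAntipodal

  record IsDRACKN (c : ℕ) : Set where
    field
      isAntipodalCover  : IsAntipodalCover
      isDistanceRegular : DistanceRegular G
      commonNeighbours  : ∀ {u v} → Distance G u v 2 →
                          HasCardinality (λ w → Adj u w × Adj v w) c

  -- The block A i j is the matrix of σ, acting on column vectors.
  Block : Fin n → Fin n → Permutation′ r → Set
  Block i j σ = ∀ a b → Adj (vertex i a) (vertex j b) ⇔ a ≡ σ ⟨$⟩ʳ b

  -- The j-th diagonal block of D.
  data DiagonalBlock : Fin n → Permutation′ r → Set where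
    first : ∀ {i} → toℕ i ≡ 0 → DiagonalBlock i Perm.id
    later : ∀ {i j δ} → toℕ i ≡ 0 → toℕ j ≢ 0 → Block i j δ → DiagonalBlock j δ

  -- The subgroup Π of the symmetric group. Recall that ρ ∘ₚ π applies ρ first,
  -- so the generator below is the (i , j) block of D A D⁻¹.
  data InΠ : Permutation′ r → Set where
    generator : ∀ {i j δᵢ σ δⱼ} → i ≢ j →
                DiagonalBlock i δᵢ → Block i j σ → DiagonalBlock j δⱼ →
                InΠ (Perm.flip δⱼ ∘ₚ σ ∘ₚ δᵢ)
    identity  : InΠ Perm.id
    compose   : ∀ {π ρ} → InΠ π → InΠ ρ → InΠ (π ∘ₚ ρ)
    inverse   : ∀ {π} → InΠ π → InΠ (Perm.flip π)
    respects  : ∀ {π ρ} → π Perm.≈ ρ → InΠ π → InΠ ρ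

  IsRegular : Set
  IsRegular = ∀ a b → ∃! Perm._≈_ λ π → InΠ π × π ⟨$⟩ʳ a ≡ b

  IsAbelian : Set
  IsAbelian = ∀ {π ρ} → InΠ π → InΠ ρ → (π ∘ₚ ρ) Perm.≈ (ρ ∘ₚ π)

------------------------------------------------------------------------
-- Finite abelian groups

record FiniteAbelianGroup (r : ℕ) : Set₁ where
  infixl 7 _∙_
  infix  8 _⁻¹
  infix  4 _≟_
  field
    Carrier        : Set
    _∙_            : Carrier → Carrier → Carrier
    ε              : Carrier
    _⁻¹            : Carrier → Carrier
    isAbelianGroup : IsAbelianGroup _≡_ _∙_ ε _⁻¹
    enumeration    : Carrier ↔ Fin r

  _≟_ : DecidableEquality Carrier
  _≟_ = Fin.inj⇒≟ (↔⇒↣ enumeration)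

  rouxLabelling : ∀ n → Labelling (Fin n × Carrier) n r
  rouxLabelling n = ↔-id (Fin n) ×-↔ enumeration

------------------------------------------------------------------------
-- Matrices

SquareMatrix : Set → Set → Set
SquareMatrix I A = I → I → A

module MatrixAlgebra (R : RawRing 0ℓ 0ℓ) (n : ℕ) where
  open RawRing R
  open RawMonoidDefinitions +-rawMonoid using (sum)

  Matrix : Set
  Matrix = SquareMatrix (Fin n) Carrier

  infix 4 _≈ᴹ_
  infixl 6 _+ᴹ_
  infixl 7 _*ᴹ_

  _≈ᴹ_ : Matrix → Matrix → Set
  M ≈ᴹ N = ∀ i j → M i j ≈ N i j

  _+ᴹ_ _*ᴹ_ : Matrix → Matrix → Matrix
  (M +ᴹ N) i j = M i j + N i j
  (M *ᴹ N) i j = sum (λ k → M i k * N k j)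

  1ᴹ : Matrix
  1ᴹ i j = if does (i Fin.≟ j) then 1# else 0#

------------------------------------------------------------------------
-- Roux

-- Only the ring structure of the scalars enters, so they are kept abstract here.
module RouxOver (K : CommutativeRing 0ℓ 0ℓ) where

  open CommutativeRing K using (_≈_; _+_; _*_; _-_; -_; 0#; 1#; +-rawMonoid)
    renaming (Carrier to Scalar)
  open RawMonoidDefinitions +-rawMonoid using (sum) renaming (_×_ to _×ᴷ_)

  fromℕ : ℕ → Scalar
  fromℕ m = m ×ᴷ 1#

  IsAdjacencyMatrix : {V : Set} → Graph V → SquareMatrix V Scalar → Set
  IsAdjacencyMatrix G A = ∀ u v → A u v ≈ (if does (Graph.adj? G u v) then 1# else 0#)

  module _ {r : ℕ} (Γ : FiniteAbelianGroup r) where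
    open FiniteAbelianGroup Γ

    ∑Γ : (Carrier → Scalar) → Scalar
    ∑Γ f = sum (λ a → f (Inverse.from enumeration a))

    -- A function f stands for the formal sum of the f g · g.
    groupRing : RawRing 0ℓ 0ℓ
    groupRing = record
      { Carrier = Carrier → Scalar
      ; _≈_ = λ f f′ → ∀ g → f g ≈ f′ g
      ; _+_ = λ f f′ g → f g + f′ g
      ; _*_ = λ f f′ g → ∑Γ λ h → f h * f′ (h ⁻¹ ∙ g)
      ; -_  = λ f g → - f g
      ; 0#  = λ _ → 0#
      ; 1#  = λ g → if does (ε ≟ g) then 1# else 0#
      }

    open RawRing groupRing using ()
      renaming (Carrier to GroupRing; _≈_ to _≈ᴳ_; _*_ to _*ᴳ_; 0# to 0ᴳ; 1# to 1ᴳ)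

    ⟦_⟧ : Carrier → GroupRing
    ⟦ x ⟧ g = if does (x ≟ g) then 1# else 0#

    module _ {n : ℕ} where
      open MatrixAlgebra groupRing n

      _·ᴹ_ : Scalar → Matrix → Matrix
      (k ·ᴹ M) i j g = k * M i j g

      _⋆_ : Carrier → Matrix → Matrix
      (x ⋆ M) i j = ⟦ x ⟧ *ᴳ M i j

      ∑Γᴹ : (Carrier → Matrix) → Matrix
      ∑Γᴹ F i j g = ∑Γ λ x → F x i j g

      InSpan : Matrix → Matrix → Set
      InSpan B M = ∃₂ λ (a b : Carrier → Scalar) →
        M ≈ᴹ ∑Γᴹ (λ g → a g ·ᴹ (g ⋆ 1ᴹ)) +ᴹ ∑Γᴹ (λ g → b g ·ᴹ (g ⋆ B))

      record IsSubalgebra (S : Matrix → Set) : Set where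
        field
          1-closed : S 1ᴹ
          +-closed : ∀ {M N} → S M → S N → S (M +ᴹ N)
          ·-closed : ∀ k {M} → S M → S (k ·ᴹ M)
          *-closed : ∀ {M N} → S M → S N → S (M *ᴹ N)

      R1 R2 R3 R4 : Matrix → Set
      R1 B = ∀ i → B i i ≈ᴳ 0ᴳ
      R2 B = ∀ i j → i ≢ j → ∃ λ g → B i j ≈ᴳ ⟦ g ⟧
      R3 B = ∀ i j → i ≢ j → (B i j *ᴳ B j i ≈ᴳ 1ᴳ) × (B j i *ᴳ B i j ≈ᴳ 1ᴳ)
      R4 B = IsSubalgebra (InSpan B)

      IsRoux : Matrix → Set
      IsRoux B = R1 B × R2 B × R3 B × R4 B

      HasRouxParameters : Matrix → (Carrier → Scalar) → Set
      HasRouxParameters B c =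
        B *ᴹ B ≈ᴹ ((fromℕ n - 1#) ·ᴹ 1ᴹ) +ᴹ ∑Γᴹ (λ g → c g ·ᴹ (g ⋆ B))

      cayley : Carrier → SquareMatrix Carrier Scalar
      cayley x g h = if does (x ∙ h ≟ g) then 1# else 0#

      ⌈_⌋ : Matrix → SquareMatrix (Fin n × Carrier) Scalar
      ⌈ B ⌋ (i , g) (j , h) = ∑Γ λ x → B i j x * cayley x g h

      IsRouxGraph : Matrix → Graph (Fin n × Carrier) → Set
      IsRouxGraph B G = IsAdjacencyMatrix G ⌈ B ⌋

    drackNParameters : (n c : ℕ) → Carrier → Scalar
    drackNParameters n c g =
      if does (g ≟ ε) then fromℕ n - fromℕ c * (fromℕ r - 1#) - fromℕ 2 else fromℕ c

open RouxOver ℂ-commutativeRing public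

ℂ[_] : ∀ {r} → FiniteAbelianGroup r → Set
ℂ[ Γ ] = FiniteAbelianGroup.Carrier Γ → ℂ

-- (R1)–(R3) say that ⌈ B ⌋ is the adjacency matrix of the graph on [n] × Γ in
-- which (i , g) and (j , h) are adjacent when i ≠ j and g = bᵢⱼ h; its blocks are
-- translations of Γ, so Π consists of translations. As ⌈ B ⌋ ⌈ B ⌋ = ⌈ B B ⌋, the
-- vertices (i , g) and (j , h) with i ≠ j have c_x common neighbours, where
-- x = bᵢⱼ⁻¹ g h⁻¹, and x = id exactly when they are adjacent. Hence c_x ≠ 0 for
-- x ≠ id means that non-adjacent vertices of different fibres are at distance 2,
-- and two vertices of a fibre are then at distance 3; conversely a walk of
-- length 3 from (i , x) to (i , id) forces c_x ≠ 0.
--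
-- Distance-regularity: the number Nᵢⱼ(u , v) of vertices at distance i from u and
-- j from v is determined by d(u , v) for i = 0 or j = 0 trivially, for i = 3 or
-- j = 3 by counting in a fibre, for i = j = 1 because common neighbours are
-- counted by the parameters, and otherwise by subtracting from a valency.
--
-- For (a), a non-adjacent pair in different fibres is at distance one less than
-- the diameter d, because one more step reaches an antipode; the third vertex of
-- a geodesic between antipodes is such a pair, so d = 3. Summing common
-- neighbours over a fibre gives c_id = n − c(r − 1) − 2. The regular abelian group
-- Π is identified with [r] through its orbit map, and the blocks of the normalized
-- matrix become the entries of B. The span is closed under products since
-- B² = (n − 1)I + (∑ c_g g)B in matrices over the commutative ring C[Γ].

module Submission where

open import Defs
  hiding (fromℕ; IsAdjacencyMatrix; ∑Γ; groupRing; ⟦_⟧; _·ᴹ_; _⋆_; ∑Γᴹ; InSpan; IsSubalgebra; R1; R2;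
         R3; R4; IsRoux; HasRouxParameters; cayley; ⌈_⌋; IsRouxGraph; drackNParameters)
open import Algebra.Bundles using (AbelianGroup; CommutativeMonoid; CommutativeRing; RawRing)
import Algebra.Consequences.Setoid as Consequences
import Algebra.Properties.AbelianGroup as AbelianGroupProperties
import Algebra.Properties.CommutativeMonoid.Sum as CommutativeMonoidSum
import Algebra.Properties.Ring as RingProperties
import Algebra.Properties.Semiring.Mult as SemiringMult
import Algebra.Properties.Semiring.Sum as SemiringSum
import Algebra.Solver.Ring.NaturalCoefficients.Default as SemiringSolver
open import Algebra.Structures using (IsAbelianGroup)
open import Data.Bool.Base using (Bool; true; false; not; if_then_else_)
open import Data.Fin.Base using (Fin; zero; suc; toℕ)
import Data.Fin.Permutation as Perm
open Perm using (Permutation′; _⟨$⟩ʳ_; _⟨$⟩ˡ_; _∘ₚ_)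
import Data.Fin.Properties as Fin
open import Data.List.Base
  using (List; []; _∷_; length; filter; map; tabulate; allFin; cartesianProductWith; _++_)
open import Data.List.Membership.Propositional using (_∈_)
open import Data.List.Membership.Propositional.Properties
  using (∈-filter⁺; ∈-filter⁻; ∈-allFin; ∈-cartesianProductWith⁺; ∈-map⁺; ∈-map⁻)
open import Data.List.Membership.Propositional.Properties.WithK using (unique∧set⇒bag)
open import Data.List.Properties using (filter-++; length-++; length-map; map-tabulate)
open import Data.List.Relation.Binary.BagAndSetEquality using (∼bag⇒↭)
open import Data.List.Relation.Binary.Permutation.Propositional.Properties using (↭-length)
import Data.List.Relation.Unary.Unique.Propositional.Properties as Unique
open import Data.Nat.Base as ℕ using (ℕ; zero; suc; _+_; _*_; _∸_; _≤_; z≤n; s≤s)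
import Data.Nat.Properties as ℕ
open import Data.Nat.Tactic.RingSolver using (solve-∀)
open import Data.Product using (∃!)
open import Data.Product.Base using (∃; ∃₂; _×_; _,_; proj₁; proj₂)
open import Data.Product.Properties using (≡-dec; ,-injective)
open import Data.Rational.Base as ℚ using (ℚ; 0ℚ; 1ℚ)
import Data.Rational.Properties as ℚ
open import Data.Sum.Base using (_⊎_; inj₁; inj₂)
open import Function.Base using (_∘_; id)
open import Function.Bundles using (_↔_; _⇔_; Inverse; Equivalence; mk⇔; mk↔ₛ′)
open import Function.Construct.Composition using (_↔-∘_)
open import Function.Construct.Identity using (↔-id)
open import Function.Construct.Symmetry using (↔-sym)
open import Function.Properties.Inverse using (↔⇒↣)
open import Level using (0ℓ)
open import Relation.Binary.Bundles using (Setoid)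
open import Relation.Binary.Definitions using (DecidableEquality)
import Relation.Binary.Reasoning.Setoid as SetoidReasoning
open import Relation.Binary.PropositionalEquality
  using (_≡_; _≢_; refl; sym; trans; cong; cong₂; subst; subst₂; module ≡-Reasoning)
open import Relation.Binary.PropositionalEquality.Algebra using (isMagma)
open import Relation.Nullary using (¬_; Dec; yes; no; does; contradiction)
open import Relation.Nullary.Decidable
  using (_×-dec_; ¬?; does-⇔; dec-true; dec-false; via-injection; map′)
open import Relation.Unary using (Decidable)

private
  module ∑ = SemiringSum ℕ.+-*-semiring
open ∑ using (sum; sum-cong-≗)

-- Sums and cardinalities

module _ (M : CommutativeMonoid 0ℓ 0ℓ) where
  open CommutativeMonoid M renaming (trans to ≈-trans)
  open CommutativeMonoidSum M using (sum-cong-≋; sum-replicate-zero) renaming (sum to sumᴹ)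

  sum-zero : ∀ {n} {f : Fin n → Carrier} → (∀ i → f i ≈ ε) → sumᴹ f ≈ ε
  sum-zero {n} f≈ε = ≈-trans (sum-cong-≋ f≈ε) (sum-replicate-zero n)

  sum-single : ∀ {n} {f : Fin n → Carrier} i → (∀ j → j ≢ i → f j ≈ ε) → sumᴹ f ≈ f i
  sum-single {suc n} {f} zero f≈ε =
    ≈-trans (∙-congˡ (sum-zero λ j → f≈ε (suc j) λ ())) (identityʳ (f zero))
  sum-single {suc n} {f} (suc i) f≈ε = ≈-trans
    (∙-cong (f≈ε zero λ ()) (sum-single i λ j j≢i → f≈ε (suc j) (j≢i ∘ Fin.suc-injective)))
    (identityˡ (f (suc i)))

𝟙 : {P : Set} → Dec P → ℕ
𝟙 P? = if does P? then 1 else 0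

module _ {P : Set} (P? : Dec P) where

  𝟙-true : P → 𝟙 P? ≡ 1
  𝟙-true p = cong (if_then 1 else 0) (dec-true P? p)

  𝟙-false : ¬ P → 𝟙 P? ≡ 0
  𝟙-false ¬p = cong (if_then 1 else 0) (dec-false P? ¬p)

  𝟙-+-¬ : 𝟙 P? + 𝟙 (¬? P?) ≡ 1
  𝟙-+-¬ with does P?
  ... | true  = refl
  ... | false = refl

  𝟙-× : {Q : Set} (Q? : Dec Q) → 𝟙 (P? ×-dec Q?) ≡ 𝟙 P? * 𝟙 Q?
  𝟙-× Q? with does P?
  ... | true  = sym (ℕ.*-identityˡ (𝟙 Q?))
  ... | false = refl

𝟙-cong : {P Q : Set} (P? : Dec P) (Q? : Dec Q) → P ⇔ Q → 𝟙 P? ≡ 𝟙 Q?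
𝟙-cong P? Q? P⇔Q = cong (if_then 1 else 0) (does-⇔ P⇔Q P? Q?)

sum-const : ∀ n k → sum {n} (λ _ → k) ≡ n * k
sum-const zero    k = refl
sum-const (suc n) k = cong (k +_) (sum-const n k)

sum-𝟙-≟ : ∀ {n} (i : Fin n) → sum (λ j → 𝟙 (i Fin.≟ j)) ≡ 1
sum-𝟙-≟ i = trans
  (sum-single ℕ.+-0-commutativeMonoid i λ j j≢i → 𝟙-false (i Fin.≟ j) (j≢i ∘ sym))
  (𝟙-true (i Fin.≟ i) refl)

-- Both sums contain `h true` once and `h false` in all other places. This is why the sums over
-- fibres below do not depend on which fibre contains the base vertex.
sum-does-≟ : ∀ {n} (h : Bool → ℕ) (i i′ : Fin n) →
  sum (λ j → h (does (i Fin.≟ j))) ≡ sum (λ j → h (does (i′ Fin.≟ j)))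
sum-does-≟ {suc n} h i i′ = trans (toZero i) (sym (toZero i′))
  where
  swap : ∀ a b c → a + (b + c) ≡ b + (a + c)
  swap = solve-∀

  toZero : ∀ {n} (i : Fin (suc n)) →
    sum (λ j → h (does (i Fin.≟ j))) ≡ h true + sum {n} (λ _ → h false)
  toZero zero = refl
  toZero {suc n} (suc i) =
    trans (cong (h false +_) (toZero i)) (swap (h false) (h true) (sum {n} (λ _ → h false)))

sum≡0⇒≡0 : ∀ {n} (f : Fin n → ℕ) → sum f ≡ 0 → ∀ i → f i ≡ 0
sum≡0⇒≡0 f ∑f≡0 zero    = ℕ.m+n≡0⇒m≡0 (f zero) ∑f≡0
sum≡0⇒≡0 f ∑f≡0 (suc i) = sum≡0⇒≡0 (f ∘ suc) (ℕ.m+n≡0⇒n≡0 (f zero) ∑f≡0) i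

length-filter-tabulate : ∀ {A : Set} {P : A → Set} (P? : Decidable P) {n} (f : Fin n → A) →
  length (filter P? (tabulate f)) ≡ sum (λ i → 𝟙 (P? (f i)))
length-filter-tabulate P? {zero}  f = refl
length-filter-tabulate P? {suc n} f with does (P? (f zero))
... | true  = cong suc (length-filter-tabulate P? (f ∘ suc))
... | false = length-filter-tabulate P? (f ∘ suc)

length-filter-cartesian : ∀ {A B C : Set} {P : C → Set} (P? : Decidable P) (f : A → B → C)
  {n r} (g : Fin n → A) (h : Fin r → B) →
  length (filter P? (cartesianProductWith f (tabulate g) (tabulate h)))
    ≡ sum (λ i → sum (λ a → 𝟙 (P? (f (g i) (h a)))))
length-filter-cartesian P? f {zero}  g h = refl
length-filter-cartesian P? f {suc n} g h = begin
  length (filter P? (map (f (g zero)) (tabulate h) ++ rest))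
    ≡⟨ cong length (filter-++ P? (map (f (g zero)) (tabulate h)) rest) ⟩
  length (filter P? (map (f (g zero)) (tabulate h)) ++ filter P? rest)
    ≡⟨ length-++ (filter P? (map (f (g zero)) (tabulate h))) ⟩
  length (filter P? (map (f (g zero)) (tabulate h))) + length (filter P? rest)
    ≡⟨ cong₂ _+_
         (trans (cong (length ∘ filter P?) (map-tabulate h (f (g zero))))
                (length-filter-tabulate P? (f (g zero) ∘ h)))
         (length-filter-cartesian P? f (g ∘ suc) h) ⟩
  sum (λ i → sum (λ a → 𝟙 (P? (f (g i) (h a)))))
    ∎
  where
  open ≡-Reasoning
  rest = cartesianProductWith f (tabulate (g ∘ suc)) (tabulate h)

-- Two duplicate-free lists with the same members are permutations of each other, so their lengths
-- agree.
HasCardinality-unique : ∀ {V : Set} {P : V → Set} {k l} →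
  HasCardinality P k → HasCardinality P l → k ≡ l
HasCardinality-unique (vs , vs! , v∈vs⇔P , refl) (ws , ws! , w∈ws⇔P , refl) =
  ↭-length (∼bag⇒↭ (unique∧set⇒bag vs! ws! λ {v} → mk⇔
    (Equivalence.from (w∈ws⇔P v) ∘ Equivalence.to (v∈vs⇔P v))
    (Equivalence.from (v∈vs⇔P v) ∘ Equivalence.to (w∈ws⇔P v))))

HasCardinality-cong : ∀ {V : Set} {P Q : V → Set} {k} →
  (∀ v → P v ⇔ Q v) → HasCardinality P k → HasCardinality Q k
HasCardinality-cong P⇔Q (vs , vs! , v∈vs⇔P , eq) = vs , vs! , (λ v → mk⇔
  (Equivalence.to (P⇔Q v) ∘ Equivalence.to (v∈vs⇔P v))
  (Equivalence.from (v∈vs⇔P v) ∘ Equivalence.from (P⇔Q v))) , eq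

HasCardinality-↔ : ∀ {V W : Set} {Q : W → Set} {k} (f : V ↔ W) →
  HasCardinality (Q ∘ Inverse.to f) k → HasCardinality Q k
HasCardinality-↔ {Q = Q} f (vs , vs! , v∈vs⇔Q , eq) =
  map to vs , Unique.map⁺ injective vs! , w∈⇔Q , trans (length-map to vs) eq
  where
  open Inverse f using (to; from; strictlyInverseˡ; strictlyInverseʳ)

  injective : ∀ {v v′} → to v ≡ to v′ → v ≡ v′
  injective {v} {v′} eq′ =
    trans (sym (strictlyInverseʳ v)) (trans (cong from eq′) (strictlyInverseʳ v′))

  w∈⇔Q : ∀ w → w ∈ map to vs ⇔ Q w
  w∈⇔Q w = mk⇔
    (λ w∈ → let v , v∈ , w≡ = ∈-map⁻ to w∈ in subst Q (sym w≡) (Equivalence.to (v∈vs⇔Q v) v∈))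
    (λ Qw → subst (_∈ map to vs) (strictlyInverseˡ w) (∈-map⁺ to
      (Equivalence.from (v∈vs⇔Q (from w)) (subst Q (sym (strictlyInverseˡ w)) Qw))))

-- Counting vertices fibre by fibre

module Labelled {V : Set} {n r : ℕ} (L : Labelling V n r) where
  open Inverse L using (strictlyInverseˡ; strictlyInverseʳ) renaming (from to at; to to label)

  infix 4 _≟ⱽ_
  _≟ⱽ_ : DecidableEquality V
  _≟ⱽ_ = via-injection (↔⇒↣ L) (≡-dec Fin._≟_ Fin._≟_)

  ∑ⱽ : (V → ℕ) → ℕ
  ∑ⱽ f = sum λ i → sum λ a → f (at (i , a))

  # : {P : V → Set} → Decidable P → ℕ
  # P? = ∑ⱽ λ v → 𝟙 (P? v)

  ∑ⱽ-cong : ∀ {f g} → (∀ v → f v ≡ g v) → ∑ⱽ f ≡ ∑ⱽ g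
  ∑ⱽ-cong f≗g = sum-cong-≗ λ i → sum-cong-≗ λ a → f≗g (at (i , a))

  ∑ⱽ-+ : ∀ f g → ∑ⱽ (λ v → f v + g v) ≡ ∑ⱽ f + ∑ⱽ g
  ∑ⱽ-+ f g = trans
    (sum-cong-≗ λ i → ∑.∑-distrib-+ (λ a → f (at (i , a))) (λ a → g (at (i , a))))
    (∑.∑-distrib-+ (λ i → sum λ a → f (at (i , a))) (λ i → sum λ a → g (at (i , a))))

  ∑ⱽ-sum : ∀ {m} (f : Fin m → V → ℕ) → sum (λ k → ∑ⱽ (f k)) ≡ ∑ⱽ (λ v → sum λ k → f k v)
  ∑ⱽ-sum f = trans
    (∑.∑-comm (λ k i → sum λ a → f k (at (i , a))))
    (sum-cong-≗ λ i → ∑.∑-comm (λ k a → f k (at (i , a))))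

  ∑ⱽ-single : ∀ {f} v → (∀ w → w ≢ v → f w ≡ 0) → ∑ⱽ f ≡ f v
  ∑ⱽ-single {f} v f≡0 = trans
    (sum-single ℕ.+-0-commutativeMonoid i λ j j≢i →
      sum-zero ℕ.+-0-commutativeMonoid λ b →
        f≡0 (at (j , b)) λ eq → j≢i (trans (sym (cong proj₁ (strictlyInverseˡ (j , b))))
                                           (cong (proj₁ ∘ label) eq)))
    (trans
      (sum-single ℕ.+-0-commutativeMonoid a λ b b≢a →
        f≡0 (at (i , b)) λ eq → b≢a (trans (sym (cong proj₂ (strictlyInverseˡ (i , b))))
                                           (cong (proj₂ ∘ label) eq)))
      (cong f (strictlyInverseʳ v)))
    where
    i = proj₁ (label v)
    a = proj₂ (label v)

  anyⱽ? : {P : V → Set} → Decidable P → Dec (∃ P)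
  anyⱽ? {P} P? = map′
    (λ (i , a , p) → at (i , a) , p)
    (λ (v , p) → proj₁ (label v) , proj₂ (label v) , subst P (sym (strictlyInverseʳ v)) p)
    (Fin.any? λ i → Fin.any? λ a → P? (at (i , a)))

  -- The labelling makes the vertex set searchable, so a nonzero count yields an actual witness.
  #≢0⇒∃ : {P : V → Set} (P? : Decidable P) → # P? ≢ 0 → ∃ P
  #≢0⇒∃ P? #≢0 with anyⱽ? P?
  ... | yes ∃v = ∃v
  ... | no ∄ = contradiction
    (sum-zero ℕ.+-0-commutativeMonoid λ i → sum-zero ℕ.+-0-commutativeMonoid λ a →
      𝟙-false (P? (at (i , a))) λ p → ∄ (at (i , a) , p)) #≢0

  #≡0⇒∄ : {P : V → Set} (P? : Decidable P) → # P? ≡ 0 → ∀ v → ¬ P v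
  #≡0⇒∄ {P} P? #≡0 v p = ℕ.1+n≢0 (trans (sym (𝟙-true (P? v) p)) (trans
    (cong (𝟙 ∘ P?) (sym (strictlyInverseʳ v)))
    (sum≡0⇒≡0 _ (sum≡0⇒≡0 _ #≡0 (proj₁ (label v))) (proj₂ (label v)))))

  #-HasCardinality : {P : V → Set} (P? : Decidable P) → HasCardinality P (# P?)
  #-HasCardinality {P} P? =
    filter P? vertices , Unique.filter⁺ P? vertices! , v∈⇔P ,
    length-filter-cartesian P? (λ i a → at (i , a)) id id
    where
    vertices : List V
    vertices = cartesianProductWith (λ i a → at (i , a)) (allFin n) (allFin r)

    vertices! = Unique.cartesianProductWith⁺ (λ i a → at (i , a))
      (λ {i} {j} {a} {b} eq → ,-injective
        (trans (sym (strictlyInverseˡ (i , a))) (trans (cong label eq) (strictlyInverseˡ (j , b)))))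
      (Unique.allFin⁺ n) (Unique.allFin⁺ r)

    ∈vertices : ∀ v → v ∈ vertices
    ∈vertices v = subst (_∈ vertices) (strictlyInverseʳ v)
      (∈-cartesianProductWith⁺ (λ i a → at (i , a)) (∈-allFin (proj₁ (label v))) (∈-allFin (proj₂ (label v))))

    v∈⇔P : ∀ v → v ∈ filter P? vertices ⇔ P v
    v∈⇔P v = mk⇔ (λ v∈ → proj₂ (∈-filter⁻ P? {xs = vertices} v∈)) (∈-filter⁺ P? (∈vertices v))

  HasCardinality⇒# : {P : V → Set} (P? : Decidable P) {k : ℕ} → HasCardinality P k → # P? ≡ k
  HasCardinality⇒# P? = HasCardinality-unique (#-HasCardinality P?)

-- Covers of the complete graph

module Cover {V : Set} {n r : ℕ} {G : Graph V} {L : Labelling V n r} (isCover : IsCover G L) where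
  open Graph G
  open IsCover isCover
  open Labelled L
  open Inverse L using (strictlyInverseˡ; strictlyInverseʳ) renaming (to to label)

  fib : V → Fin n
  fib = fibre G L

  vtx : Fin n → Fin r → V
  vtx = vertex G L

  fib-vtx : ∀ i a → fib (vtx i a) ≡ i
  fib-vtx i a = cong proj₁ (strictlyInverseˡ (i , a))

  vtx-injective : ∀ {i a b} → vtx i a ≡ vtx i b → a ≡ b
  vtx-injective {i} {a} {b} eq = trans (sym (cong proj₂ (strictlyInverseˡ (i , a))))
    (trans (cong (proj₂ ∘ label) eq) (cong proj₂ (strictlyInverseˡ (i , b))))

  vtx-label : ∀ {v j} → fib v ≡ j → vtx j (proj₂ (label v)) ≡ v
  vtx-label refl = strictlyInverseʳ _

  -- The matching condition only places the partner of `u` in one of two fibres; independence rules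
  -- out the fibre of `u` itself.
  neighbour : ∀ u {j} → fib u ≢ j →
    ∃ λ a → Adj u (vtx j a) × (∀ b → Adj u (vtx j b) → a ≡ b)
  neighbour u {j} u≢j with matching u≢j u (inj₁ refl)
  ... | v , (inj₁ v≡u , u~v) , _ = contradiction (sym v≡u) (independent u~v)
  ... | v , (inj₂ v≡j , u~v) , unique =
    proj₂ (label v) , subst (Adj u) (sym (vtx-label v≡j)) u~v , λ b u~b →
      vtx-injective (trans (vtx-label v≡j) (unique (inj₂ (fib-vtx j b) , u~b)))

  -- Both vertices are the unique neighbour of `u` in their common fibre. Applied to the midpoint of
  -- a walk, this excludes walks of length 2 between distinct vertices of a fibre.
  same-fibre-neighbour : ∀ {u v w} → Adj u v → Adj u w → fib v ≡ fib w → v ≡ w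
  same-fibre-neighbour {u} {v} {w} u~v u~w v≡w
    with a , _ , unique ← neighbour u (independent u~v) =
    trans (sym (at-a refl u~v)) (at-a (sym v≡w) u~w)
    where
    at-a : ∀ {x} → fib x ≡ fib v → Adj u x → vtx (fib v) a ≡ x
    at-a {x} x≡v u~x = trans (cong (vtx (fib v)) (unique (proj₂ (label x))
      (subst (Adj u) (sym (vtx-label x≡v)) u~x))) (vtx-label x≡v)

  neighbours-in-fibre : ∀ u j → sum (λ a → 𝟙 (adj? u (vtx j a))) ≡ 𝟙 (¬? (fib u Fin.≟ j))
  neighbours-in-fibre u j with fib u Fin.≟ j
  ... | yes u≡j = sum-zero ℕ.+-0-commutativeMonoid λ a → 𝟙-false (adj? u (vtx j a)) λ u~a →
    independent u~a (trans u≡j (sym (fib-vtx j a)))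
  ... | no u≢j with a , u~a , unique ← neighbour u u≢j = trans
    (sum-single ℕ.+-0-commutativeMonoid a λ b b≢a →
      𝟙-false (adj? u (vtx j b)) (b≢a ∘ sym ∘ unique b))
    (𝟙-true (adj? u (vtx j a)) u~a)

  -- Each of the other n - 1 fibres holds one neighbour; the successor on the left avoids truncated
  -- subtraction.
  valency : ∀ u → suc (# (adj? u)) ≡ n
  valency u = begin
    suc (# (adj? u))
      ≡⟨ ℕ.+-comm 1 (# (adj? u)) ⟩
    # (adj? u) + 1
      -- The added 1 is the indicator of the fibre of `u`, summed over all fibres, so that every
      -- fibre contributes 1 in total.
      ≡⟨ cong₂ _+_ (sum-cong-≗ (neighbours-in-fibre u)) (sym (sum-𝟙-≟ (fib u))) ⟩
    sum (λ j → 𝟙 (¬? (fib u Fin.≟ j))) + sum (λ j → 𝟙 (fib u Fin.≟ j))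
      ≡⟨ ∑.∑-distrib-+ (λ j → 𝟙 (¬? (fib u Fin.≟ j))) _ ⟨
    sum (λ j → 𝟙 (¬? (fib u Fin.≟ j)) + 𝟙 (fib u Fin.≟ j))
      ≡⟨ sum-cong-≗ (λ j → trans (ℕ.+-comm (𝟙 (¬? (fib u Fin.≟ j))) _) (𝟙-+-¬ (fib u Fin.≟ j))) ⟩
    sum {n} (λ _ → 1)
      ≡⟨ trans (sum-const n 1) (ℕ.*-identityʳ n) ⟩
    n
      ∎
    where open ≡-Reasoning

  common? : ∀ u v → Decidable (λ w → Adj u w × Adj v w)
  common? u v w = adj? u w ×-dec adj? v w

  common-self : ∀ u → suc (# (common? u u)) ≡ n
  common-self u = trans
    (cong suc (∑ⱽ-cong λ w → 𝟙-cong (common? u u w) (adj? u w) (mk⇔ proj₁ λ u~w → u~w , u~w)))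
    (valency u)

  common-same-fibre : ∀ {u v} → fib u ≡ fib v → u ≢ v → # (common? u v) ≡ 0
  common-same-fibre {u} {v} u≡v u≢v =
    sum-zero ℕ.+-0-commutativeMonoid λ k → sum-zero ℕ.+-0-commutativeMonoid λ a →
      𝟙-false (common? u v (vtx k a)) λ (u~w , v~w) →
        u≢v (same-fibre-neighbour (symm u~w) (symm v~w) u≡v)

  -- Every common neighbour of u and a vertex of the fibre j lies in a third
  -- fibre, and each of the remaining n − 2 fibres contributes exactly one.
  common-in-fibre : ∀ u j → fib u ≢ j → sum (λ a → # (common? u (vtx j a))) + 2 ≡ n
  common-in-fibre u j u≢j = begin
    sum (λ a → # (common? u (vtx j a))) + 2
      ≡⟨ cong (_+ 2) (∑ⱽ-sum (λ a w → 𝟙 (common? u (vtx j a) w))) ⟩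
    ∑ⱽ (λ w → sum λ a → 𝟙 (common? u (vtx j a) w)) + 2
      ≡⟨ cong (_+ 2) (∑ⱽ-cong λ w → trans
           (sum-cong-≗ λ a → 𝟙-× (adj? u w) (adj? (vtx j a) w))
           (sym (∑.*-distribˡ-sum (𝟙 (adj? u w)) (λ a → 𝟙 (adj? (vtx j a) w))))) ⟩
    ∑ⱽ (λ w → 𝟙 (adj? u w) * sum λ a → 𝟙 (adj? (vtx j a) w)) + 2
      -- With the adjacency reversed, the inner sum counts the neighbours of `w` in the fibre `j`.
      ≡⟨ cong (_+ 2) (∑ⱽ-cong λ w → cong (𝟙 (adj? u w) *_) (trans
           (sum-cong-≗ λ a → 𝟙-cong (adj? (vtx j a) w) (adj? w (vtx j a)) (mk⇔ symm symm))
           (neighbours-in-fibre w j))) ⟩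
    ∑ⱽ (λ w → 𝟙 (adj? u w) * 𝟙 (¬? (fib w Fin.≟ j))) + 2
      ≡⟨ cong (_+ 2) (sum-cong-≗ λ k → trans
           (sum-cong-≗ λ b → cong (λ i → 𝟙 (adj? u (vtx k b)) * 𝟙 (¬? (i Fin.≟ j))) (fib-vtx k b))
           (trans (sym (∑.*-distribʳ-sum (𝟙 (¬? (k Fin.≟ j))) (λ b → 𝟙 (adj? u (vtx k b)))))
                  (cong (_* 𝟙 (¬? (k Fin.≟ j))) (neighbours-in-fibre u k)))) ⟩
    sum (λ k → 𝟙 (¬? (fib u Fin.≟ k)) * 𝟙 (¬? (k Fin.≟ j))) + 2
      -- The summand 2 becomes the indicators of `fib u` and `j`, the two fibres that hold no
      -- counted vertex.
      ≡⟨ cong (sum (λ k → 𝟙 (¬? (fib u Fin.≟ k)) * 𝟙 (¬? (k Fin.≟ j))) +_)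
           (sym (cong₂ _+_ (sum-𝟙-≟ (fib u)) (sum-𝟙-≟ j))) ⟩
    sum (λ k → 𝟙 (¬? (fib u Fin.≟ k)) * 𝟙 (¬? (k Fin.≟ j)))
      + (sum (λ k → 𝟙 (fib u Fin.≟ k)) + sum (λ k → 𝟙 (j Fin.≟ k)))
      ≡⟨ trans
           (∑.∑-distrib-+ (λ k → 𝟙 (¬? (fib u Fin.≟ k)) * 𝟙 (¬? (k Fin.≟ j))) _)
           (cong (sum (λ k → 𝟙 (¬? (fib u Fin.≟ k)) * 𝟙 (¬? (k Fin.≟ j))) +_)
             (∑.∑-distrib-+ (λ k → 𝟙 (fib u Fin.≟ k)) _)) ⟨
    sum (λ k → 𝟙 (¬? (fib u Fin.≟ k)) * 𝟙 (¬? (k Fin.≟ j)) + (𝟙 (fib u Fin.≟ k) + 𝟙 (j Fin.≟ k)))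
      ≡⟨ sum-cong-≗ one ⟩
    sum {n} (λ _ → 1)
      ≡⟨ trans (sum-const n 1) (ℕ.*-identityʳ n) ⟩
    n
      ∎
    where
    open ≡-Reasoning

    one : ∀ k → 𝟙 (¬? (fib u Fin.≟ k)) * 𝟙 (¬? (k Fin.≟ j)) + (𝟙 (fib u Fin.≟ k) + 𝟙 (j Fin.≟ k)) ≡ 1
    one k with fib u Fin.≟ k | k Fin.≟ j | j Fin.≟ k
    ... | yes u≡k | yes k≡j | _       = contradiction (trans u≡k k≡j) u≢j
    ... | yes u≡k | no _    | yes j≡k = contradiction (trans u≡k (sym j≡k)) u≢j
    ... | yes _   | no _    | no _    = refl
    ... | no _    | yes _   | yes _   = refl
    ... | no _    | yes k≡j | no j≢k  = contradiction (sym k≡j) j≢k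
    ... | no _    | no k≢j  | yes j≡k = contradiction (sym j≡k) k≢j
    ... | no _    | no _    | no _    = refl

  -- In the fibre of `v`, only `v` is adjacent to `u`; the other r - 1 vertices have c common
  -- neighbours with `u`. Subtracting these from the n - 2 of `common-in-fibre` leaves the count for
  -- `v`, stated here without subtraction.
  common-adjacent : ∀ {c} →
    (∀ {u v} → fib u ≢ fib v → ¬ Adj u v → # (common? u v) ≡ c) →
    ∀ {u v} → Adj u v → # (common? u v) + r * c + 2 ≡ n + c
  common-adjacent {c} nonadjacent {u} {v} u~v
    with a , u~a , unique ← neighbour u (independent u~v) = begin
    # (common? u v) + r * c + 2
      ≡⟨ cong (λ w → # (common? u w) + r * c + 2)
           (same-fibre-neighbour u~v u~a (sym (fib-vtx (fib v) a))) ⟩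
    k + r * c + 2
      ≡⟨ cong (_+ 2) (sym (trans (∑.∑-distrib-+ (λ b → 𝟙 (a Fin.≟ b) * k) (λ _ → c))
           (cong₂ _+_ (trans (sym (∑.*-distribʳ-sum k (λ b → 𝟙 (a Fin.≟ b))))
                             (trans (cong (_* k) (sum-𝟙-≟ a)) (ℕ.*-identityˡ k)))
                      (sum-const r c)))) ⟩
    sum (λ b → 𝟙 (a Fin.≟ b) * k + c) + 2
      ≡⟨ cong (_+ 2) (sum-cong-≗ each) ⟩
    sum (λ b → # (common? u (vtx j b)) + 𝟙 (a Fin.≟ b) * c) + 2
      ≡⟨ cong (_+ 2) (trans (∑.∑-distrib-+ (λ b → # (common? u (vtx j b))) _)
           (cong (sum (λ b → # (common? u (vtx j b))) +_)
             (trans (sym (∑.*-distribʳ-sum c (λ b → 𝟙 (a Fin.≟ b))))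
                    (trans (cong (_* c) (sum-𝟙-≟ a)) (ℕ.*-identityˡ c))))) ⟩
    sum (λ b → # (common? u (vtx j b))) + c + 2
      ≡⟨ swap (sum (λ b → # (common? u (vtx j b)))) c ⟩
    sum (λ b → # (common? u (vtx j b))) + 2 + c
      ≡⟨ cong (_+ c) (common-in-fibre u j (independent u~v)) ⟩
    n + c
      ∎
    where
    open ≡-Reasoning
    j = fib v
    k = # (common? u (vtx j a))

    swap : ∀ x y → x + y + 2 ≡ x + 2 + y
    swap = solve-∀

    -- The term at `a` is `k` instead of `c`; adding `c` to it on the right lets the left side have
    -- the constant `c` in all r places.
    each : ∀ b → 𝟙 (a Fin.≟ b) * k + c ≡ # (common? u (vtx j b)) + 𝟙 (a Fin.≟ b) * c
    each b with a Fin.≟ b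
    ... | yes refl = cong₂ _+_ (ℕ.*-identityˡ k) (sym (ℕ.*-identityˡ c))
    ... | no a≢b   = sym (trans (ℕ.+-identityʳ _) (nonadjacent
      (λ u≡b → independent u~v (trans u≡b (fib-vtx j b))) (a≢b ∘ unique b)))

-- Distances and intersection numbers

module CoverDistance {V : Set} {n r : ℕ} {G : Graph V} {L : Labelling V n r}
  (isCover : IsCover G L) where
  open Graph G
  open IsCover isCover
  open Labelled L
  open Cover isCover

  Distance-unique : ∀ {u v k l} → Distance G u v k → Distance G u v l → k ≡ l
  Distance-unique (p , p-min) (q , q-min) = ℕ.≤-antisym (p-min q) (q-min p)

  -- Length 2 is impossible because the middle vertex would have two neighbours in one fibre.
  3≤walk : ∀ {m u v} → fib u ≡ fib v → u ≢ v → Walk G m u v → 3 ≤ m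
  3≤walk u≡v u≢v []                  = contradiction refl u≢v
  3≤walk u≡v u≢v (u~v ∷ [])          = contradiction u≡v (independent u~v)
  3≤walk u≡v u≢v (u~w ∷ (w~v ∷ []))  =
    contradiction (same-fibre-neighbour (symm u~w) w~v u≡v) u≢v
  3≤walk u≡v u≢v (_ ∷ (_ ∷ (_ ∷ _))) = s≤s (s≤s (s≤s z≤n))

  2≤walk : ∀ {m u v} → fib u ≢ fib v → ¬ Adj u v → Walk G m u v → 2 ≤ m
  2≤walk u≢v u≁v []            = contradiction refl u≢v
  2≤walk u≢v u≁v (u~v ∷ [])    = contradiction u~v u≁v
  2≤walk u≢v u≁v (_ ∷ (_ ∷ _)) = s≤s (s≤s z≤n)

  module _ (isAntipodal : IsAntipodal G L) where
    open IsAntipodal isAntipodal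

    private
      infixl 5 _∷ʳ_
      _∷ʳ_ : ∀ {k u v w} → Walk G k u v → Adj v w → Walk G (suc k) u w
      []      ∷ʳ v~w = v~w ∷ []
      (e ∷ p) ∷ʳ v~w = e ∷ (p ∷ʳ v~w)

      Antipode : V → Set
      Antipode u = ∃ λ u′ → fib u ≡ fib u′ × u ≢ u′

      -- One step beyond v lies a vertex of the fibre of u, at distance equal to
      -- the diameter.
      remote-eccentric : ∀ {u v} → fib u ≢ fib v → ¬ Adj u v →
        Antipode u × ∃ λ k → Distance G u v k × suc k ≡ diameter
      remote-eccentric {u} {v} u≢v u≁v
        with k , u-v , k≤d ← proj₁ isDiameter u v
           | a , v~u′ , _ ← neighbour v (u≢v ∘ sym) =
        (u′ , sym (fib-vtx (fib u) a) , u≢u′) , k , u-v ,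
        ℕ.≤-antisym (ℕ.≤∧≢⇒< k≤d k≢d) (proj₂ u-u′ (proj₁ u-v ∷ʳ v~u′))
        where
        u′ = vtx (fib u) a

        u≢u′ : u ≢ u′
        u≢u′ u≡u′ = u≁v (symm (subst (Adj v) (sym u≡u′) v~u′))

        u-u′ : Distance G u u′ diameter
        u-u′ = Equivalence.from (antipodal u≢u′) (sym (fib-vtx (fib u) a))

        k≢d : k ≢ diameter
        k≢d refl = u≢v (Equivalence.to (antipodal (u≢v ∘ cong fib)) u-v)

      -- The third vertex of a geodesic between two antipodes is at distance 2
      -- from the first one, and at distance diameter − 1 by remote-eccentric.
      diameter≤3 : ∀ {u} → Antipode u → diameter ≤ 3
      diameter≤3 {u} (u′ , u≡u′ , u≢u′) = bound refl (Equivalence.from (antipodal u≢u′) u≡u′)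
        where
        -- The length is a variable `d` with an equation to `diameter`, so that the geodesic can be
        -- taken apart step by step.
        bound : ∀ {d} → d ≡ diameter → Distance G u u′ d → d ≤ 3
        bound _ ([] , _) = z≤n
        bound _ ((_ ∷ []) , _) = s≤s z≤n
        -- The geodesic starts `u`, `x`, `y`; an edge from `u` to `y` would shorten it by one.
        bound d≡ (_∷_ {v = x} u~x (_∷_ {k = m} {v = y} x~y p) , min) = beyond
          (remote-eccentric u≢y (λ u~y → ℕ.1+n≰n (min (u~y ∷ p))))
          where
          u≢y : fib u ≢ fib y
          -- If `y` lies in the fibre of `u`, either it is `u` and the rest of the geodesic is a
          -- shorter walk, or two steps join distinct vertices of one fibre.
          u≢y u≡y with u ≟ⱽ y
          ... | yes refl = ℕ.1+n≰n (ℕ.≤-trans (ℕ.n≤1+n (suc m)) (min p))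
          ... | no u≠y   = ℕ.1+n≰n (3≤walk u≡y u≠y (u~x ∷ (x~y ∷ [])))

          -- The two steps to `y` bound its distance from `u` by 2, hence the diameter, one more, by
          -- 3.
          beyond : (Antipode u × ∃ λ k → Distance G u y k × suc k ≡ diameter) → suc (suc m) ≤ 3
          beyond (_ , k , (_ , min′) , 1+k≡) =
            subst (_≤ 3) (trans 1+k≡ (sym d≡)) (s≤s (min′ (u~x ∷ (x~y ∷ []))))

    -- The antipode from `remote-eccentric` is what `diameter≤3` asks for, so the distance, one
    -- below the diameter, is at most 2; it is at least 2 because the vertices are neither equal nor
    -- adjacent.
    remote-distance : ∀ {u v} → fib u ≢ fib v → ¬ Adj u v → Distance G u v 2
    remote-distance {u} {v} u≢v u≁v
      with antipode , k , u-v , 1+k≡ ← remote-eccentric u≢v u≁v =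
      subst (Distance G u v)
        (ℕ.≤-antisym (ℕ.≤-pred (subst (_≤ 3) (sym 1+k≡) (diameter≤3 antipode)))
                     (2≤walk u≢v u≁v (proj₁ u-v)))
        u-v

  -- The index is the distance that the pair ought to have, read off from fibres and adjacency
  -- alone. The cases are exhaustive and exclusive, which makes `dist` a computable function;
  -- `position-distance` later identifies it with the distance by walks.
  data Position (u v : V) : ℕ → Set where
    equal     : u ≡ v → Position u v 0
    adjacent  : Adj u v → Position u v 1
    remote    : fib u ≢ fib v → ¬ Adj u v → Position u v 2
    antipodal : fib u ≡ fib v → u ≢ v → Position u v 3

  position : ∀ u v → ∃ (Position u v)
  position u v with fib u Fin.≟ fib v
  ... | yes u≡v with u ≟ⱽ v
  ...   | yes u≈v = 0 , equal u≈v
  ...   | no u≉v  = 3 , antipodal u≡v u≉v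
  position u v | no u≢v with adj? u v
  ...   | yes u~v = 1 , adjacent u~v
  ...   | no u≁v  = 2 , remote u≢v u≁v

  Position-unique : ∀ {u v k l} → Position u v k → Position u v l → k ≡ l
  Position-unique (equal _)       (equal _)       = refl
  Position-unique (equal refl)    (adjacent u~u)  = contradiction refl (independent u~u)
  Position-unique (equal refl)    (remote u≢u _)  = contradiction refl u≢u
  Position-unique (equal u≡v)     (antipodal _ u≢v) = contradiction u≡v u≢v
  Position-unique (adjacent u~u)  (equal refl)    = contradiction refl (independent u~u)
  Position-unique (adjacent _)    (adjacent _)    = refl
  Position-unique (adjacent u~v)  (remote _ u≁v)  = contradiction u~v u≁v
  Position-unique (adjacent u~v)  (antipodal u≡v _) = contradiction u≡v (independent u~v)
  Position-unique (remote u≢u _)  (equal refl)    = contradiction refl u≢u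
  Position-unique (remote _ u≁v)  (adjacent u~v)  = contradiction u~v u≁v
  Position-unique (remote _ _)    (remote _ _)    = refl
  Position-unique (remote u≢v _)    (antipodal u≡v _) = contradiction u≡v u≢v
  Position-unique (antipodal _ u≢v) (equal u≡v)     = contradiction u≡v u≢v
  Position-unique (antipodal u≡v _) (adjacent u~v)  = contradiction u≡v (independent u~v)
  Position-unique (antipodal u≡v _) (remote u≢v _)    = contradiction u≡v u≢v
  Position-unique (antipodal _ _) (antipodal _ _) = refl

  Position-sym : ∀ {u v k} → Position u v k → Position v u k
  Position-sym (equal u≡v)         = equal (sym u≡v)
  Position-sym (adjacent u~v)      = adjacent (symm u~v)
  Position-sym (remote u≢v u≁v)    = remote (u≢v ∘ sym) (u≁v ∘ symm)
  Position-sym (antipodal u≡v u≢v) = antipodal (sym u≡v) (u≢v ∘ sym)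

  Position-fibre : ∀ {u v u′ v′ k} → Position u v k → Position u′ v′ k →
    fib u ≡ fib v → fib u′ ≡ fib v′
  Position-fibre _              (equal refl)       _   = refl
  Position-fibre (adjacent u~v) (adjacent _)       u≡v = contradiction u≡v (independent u~v)
  Position-fibre (remote u≢v _) (remote _ _)       u≡v = contradiction u≡v u≢v
  Position-fibre _              (antipodal u′≡v′ _) _   = u′≡v′

  dist : V → V → ℕ
  dist u v = proj₁ (position u v)

  dist-position : ∀ {u v k} → Position u v k → dist u v ≡ k
  dist-position = Position-unique (proj₂ (position _ _))

  position-dist : ∀ {u v k} → dist u v ≡ k → Position u v k
  position-dist refl = proj₂ (position _ _)

  dist-sym : ∀ u v → dist u v ≡ dist v u
  dist-sym u v = dist-position (Position-sym (proj₂ (position v u)))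

  -- Intersection numbers of a cover

  module Counting where

    Determined : (V → V → ℕ) → Set
    Determined f = ∀ {u v u′ v′} → dist u v ≡ dist u′ v′ → f u v ≡ f u′ v′

    -- This is how an intersection number is found from a total and the remaining summands.
    Determined-cancelˡ : ∀ f {g} → Determined (λ u v → f u v + g u v) → Determined f → Determined g
    Determined-cancelˡ f {g} f+g f-det {u} {v} {u′} {v′} eq = ℕ.+-cancelˡ-≡ (f u v) _ _
      (trans (f+g eq) (cong (_+ g u′ v′) (sym (f-det eq))))

    Determined-value : ∀ {f} → Determined f → ∀ d → ∃ λ p → ∀ u v → dist u v ≡ d → f u v ≡ p
    Determined-value {f} f-det d with anyⱽ? (λ u → anyⱽ? λ v → dist u v ℕ.≟ d)
    ... | yes (u , v , eq) = f u v , λ u′ v′ eq′ → f-det (trans eq′ (sym eq))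
    -- With no pair at distance `d` any value would do; 0 is the default.
    ... | no ∄ = 0 , λ u v eq → contradiction (u , v , eq) ∄

    infix 8 _at_from_
    _at_from_ : V → ℕ → V → ℕ
    w at k from u = 𝟙 (dist u w ℕ.≟ k)

    -- Distances 0 and 3 together fill the fibre of `u`, and 1 and 2 its complement. So the counts
    -- for 3 and 2 follow from those for 0 and 1.
    at-0or3 : ∀ u w → w at 0 from u + w at 3 from u ≡ 𝟙 (fib u Fin.≟ fib w)
    at-0or3 u w with position u w
    ... | _ , equal u≡w       = sym (𝟙-true (fib u Fin.≟ fib w) (cong fib u≡w))
    ... | _ , adjacent u~w    = sym (𝟙-false (fib u Fin.≟ fib w) (independent u~w))
    ... | _ , remote u≢w _    = sym (𝟙-false (fib u Fin.≟ fib w) u≢w)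
    ... | _ , antipodal u≡w _ = sym (𝟙-true (fib u Fin.≟ fib w) u≡w)

    at-1or2 : ∀ u w → w at 1 from u + w at 2 from u ≡ 𝟙 (¬? (fib u Fin.≟ fib w))
    at-1or2 u w with position u w
    ... | _ , equal u≡w       = sym (𝟙-false (¬? (fib u Fin.≟ fib w)) (contradiction (cong fib u≡w)))
    ... | _ , adjacent u~w    = sym (𝟙-true (¬? (fib u Fin.≟ fib w)) (independent u~w))
    ... | _ , remote u≢w _    = sym (𝟙-true (¬? (fib u Fin.≟ fib w)) u≢w)
    ... | _ , antipodal u≡w _ = sym (𝟙-false (¬? (fib u Fin.≟ fib w)) (contradiction u≡w))

    at-any : ∀ u w → w at 0 from u + w at 3 from u + (w at 1 from u + w at 2 from u) ≡ 1
    at-any u w = trans (cong₂ _+_ (at-0or3 u w) (at-1or2 u w)) (𝟙-+-¬ (fib u Fin.≟ fib w))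

    at-≥4 : ∀ {k} u w → w at (4 + k) from u ≡ 0
    at-≥4 {k} u w = 𝟙-false (dist u w ℕ.≟ 4 + k) λ eq → impossible (position-dist eq)
      where
      impossible : ¬ Position u w (4 + k)
      impossible ()

    at-1 : ∀ u w → w at 1 from u ≡ 𝟙 (adj? u w)
    at-1 u w = 𝟙-cong (dist u w ℕ.≟ 1) (adj? u w)
      (mk⇔ (λ eq → adj (position-dist eq)) (dist-position ∘ adjacent))
      where
      adj : Position u w 1 → Adj u w
      adj (adjacent u~w) = u~w

    at-0-≢ : ∀ {u w} → w ≢ u → w at 0 from u ≡ 0
    at-0-≢ {u} {w} w≢u = 𝟙-false (dist u w ℕ.≟ 0) λ eq → w≢u (≡-of (position-dist eq))
      where
      ≡-of : Position u w 0 → w ≡ u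
      ≡-of (equal u≡w) = sym u≡w

    at-0-≡ : ∀ u → u at 0 from u ≡ 1
    at-0-≡ u = 𝟙-true (dist u u ℕ.≟ 0) (dist-position (equal refl))

    -- The flag tells whether the vertex from which distances are measured lies
    -- in the fibre.
    fibreCount : ℕ → Bool → ℕ
    fibreCount 0 b = if b then 1 else 0
    fibreCount 1 b = if not b then 1 else 0
    fibreCount 2 b = r * fibreCount 1 b ∸ fibreCount 1 b
    fibreCount 3 b = r * fibreCount 0 b ∸ fibreCount 0 b
    fibreCount _ b = 0

    sum-at-0 : ∀ u j → sum (λ a → vtx j a at 0 from u) ≡ 𝟙 (fib u Fin.≟ j)
    sum-at-0 u j with fib u Fin.≟ j
    ... | no u≢j   = sum-zero ℕ.+-0-commutativeMonoid λ a → at-0-≢ λ eq →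
      u≢j (trans (cong fib (sym eq)) (fib-vtx j a))
    ... | yes refl = trans
      (sum-single ℕ.+-0-commutativeMonoid (proj₂ (Inverse.to L u)) λ a a≢ →
        at-0-≢ λ eq → a≢ (vtx-injective (trans eq (sym (vtx-label refl)))))
      (trans (cong (_at 0 from u) (vtx-label refl)) (at-0-≡ u))

    private
      a+b≡c⇒b≡c∸a : ∀ {a b c d} → a + b ≡ c → a ≡ d → b ≡ c ∸ d
      a+b≡c⇒b≡c∸a {a} {b} refl refl = sym (ℕ.m+n∸m≡n a b)

    -- Distances 0 and 1 are counted directly. A fibre consists of r vertices at distances 0 or 3,
    -- or of r vertices at distances 1 or 2, whence the truncated differences in `fibreCount`.
    sum-at : ∀ k u j → sum (λ a → vtx j a at k from u) ≡ fibreCount k (does (fib u Fin.≟ j))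
    sum-at 0 u j = sum-at-0 u j
    sum-at 1 u j = trans (sum-cong-≗ λ a → at-1 u (vtx j a)) (neighbours-in-fibre u j)
    sum-at 2 u j = a+b≡c⇒b≡c∸a
      (trans (sym (∑.∑-distrib-+ (λ a → vtx j a at 1 from u) _))
        (trans (sum-cong-≗ λ a → trans (at-1or2 u (vtx j a))
                 (cong (λ i → 𝟙 (¬? (fib u Fin.≟ i))) (fib-vtx j a)))
               (sum-const r _)))
      (sum-at 1 u j)
    sum-at 3 u j = a+b≡c⇒b≡c∸a
      (trans (sym (∑.∑-distrib-+ (λ a → vtx j a at 0 from u) _))
        (trans (sum-cong-≗ λ a → trans (at-0or3 u (vtx j a))
                 (cong (λ i → 𝟙 (fib u Fin.≟ i)) (fib-vtx j a)))
               (sum-const r _)))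
      (sum-at 0 u j)
    sum-at (suc (suc (suc (suc k)))) u j =
      sum-zero ℕ.+-0-commutativeMonoid λ a → at-≥4 u (vtx j a)

    -- Only the position of the fibre of `u` among all fibres enters, and summing over the fibres
    -- removes it.
    ∑ⱽ-at : ∀ k u u′ → ∑ⱽ (_at k from u) ≡ ∑ⱽ (_at k from u′)
    ∑ⱽ-at k u u′ = begin
      ∑ⱽ (_at k from u)                              ≡⟨ sum-cong-≗ (sum-at k u) ⟩
      sum (λ j → fibreCount k (does (fib u Fin.≟ j)))  ≡⟨ sum-does-≟ (fibreCount k) (fib u) (fib u′) ⟩
      sum (λ j → fibreCount k (does (fib u′ Fin.≟ j))) ≡⟨ sum-cong-≗ (sum-at k u′) ⟨
      ∑ⱽ (_at k from u′)                             ∎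
      where open ≡-Reasoning

    -- The intersection numbers, not yet known to depend only on the distance of `u` and `v`.
    N : ℕ → ℕ → V → V → ℕ
    N i j u v = ∑ⱽ λ w → w at i from u * w at j from v

    N-swap : ∀ i j → Determined (N i j) → Determined (N j i)
    N-swap i j det {u} {v} {u′} {v′} eq = trans (swap u v)
      (trans (det (trans (dist-sym v u) (trans eq (dist-sym u′ v′)))) (sym (swap u′ v′)))
      where
      swap : ∀ u v → N j i u v ≡ N i j v u
      swap u v = ∑ⱽ-cong λ w → ℕ.*-comm (w at j from u) (w at i from v)

    N-0 : ∀ j → Determined (N 0 j)
    N-0 j {u} {v} {u′} {v′} eq = trans (value u v) (trans
      (cong (λ d → 𝟙 (d ℕ.≟ j)) (trans (dist-sym v u) (trans eq (dist-sym u′ v′))))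
      (sym (value u′ v′)))
      where
      value : ∀ u v → N 0 j u v ≡ u at j from v
      value u v = trans
        (∑ⱽ-single u λ w w≢u → cong (_* w at j from v) (at-0-≢ w≢u))
        (trans (cong (_* u at j from v) (at-0-≡ u)) (ℕ.*-identityˡ _))

    -- Distance 0 or 3 from `v` means lying in its fibre, so the sum counts the vertices of that
    -- fibre at distance `i` from `u`.
    N-0+N-3 : ∀ i u v → N i 0 u v + N i 3 u v ≡ fibreCount i (does (fib u Fin.≟ fib v))
    N-0+N-3 i u v = begin
      N i 0 u v + N i 3 u v
        ≡⟨ ∑ⱽ-+ (λ w → w at i from u * w at 0 from v) (λ w → w at i from u * w at 3 from v) ⟨
      ∑ⱽ (λ w → w at i from u * w at 0 from v + w at i from u * w at 3 from v)
        ≡⟨ ∑ⱽ-cong (λ w → trans (sym (ℕ.*-distribˡ-+ (w at i from u) (w at 0 from v) (w at 3 from v)))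
             (cong (w at i from u *_) (at-0or3 v w))) ⟩
      ∑ⱽ (λ w → w at i from u * 𝟙 (fib v Fin.≟ fib w))
        ≡⟨ sum-cong-≗ (λ j → trans
             (sum-cong-≗ λ a → cong (λ k → vtx j a at i from u * 𝟙 (fib v Fin.≟ k)) (fib-vtx j a))
             (trans (sym (∑.*-distribʳ-sum (𝟙 (fib v Fin.≟ j)) (λ a → vtx j a at i from u)))
                    (cong (_* 𝟙 (fib v Fin.≟ j)) (sum-at i u j)))) ⟩
      sum (λ j → fibreCount i (does (fib u Fin.≟ j)) * 𝟙 (fib v Fin.≟ j))
        ≡⟨ sum-single ℕ.+-0-commutativeMonoid (fib v) (λ j j≢v → trans
             (cong (fibreCount i (does (fib u Fin.≟ j)) *_) (𝟙-false (fib v Fin.≟ j) (j≢v ∘ sym)))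
             (ℕ.*-zeroʳ (fibreCount i (does (fib u Fin.≟ j))))) ⟩
      fibreCount i (does (fib u Fin.≟ fib v)) * 𝟙 (fib v Fin.≟ fib v)
        ≡⟨ trans (cong (fibreCount i (does (fib u Fin.≟ fib v)) *_) (𝟙-true (fib v Fin.≟ fib v) refl))
                 (ℕ.*-identityʳ _) ⟩
      fibreCount i (does (fib u Fin.≟ fib v))
        ∎
      where open ≡-Reasoning

    N-3 : ∀ i → Determined (N i 3)
    N-3 i = Determined-cancelˡ (N i 0)
      (λ {u} {v} {u′} {v′} eq → trans (N-0+N-3 i u v) (trans
        (cong (fibreCount i) (does-⇔ (same eq) (fib u Fin.≟ fib v) (fib u′ Fin.≟ fib v′)))
        (sym (N-0+N-3 i u′ v′))))
      (N-swap 0 i (N-0 i))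
      where
      same : ∀ {u v u′ v′} → dist u v ≡ dist u′ v′ → (fib u ≡ fib v) ⇔ (fib u′ ≡ fib v′)
      same eq = mk⇔ (Position-fibre (position-dist eq) (proj₂ (position _ _)))
                    (Position-fibre (proj₂ (position _ _)) (position-dist eq))

    N-row : ∀ i u v → N i 0 u v + N i 3 u v + (N i 1 u v + N i 2 u v) ≡ ∑ⱽ (_at i from u)
    N-row i u v = begin
      N i 0 u v + N i 3 u v + (N i 1 u v + N i 2 u v)
        ≡⟨ cong₂ _+_ (∑ⱽ-+ (f 0) (f 3)) (∑ⱽ-+ (f 1) (f 2)) ⟨
      ∑ⱽ (λ w → f 0 w + f 3 w) + ∑ⱽ (λ w → f 1 w + f 2 w)
        ≡⟨ ∑ⱽ-+ (λ w → f 0 w + f 3 w) (λ w → f 1 w + f 2 w) ⟨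
      ∑ⱽ (λ w → f 0 w + f 3 w + (f 1 w + f 2 w))
        ≡⟨ ∑ⱽ-cong (λ w → trans (factor (w at i from u) (w at 0 from v) (w at 3 from v) (w at 1 from v) (w at 2 from v))
             (trans (cong (w at i from u *_) (at-any v w)) (ℕ.*-identityʳ (w at i from u)))) ⟩
      ∑ⱽ (_at i from u)
        ∎
      where
      open ≡-Reasoning
      f : ℕ → V → ℕ
      f j w = w at i from u * w at j from v

      factor : ∀ x a b c d → x * a + x * b + (x * c + x * d) ≡ x * (a + b + (c + d))
      factor = solve-∀

    -- `N-row` gives the sum of all four columns; columns 0 and 3 are known, so column 1 determines
    -- column 2.
    N-1⇒N-2 : ∀ i → Determined (N i 1) → Determined (N i 2)
    N-1⇒N-2 i N-1 = Determined-cancelˡ (N i 1)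
      (Determined-cancelˡ (λ u v → N i 0 u v + N i 3 u v)
        (λ {u} {v} {u′} {v′} eq → trans (N-row i u v) (trans (∑ⱽ-at i u u′) (sym (N-row i u′ v′))))
        (λ eq → cong₂ _+_ (N-swap 0 i (N-0 i) eq) (N-3 i eq)))
      N-1

    N-≥4 : ∀ i j → Determined (N (4 + i) j)
    N-≥4 i j {u} {v} {u′} {v′} _ = trans (zero≡ u v) (sym (zero≡ u′ v′))
      where
      zero≡ : ∀ u v → N (4 + i) j u v ≡ 0
      zero≡ u v = sum-zero ℕ.+-0-commutativeMonoid λ k → sum-zero ℕ.+-0-commutativeMonoid λ a →
        cong (_* vtx k a at j from v) (at-≥4 u (vtx k a))

    N-common : ∀ u v → N 1 1 u v ≡ # (common? u v)
    N-common u v = ∑ⱽ-cong λ w → trans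
      (cong₂ _*_ (at-1 u w) (at-1 v w)) (sym (𝟙-× (adj? u w) (adj? v w)))

    module _ (common-determined : Determined λ u v → # (common? u v)) where

      -- Rows and columns 0 and 3 are settled; the hypothesis is the entry (1, 1), from which (1,
      -- 2), then by symmetry (2, 1), then (2, 2) follow.
      N-determined : ∀ i j → Determined (N i j)
      N-determined 0 j = N-0 j
      N-determined i 0 = N-swap 0 i (N-0 i)
      N-determined 3 j = N-swap j 3 (N-3 j)
      N-determined i 3 = N-3 i
      N-determined 1 1 {u} {v} {u′} {v′} eq =
        trans (N-common u v) (trans (common-determined eq) (sym (N-common u′ v′)))
      N-determined 1 2 = N-1⇒N-2 1 (N-determined 1 1)
      N-determined 2 1 = N-swap 1 2 (N-determined 1 2)
      N-determined 2 2 = N-1⇒N-2 2 (N-determined 2 1)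
      N-determined (suc (suc (suc (suc i)))) j = N-≥4 i j
      N-determined i (suc (suc (suc (suc j)))) = N-swap (4 + j) i (N-≥4 j i)

  -- The value is n - 1 for equal vertices and 0 for antipodal ones; `common-adjacent` turns the
  -- constant for remote pairs into one for adjacent pairs.
  common-determined : ∀ {c} →
    (∀ {u v} → fib u ≢ fib v → ¬ Adj u v → # (common? u v) ≡ c) →
    Counting.Determined λ u v → # (common? u v)
  common-determined {c} common-remote eq = same (position-dist eq) (proj₂ (position _ _))
    where
    same : ∀ {u v u′ v′ k} → Position u v k → Position u′ v′ k → # (common? u v) ≡ # (common? u′ v′)
    same {u} {_} {u′} (equal refl) (equal refl) =
      ℕ.suc-injective (trans (common-self u) (sym (common-self u′)))
    same (adjacent u~v) (adjacent u′~v′) = ℕ.+-cancelʳ-≡ (r * c) _ _ (ℕ.+-cancelʳ-≡ 2 _ _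
      (trans (common-adjacent common-remote u~v) (sym (common-adjacent common-remote u′~v′))))
    same (remote u≢v u≁v) (remote u′≢v′ u′≁v′) =
      trans (common-remote u≢v u≁v) (sym (common-remote u′≢v′ u′≁v′))
    same (antipodal u≡v u≢v) (antipodal u′≡v′ u′≢v′) =
      trans (common-same-fibre u≡v u≢v) (sym (common-same-fibre u′≡v′ u′≢v′))

  module _ (2≤n : 2 ≤ n)
    (linked : ∀ {u v} → fib u ≢ fib v → ¬ Adj u v → ∃ λ w → Adj u w × Adj w v) where

    private
      otherFibre : ∀ {m} → 2 ≤ m → (i : Fin m) → ∃ λ j → i ≢ j
      otherFibre (s≤s (s≤s _)) zero    = suc zero , λ ()
      otherFibre (s≤s (s≤s _)) (suc i) = zero , λ ()

    position-distance : ∀ {u v k} → Position u v k → Distance G u v k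
    position-distance (equal refl) = [] , λ _ → z≤n
    position-distance (adjacent u~v) = u~v ∷ [] , λ where
      []      → contradiction refl (independent u~v)
      (_ ∷ _) → s≤s z≤n
    position-distance (remote u≢v u≁v) with w , u~w , w~v ← linked u≢v u≁v =
      u~w ∷ (w~v ∷ []) , 2≤walk u≢v u≁v
    position-distance {u} {v} (antipodal u≡v u≢v)
      -- The walk first leaves for a neighbour in another fibre. That vertex is not adjacent to `v`,
      -- or it would have two neighbours in one fibre, so `linked` completes the walk.
      with j , u≢j ← otherFibre 2≤n (fib u)
      with a , u~a , _ ← neighbour u u≢j
      with w , a~w , w~v ← linked
             (λ a≡v → u≢j (trans u≡v (trans (sym a≡v) (fib-vtx j a))))
             (λ a~v → u≢v (same-fibre-neighbour (symm u~a) a~v u≡v)) =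
      u~a ∷ (a~w ∷ (w~v ∷ [])) , 3≤walk u≡v u≢v

    distance : ∀ u v → Distance G u v (dist u v)
    distance u v = position-distance (proj₂ (position u v))

    dist-distance : ∀ {u v k} → Distance G u v k → dist u v ≡ k
    dist-distance = Distance-unique (distance _ _)

    module _ (2≤r : 2 ≤ r) where

      diameter-3 : Diameter G 3
      diameter-3 = (λ u v → dist u v , distance u v , dist≤3 (proj₂ (position u v))) , far 2≤n 2≤r
        where
        dist≤3 : ∀ {u v k} → Position u v k → k ≤ 3
        dist≤3 (equal _)       = z≤n
        dist≤3 (adjacent _)    = s≤s z≤n
        dist≤3 (remote _ _)    = s≤s (s≤s z≤n)
        dist≤3 (antipodal _ _) = s≤s (s≤s (s≤s z≤n))

        distinct : ∀ {i a b} → a ≢ b → ∃₂ λ u v → Distance G u v 3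
        distinct {i} {a} {b} a≢b = vtx i a , vtx i b , position-distance
          (antipodal (trans (fib-vtx i a) (sym (fib-vtx i b))) (a≢b ∘ vtx-injective))

        far : 2 ≤ n → 2 ≤ r → ∃₂ λ u v → Distance G u v 3
        far (s≤s _) (s≤s (s≤s _)) = distinct {zero} {zero} {suc zero} λ ()

      antipodal-cover : IsAntipodalCover G L
      antipodal-cover = record
        { isCover = isCover
        ; isAntipodal = record
          { connected  = λ u v → dist u v , proj₁ (distance u v)
          ; diameter   = 3
          ; isDiameter = diameter-3
          ; antipodal  = λ u≢v → mk⇔
              (λ u-v → fibre≡ (position-dist (dist-distance u-v)))
              (λ u≡v → position-distance (antipodal u≡v u≢v))
          }
        }
        where
        fibre≡ : ∀ {u v} → Position u v 3 → fib u ≡ fib v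
        fibre≡ (antipodal u≡v _) = u≡v

    distance-regular : Counting.Determined (λ u v → # (common? u v)) → DistanceRegular G
    distance-regular det d i j
      with p , value ← Counting.Determined-value (Counting.N-determined det i j) d =
      p , λ u v u-v → HasCardinality-cong
        (λ w → mk⇔ (λ (eq , eq′) → subst (Distance G u w) eq (distance u w) ,
                                     subst (Distance G v w) eq′ (distance v w))
                   (λ (u-w , v-w) → dist-distance u-w , dist-distance v-w))
        (subst (HasCardinality _)
          (trans (∑ⱽ-cong λ w → 𝟙-× (dist u w ℕ.≟ i) (dist v w ℕ.≟ j))
                 (value u v (dist-distance u-v)))
          (#-HasCardinality λ w → dist u w ℕ.≟ i ×-dec dist v w ℕ.≟ j))

-- The group ring

module FiniteAbelianGroupProperties {r : ℕ} (Γ : FiniteAbelianGroup r) where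
  open FiniteAbelianGroup Γ public
  open IsAbelianGroup isAbelianGroup public
    using (assoc; comm; identityˡ; identityʳ; inverseˡ; inverseʳ)

  abelianGroup : AbelianGroup 0ℓ 0ℓ
  abelianGroup = record { isAbelianGroup = isAbelianGroup }

  open AbelianGroupProperties abelianGroup public
    using (⁻¹-involutive; ⁻¹-∙-comm; ∙-cancelˡ; ∙-cancelʳ; inverseʳ-unique; ε⁻¹≈ε;
           \\-leftDividesˡ; \\-leftDividesʳ; //-rightDividesˡ; //-rightDividesʳ; x≈z//y)

module GroupRing (K : CommutativeRing 0ℓ 0ℓ) {r : ℕ} (Γ : FiniteAbelianGroup r) where
  open CommutativeRing K
    using (_≈_; 0#; 1#; +-cong; +-assoc; +-comm; *-cong; *-congˡ; *-congʳ; *-assoc; *-comm;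
           *-identityˡ; zeroˡ; setoid)
    renaming (Carrier to Scalar; _+_ to _+ᴷ_; _*_ to _*ᴷ_; refl to ≈-refl; sym to ≈-sym;
              trans to ≈-trans; reflexive to ≈-reflexive)
  open RouxOver K using (∑Γ; groupRing; ⟦_⟧)
  open FiniteAbelianGroupProperties Γ
  open Inverse enumeration using () renaming (from to element; to to index)
  open SetoidReasoning setoid

  private
    module ∑ᴷ = SemiringSum (CommutativeRing.semiring K)
    +-commutativeMonoid = CommutativeRing.+-commutativeMonoid K

    ∑ : (Carrier → Scalar) → Scalar
    ∑ = ∑Γ Γ

  ∑-cong : ∀ {f f′} → (∀ x → f x ≈ f′ x) → ∑ f ≈ ∑ f′
  ∑-cong f≈f′ = ∑ᴷ.sum-cong-≋ λ a → f≈f′ (element a)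

  ∑-+ : ∀ f f′ → ∑ (λ x → f x +ᴷ f′ x) ≈ ∑ f +ᴷ ∑ f′
  ∑-+ f f′ = ∑ᴷ.∑-distrib-+ (λ a → f (element a)) (λ a → f′ (element a))

  *-∑ : ∀ k f → k *ᴷ ∑ f ≈ ∑ (λ x → k *ᴷ f x)
  *-∑ k f = ∑ᴷ.*-distribˡ-sum k (λ a → f (element a))

  ∑-* : ∀ f k → ∑ f *ᴷ k ≈ ∑ (λ x → f x *ᴷ k)
  ∑-* f k = ∑ᴷ.*-distribʳ-sum k (λ a → f (element a))

  ∑-swap : ∀ (f : Carrier → Carrier → Scalar) → ∑ (λ x → ∑ (f x)) ≈ ∑ (λ y → ∑ λ x → f x y)
  ∑-swap f = ∑ᴷ.∑-comm (λ a b → f (element a) (element b))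

  ∑-zero : ∀ {f} → (∀ x → f x ≈ 0#) → ∑ f ≈ 0#
  ∑-zero f≈0 = sum-zero +-commutativeMonoid λ a → f≈0 (element a)

  ∑-single : ∀ {f} x → (∀ y → y ≢ x → f y ≈ 0#) → ∑ f ≈ f x
  ∑-single {f} x f≈0 = ≈-trans
    (sum-single +-commutativeMonoid (index x) λ a a≢x → f≈0 (element a)
      λ eq → a≢x (trans (sym (Inverse.strictlyInverseˡ enumeration a)) (cong index eq)))
    (≈-reflexive (cong f (Inverse.strictlyInverseʳ enumeration x)))

  ∑-reindex : ∀ f (φ : Carrier ↔ Carrier) → ∑ f ≈ ∑ (f ∘ Inverse.to φ)
  ∑-reindex f φ = ≈-trans
    (∑ᴷ.sum-permute (f ∘ element) π)
    (∑ᴷ.sum-cong-≋ λ a → ≈-reflexive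
      (cong f (Inverse.strictlyInverseʳ enumeration (Inverse.to φ (element a)))))
    where
    π : Permutation′ r
    π = enumeration ↔-∘ (φ ↔-∘ ↔-sym enumeration)

  translation : Carrier → Carrier ↔ Carrier
  translation x = mk↔ₛ′ (x ∙_) (x ⁻¹ ∙_) (\\-leftDividesˡ x) (\\-leftDividesʳ x)

  -- The involution x ↦ x⁻¹ g, which exchanges the factors of a convolution.
  reflection : Carrier → Carrier ↔ Carrier
  reflection g = mk↔ₛ′ ρ ρ involutive involutive
    where
    ρ : Carrier → Carrier
    ρ x = x ⁻¹ ∙ g

    involutive : ∀ x → ρ (ρ x) ≡ x
    involutive x = trans (cong (_∙ g) (trans (sym (⁻¹-∙-comm (x ⁻¹) g)) (cong (_∙ g ⁻¹) (⁻¹-involutive x))))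
      (//-rightDividesˡ g x)

  open RawRing (groupRing Γ) using ()
    renaming (Carrier to ℜ; _≈_ to _≈ᴳ_; _+_ to _+ᴳ_; _*_ to _*ᴳ_; -_ to -ᴳ_; 0# to 0ᴳ; 1# to 1ᴳ)

  δ : Carrier → ℜ
  δ = ⟦_⟧ Γ

  δ-≡ : ∀ {x g} → x ≡ g → δ x g ≈ 1#
  δ-≡ {x} {g} x≡g = ≈-reflexive (cong (if_then 1# else 0#) (dec-true (x ≟ g) x≡g))

  δ-≢ : ∀ {x g} → x ≢ g → δ x g ≈ 0#
  δ-≢ {x} {g} x≢g = ≈-reflexive (cong (if_then 1# else 0#) (dec-false (x ≟ g) x≢g))

  δ-⇔ : ∀ {x g y h} → x ≡ g ⇔ y ≡ h → δ x g ≈ δ y h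
  δ-⇔ {x} {g} {y} {h} eq = ≈-reflexive (cong (if_then 1# else 0#) (does-⇔ eq (x ≟ g) (y ≟ h)))

  δ-* : ∀ x f g → (δ x *ᴳ f) g ≈ f (x ⁻¹ ∙ g)
  δ-* x f g = begin
    ∑ (λ h → δ x h *ᴷ f (h ⁻¹ ∙ g))
      ≈⟨ ∑-single x (λ h h≢x → ≈-trans (*-congʳ (δ-≢ (h≢x ∘ sym))) (zeroˡ _)) ⟩
    δ x x *ᴷ f (x ⁻¹ ∙ g)
      ≈⟨ ≈-trans (*-congʳ (δ-≡ refl)) (*-identityˡ _) ⟩
    f (x ⁻¹ ∙ g)
      ∎

  δ-δ : ∀ x y → (δ x *ᴳ δ y) ≈ᴳ δ (x ∙ y)
  δ-δ x y g = ≈-trans (δ-* x (δ y) g) (δ-⇔ (mk⇔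
    (λ y≡ → trans (cong (x ∙_) y≡) (\\-leftDividesˡ x g))
    (λ xy≡g → trans (sym (\\-leftDividesʳ x y)) (cong (x ⁻¹ ∙_) xy≡g))))

  *ᴳ-cong : ∀ {f f′ k k′} → f ≈ᴳ f′ → k ≈ᴳ k′ → (f *ᴳ k) ≈ᴳ (f′ *ᴳ k′)
  *ᴳ-cong f≈f′ k≈k′ g = ∑-cong λ h → *-cong (f≈f′ h) (k≈k′ (h ⁻¹ ∙ g))

  *ᴳ-comm : ∀ f f′ → (f *ᴳ f′) ≈ᴳ (f′ *ᴳ f)
  *ᴳ-comm f f′ g = begin
    ∑ (λ h → f h *ᴷ f′ (h ⁻¹ ∙ g))
      ≈⟨ ∑-cong (λ h → *-comm (f h) (f′ (h ⁻¹ ∙ g))) ⟩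
    ∑ (λ h → f′ (h ⁻¹ ∙ g) *ᴷ f h)
      ≈⟨ ∑-cong (λ h → *-congˡ {f′ (h ⁻¹ ∙ g)} (≈-reflexive (cong f
           (sym (Inverse.strictlyInverseˡ (reflection g) h))))) ⟩
    ∑ (λ h → f′ (h ⁻¹ ∙ g) *ᴷ f ((h ⁻¹ ∙ g) ⁻¹ ∙ g))
      ≈⟨ ∑-reindex (λ h → f′ h *ᴷ f (h ⁻¹ ∙ g)) (reflection g) ⟨
    ∑ (λ h → f′ h *ᴷ f (h ⁻¹ ∙ g))
      ∎

  *ᴳ-assoc : ∀ f f′ f″ → ((f *ᴳ f′) *ᴳ f″) ≈ᴳ (f *ᴳ (f′ *ᴳ f″))
  *ᴳ-assoc f f′ f″ g = begin
    ∑ (λ h → ∑ (λ k → f k *ᴷ f′ (k ⁻¹ ∙ h)) *ᴷ f″ (h ⁻¹ ∙ g))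
      ≈⟨ ∑-cong (λ h → ≈-trans 
           (∑-* (λ k → f k *ᴷ f′ (k ⁻¹ ∙ h)) (f″ (h ⁻¹ ∙ g)))
           (∑-cong λ k → *-assoc (f k) (f′ (k ⁻¹ ∙ h)) (f″ (h ⁻¹ ∙ g)))) ⟩
    ∑ (λ h → ∑ λ k → f k *ᴷ (f′ (k ⁻¹ ∙ h) *ᴷ f″ (h ⁻¹ ∙ g)))
      ≈⟨ ∑-swap (λ h k → f k *ᴷ (f′ (k ⁻¹ ∙ h) *ᴷ f″ (h ⁻¹ ∙ g))) ⟩
    ∑ (λ k → ∑ λ h → f k *ᴷ (f′ (k ⁻¹ ∙ h) *ᴷ f″ (h ⁻¹ ∙ g)))
      ≈⟨ ∑-cong (λ k → ≈-trans
           (≈-sym (*-∑ (f k) (λ h → f′ (k ⁻¹ ∙ h) *ᴷ f″ (h ⁻¹ ∙ g))))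
           (*-congˡ (shift k))) ⟩
    ∑ (λ k → f k *ᴷ ∑ λ l → f′ l *ᴷ f″ (l ⁻¹ ∙ (k ⁻¹ ∙ g)))
      ∎
    where
    -- The inner sum is reindexed by h = k l.
    shift : ∀ k → ∑ (λ h → f′ (k ⁻¹ ∙ h) *ᴷ f″ (h ⁻¹ ∙ g))
                ≈ ∑ (λ l → f′ l *ᴷ f″ (l ⁻¹ ∙ (k ⁻¹ ∙ g)))
    shift k = ≈-trans (∑-reindex (λ h → f′ (k ⁻¹ ∙ h) *ᴷ f″ (h ⁻¹ ∙ g)) (translation k))
      (∑-cong λ l → *-cong
        (≈-reflexive (cong f′ (\\-leftDividesʳ k l)))
        (≈-reflexive (cong f″ (trans (cong (_∙ g)
          (trans (sym (⁻¹-∙-comm k l)) (comm (k ⁻¹) (l ⁻¹)))) (assoc (l ⁻¹) (k ⁻¹) g)))))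

  *ᴳ-identityˡ : ∀ f → (1ᴳ *ᴳ f) ≈ᴳ f
  *ᴳ-identityˡ f g = ≈-trans (δ-* ε f g)
    (≈-reflexive (cong f (trans (cong (_∙ g) ε⁻¹≈ε) (identityˡ g))))

  *ᴳ-distribˡ : ∀ f k l → (f *ᴳ (k +ᴳ l)) ≈ᴳ ((f *ᴳ k) +ᴳ (f *ᴳ l))
  *ᴳ-distribˡ f k l g = ≈-trans
    (∑-cong λ h → CommutativeRing.distribˡ K (f h) (k (h ⁻¹ ∙ g)) (l (h ⁻¹ ∙ g)))
    (∑-+ (λ h → f h *ᴷ k (h ⁻¹ ∙ g)) (λ h → f h *ᴷ l (h ⁻¹ ∙ g)))

  ≈ᴳ-setoid : Setoid 0ℓ 0ℓ
  ≈ᴳ-setoid = record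
    { Carrier       = ℜ
    ; _≈_           = _≈ᴳ_
    ; isEquivalence = record
      { refl  = λ g → ≈-refl
      ; sym   = λ p g → ≈-sym (p g)
      ; trans = λ p q g → ≈-trans (p g) (q g)
      }
    }

  groupRing-commutativeRing : CommutativeRing 0ℓ 0ℓ
  groupRing-commutativeRing = record
    { Carrier = ℜ
    ; _≈_ = _≈ᴳ_
    ; _+_ = _+ᴳ_
    ; _*_ = _*ᴳ_
    ; -_  = -ᴳ_
    ; 0#  = 0ᴳ
    ; 1#  = 1ᴳ
    ; isCommutativeRing = record
      { isRing = record
        { +-isAbelianGroup = record
          { isGroup = record
            { isMonoid = record
              { isSemigroup = record
                { isMagma = record
                  { isEquivalence = Setoid.isEquivalence ≈ᴳ-setoid
                  ; ∙-cong = λ p q g → +-cong (p g) (q g)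
                  }
                ; assoc = λ f k l g → +-assoc (f g) (k g) (l g)
                }
              ; identity = (λ f g → CommutativeRing.+-identityˡ K (f g))
                         , (λ f g → CommutativeRing.+-identityʳ K (f g))
              }
            ; inverse = (λ f g → CommutativeRing.-‿inverseˡ K (f g))
                      , (λ f g → CommutativeRing.-‿inverseʳ K (f g))
            ; ⁻¹-cong = λ p g → CommutativeRing.-‿cong K (p g)
            }
          ; comm = λ f k g → +-comm (f g) (k g)
          }
        ; *-cong = *ᴳ-cong
        ; *-assoc = *ᴳ-assoc
        ; *-identity = comm∧idˡ⇒id *ᴳ-comm {e = 1ᴳ} *ᴳ-identityˡ
        ; distrib = comm∧distrˡ⇒distr (λ p q g → +-cong (p g) (q g)) *ᴳ-comm *ᴳ-distribˡ
        }
      ; *-comm = *ᴳ-comm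
      }
    }
    where
    open Consequences ≈ᴳ-setoid using (comm∧idˡ⇒id; comm∧distrˡ⇒distr)

-- Matrices spanned by the identity and one matrix

module MatrixProperties (R : CommutativeRing 0ℓ 0ℓ) {n : ℕ} where
  open CommutativeRing R
    using (_≈_; 0#; 1#; +-cong; *-cong; *-congˡ; *-congʳ; *-identityˡ; *-identityʳ; zeroˡ; zeroʳ;
           setoid; rawRing)
    renaming (Carrier to A; _+_ to _⊞_; _*_ to _⊠_; refl to ≈-refl; trans to ≈-trans;
              reflexive to ≈-reflexive)
  open MatrixAlgebra rawRing n
  open SetoidReasoning setoid
  open SemiringSolver (CommutativeRing.commutativeSemiring R) using (solve; _:+_; _:*_; _:=_)

  private
    module ∑ᴿ = SemiringSum (CommutativeRing.semiring R)
    +-commutativeMonoid = CommutativeRing.+-commutativeMonoid R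

  1ᴹ-≡ : ∀ {i j} → i ≡ j → 1ᴹ i j ≈ 1#
  1ᴹ-≡ {i} {j} i≡j = ≈-reflexive (cong (if_then 1# else 0#) (dec-true (i Fin.≟ j) i≡j))

  1ᴹ-≢ : ∀ {i j} → i ≢ j → 1ᴹ i j ≈ 0#
  1ᴹ-≢ {i} {j} i≢j = ≈-reflexive (cong (if_then 1# else 0#) (dec-false (i Fin.≟ j) i≢j))

  *ᴹ-identityˡ : ∀ M → (1ᴹ *ᴹ M) ≈ᴹ M
  *ᴹ-identityˡ M i j = ≈-trans
    (sum-single +-commutativeMonoid i λ k k≢i → ≈-trans (*-congʳ (1ᴹ-≢ (k≢i ∘ sym))) (zeroˡ _))
    (≈-trans (*-congʳ (1ᴹ-≡ {i} refl)) (*-identityˡ _))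

  *ᴹ-identityʳ : ∀ M → (M *ᴹ 1ᴹ) ≈ᴹ M
  *ᴹ-identityʳ M i j = ≈-trans
    (sum-single +-commutativeMonoid j λ k k≢j → ≈-trans (*-congˡ (1ᴹ-≢ k≢j)) (zeroʳ _))
    (≈-trans (*-congˡ (1ᴹ-≡ {j} refl)) (*-identityʳ _))

  module _ {B : Matrix} {ν κ : A} (B² : (B *ᴹ B) ≈ᴹ λ i j → (ν ⊠ 1ᴹ i j) ⊞ (κ ⊠ B i j)) where

    -- Multiplying out and replacing B² keeps the product in the span; commutativity of the ring
    -- lets the coefficients pass the matrix entries.
    *ᴹ-span : ∀ a b a′ b′ {M N} →
      M ≈ᴹ (λ i j → (a ⊠ 1ᴹ i j) ⊞ (b ⊠ B i j)) →
      N ≈ᴹ (λ i j → (a′ ⊠ 1ᴹ i j) ⊞ (b′ ⊠ B i j)) →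
      (M *ᴹ N) ≈ᴹ λ i j → (((a ⊠ a′) ⊞ ((b ⊠ b′) ⊠ ν)) ⊠ 1ᴹ i j)
                        ⊞ ((((a ⊠ b′) ⊞ (b ⊠ a′)) ⊞ ((b ⊠ b′) ⊠ κ)) ⊠ B i j)
    *ᴹ-span a b a′ b′ {M} {N} M≈ N≈ i j = begin
      (M *ᴹ N) i j
        ≈⟨ ∑ᴿ.sum-cong-≋ (λ k → ≈-trans (*-cong (M≈ i k) (N≈ k j))
             (expand (1ᴹ i k) (B i k) (1ᴹ k j) (B k j))) ⟩
      ∑ᴿ.sum (λ k → (p k ⊞ q k) ⊞ (s k ⊞ t k))
        ≈⟨ ≈-trans (∑ᴿ.∑-distrib-+ (λ k → p k ⊞ q k) (λ k → s k ⊞ t k))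
             (+-cong (∑ᴿ.∑-distrib-+ p q) (∑ᴿ.∑-distrib-+ s t)) ⟩
      (∑ᴿ.sum p ⊞ ∑ᴿ.sum q) ⊞ (∑ᴿ.sum s ⊞ ∑ᴿ.sum t)
        ≈⟨ +-cong
             (+-cong (∑ᴿ.*-distribˡ-sum (a ⊠ a′) (λ k → 1ᴹ i k ⊠ 1ᴹ k j))
                     (∑ᴿ.*-distribˡ-sum (a ⊠ b′) (λ k → 1ᴹ i k ⊠ B k j)))
             (+-cong (∑ᴿ.*-distribˡ-sum (b ⊠ a′) (λ k → B i k ⊠ 1ᴹ k j))
                     (∑ᴿ.*-distribˡ-sum (b ⊠ b′) (λ k → B i k ⊠ B k j))) ⟨
      (((a ⊠ a′) ⊠ (1ᴹ *ᴹ 1ᴹ) i j) ⊞ ((a ⊠ b′) ⊠ (1ᴹ *ᴹ B) i j))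
        ⊞ (((b ⊠ a′) ⊠ (B *ᴹ 1ᴹ) i j) ⊞ ((b ⊠ b′) ⊠ (B *ᴹ B) i j))
        ≈⟨ +-cong (+-cong (*-congˡ (*ᴹ-identityˡ 1ᴹ i j)) (*-congˡ (*ᴹ-identityˡ B i j)))
                  (+-cong (*-congˡ (*ᴹ-identityʳ B i j)) (*-congˡ (B² i j))) ⟩
      (((a ⊠ a′) ⊠ 1ᴹ i j) ⊞ ((a ⊠ b′) ⊠ B i j))
        ⊞ (((b ⊠ a′) ⊠ B i j) ⊞ ((b ⊠ b′) ⊠ ((ν ⊠ 1ᴹ i j) ⊞ (κ ⊠ B i j))))
        ≈⟨ collect (a ⊠ a′) (a ⊠ b′) (b ⊠ a′) (b ⊠ b′) ν κ (1ᴹ i j) (B i j) ⟩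
      (((a ⊠ a′) ⊞ ((b ⊠ b′) ⊠ ν)) ⊠ 1ᴹ i j)
        ⊞ ((((a ⊠ b′) ⊞ (b ⊠ a′)) ⊞ ((b ⊠ b′) ⊠ κ)) ⊠ B i j)
        ∎
      where
      p q s t : Fin n → A
      p k = (a ⊠ a′) ⊠ (1ᴹ i k ⊠ 1ᴹ k j)
      q k = (a ⊠ b′) ⊠ (1ᴹ i k ⊠ B k j)
      s k = (b ⊠ a′) ⊠ (B i k ⊠ 1ᴹ k j)
      t k = (b ⊠ b′) ⊠ (B i k ⊠ B k j)

      expand : ∀ x y x′ y′ → ((a ⊠ x) ⊞ (b ⊠ y)) ⊠ ((a′ ⊠ x′) ⊞ (b′ ⊠ y′))
        ≈ (((a ⊠ a′) ⊠ (x ⊠ x′)) ⊞ ((a ⊠ b′) ⊠ (x ⊠ y′)))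
          ⊞ (((b ⊠ a′) ⊠ (y ⊠ x′)) ⊞ ((b ⊠ b′) ⊠ (y ⊠ y′)))
      expand = solve 8 (λ a b a′ b′ x y x′ y′ →
        (a :* x :+ b :* y) :* (a′ :* x′ :+ b′ :* y′)
          := ((a :* a′) :* (x :* x′) :+ (a :* b′) :* (x :* y′))
               :+ ((b :* a′) :* (y :* x′) :+ (b :* b′) :* (y :* y′))) ≈-refl a b a′ b′

      collect : ∀ aa ab ba bb ν κ x y →
        ((aa ⊠ x) ⊞ (ab ⊠ y)) ⊞ ((ba ⊠ y) ⊞ (bb ⊠ ((ν ⊠ x) ⊞ (κ ⊠ y))))
        ≈ ((aa ⊞ (bb ⊠ ν)) ⊠ x) ⊞ (((ab ⊞ ba) ⊞ (bb ⊠ κ)) ⊠ y)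
      collect = solve 8 (λ aa ab ba bb ν κ x y →
        (aa :* x :+ ab :* y) :+ (ba :* y :+ bb :* (ν :* x :+ κ :* y))
          := (aa :+ bb :* ν) :* x :+ ((ab :+ ba) :+ bb :* κ) :* y) ≈-refl

module RouxAlgebra (K : CommutativeRing 0ℓ 0ℓ) {r n : ℕ} (Γ : FiniteAbelianGroup r)
  (B : SquareMatrix (Fin n) (FiniteAbelianGroup.Carrier Γ → CommutativeRing.Carrier K)) where
  open CommutativeRing K
    using (_≈_; 0#; 1#; +-cong; *-congˡ; *-assoc; *-identityˡ; zeroˡ; setoid)
    renaming (Carrier to Scalar; _+_ to _+ᴷ_; _*_ to _*ᴷ_; _-_ to _-ᴷ_; sym to ≈-sym; trans to ≈-trans)
  open RouxOver K
  open GroupRing K Γ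
  open FiniteAbelianGroupProperties Γ
  open SetoidReasoning setoid
  open CommutativeRing groupRing-commutativeRing using ()
    renaming (Carrier to ℜ; _≈_ to _≈ᴳ_; _+_ to _+ᴳ_; _*_ to _*ᴳ_; 0# to 0ᴳ; 1# to 1ᴳ)
  open MatrixAlgebra (groupRing Γ) n
  private
    module ℜ = CommutativeRing groupRing-commutativeRing
    module ∑ᴷ = SemiringSum (CommutativeRing.semiring K)
    module ∑ᴳ = SemiringSum ℜ.semiring

  sum-apply : ∀ {m} (F : Fin m → ℜ) g → ∑ᴳ.sum F g ≡ ∑ᴷ.sum (λ k → F k g)
  sum-apply {zero}  F g = refl
  sum-apply {suc m} F g = cong (F zero g +ᴷ_) (sum-apply (F ∘ suc) g)

  -- A family of scalars indexed by Γ is itself an element of the group ring. Hence the scalar span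
  -- of all g I and g B is the set of a I + b B with `a` and `b` in the group ring.
  ∑Γᴹ-⋆ : ∀ (a : ℜ) M → ∑Γᴹ Γ (λ x → _·ᴹ_ Γ (a x) (_⋆_ Γ x M)) ≈ᴹ λ i j → a *ᴳ M i j
  ∑Γᴹ-⋆ a M i j g = ∑-cong λ x → *-congˡ {a x} (δ-* x (M i j) g)

  scalar : Scalar → ℜ
  scalar k g = k *ᴷ 1ᴳ g

  -- Scalars are embedded as multiples of the identity of Γ so that scalar multiples too become
  -- products in the group ring.
  scalar-* : ∀ k f g → (scalar k *ᴳ f) g ≈ k *ᴷ f g
  scalar-* k f g = begin
    ∑Γ Γ (λ h → (k *ᴷ 1ᴳ h) *ᴷ f (h ⁻¹ ∙ g))  ≈⟨ ∑-cong (λ h → *-assoc k (1ᴳ h) (f (h ⁻¹ ∙ g))) ⟩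
    ∑Γ Γ (λ h → k *ᴷ (1ᴳ h *ᴷ f (h ⁻¹ ∙ g)))  ≈⟨ *-∑ k (λ h → 1ᴳ h *ᴷ f (h ⁻¹ ∙ g)) ⟨
    k *ᴷ (1ᴳ *ᴳ f) g                          ≈⟨ *-congˡ {k} (*ᴳ-identityˡ f g) ⟩
    k *ᴷ f g                                  ∎

  private
    Span : ℜ → ℜ → Matrix
    Span a b i j = (a *ᴳ 1ᴹ i j) +ᴳ (b *ᴳ B i j)

    toSpan : ∀ a b {M} →
      M ≈ᴹ (∑Γᴹ Γ (λ g → _·ᴹ_ Γ (a g) (_⋆_ Γ g 1ᴹ)) +ᴹ ∑Γᴹ Γ (λ g → _·ᴹ_ Γ (b g) (_⋆_ Γ g B))) →
      M ≈ᴹ Span a b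
    toSpan a b M≈ i j g = ≈-trans (M≈ i j g) (+-cong (∑Γᴹ-⋆ a 1ᴹ i j g) (∑Γᴹ-⋆ b B i j g))

    inSpan : ∀ a b {M} → M ≈ᴹ Span a b → InSpan Γ B M
    inSpan a b M≈ = a , b , λ i j g →
      ≈-trans (M≈ i j g) (≈-sym (+-cong (∑Γᴹ-⋆ a 1ᴹ i j g) (∑Γᴹ-⋆ b B i j g)))

  parameters⇒R4 : ∀ {c} → HasRouxParameters Γ B c → R4 Γ B
  parameters⇒R4 {c} B² = record
    { 1-closed = inSpan 1ᴳ 0ᴳ λ i j → ℜ.sym (ℜ.trans
        (ℜ.+-cong (ℜ.*-identityˡ (1ᴹ i j)) (ℜ.zeroˡ (B i j))) (ℜ.+-identityʳ (1ᴹ i j)))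
    ; +-closed = λ (a , b , M≈) (a′ , b′ , N≈) → inSpan (a +ᴳ a′) (b +ᴳ b′) λ i j → ℜ.trans
        (ℜ.+-cong (toSpan a b M≈ i j) (toSpan a′ b′ N≈ i j)) (gather a a′ b b′ (1ᴹ i j) (B i j))
    ; ·-closed = λ k (a , b , M≈) → inSpan (scalar k *ᴳ a) (scalar k *ᴳ b) λ i j → ℜ.trans
        (λ g → ≈-trans (*-congˡ {k} (toSpan a b M≈ i j g)) (≈-sym (scalar-* k (Span a b i j) g)))
        (factor (scalar k) a b (1ᴹ i j) (B i j))
    ; *-closed = λ (a , b , M≈) (a′ , b′ , N≈) → inSpan
        -- Coefficients of (a I + b B)(a′ I + b′ B) after B² is replaced by ν I + c B.
        ((a *ᴳ a′) +ᴳ ((b *ᴳ b′) *ᴳ ν)) (((a *ᴳ b′) +ᴳ (b *ᴳ a′)) +ᴳ ((b *ᴳ b′) *ᴳ c))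
        (MatrixProperties.*ᴹ-span groupRing-commutativeRing {n} {B} {ν} {c} B²-span
          a b a′ b′ (toSpan a b M≈) (toSpan a′ b′ N≈))
    }
    where
    open SemiringSolver ℜ.commutativeSemiring using (solve; _:+_; _:*_; _:=_)

    gather : ∀ a a′ b b′ x y → (((a *ᴳ x) +ᴳ (b *ᴳ y)) +ᴳ ((a′ *ᴳ x) +ᴳ (b′ *ᴳ y)))
                             ≈ᴳ (((a +ᴳ a′) *ᴳ x) +ᴳ ((b +ᴳ b′) *ᴳ y))
    gather = solve 6 (λ a a′ b b′ x y → (a :* x :+ b :* y) :+ (a′ :* x :+ b′ :* y)
                                     := (a :+ a′) :* x :+ (b :+ b′) :* y) ℜ.refl

    factor : ∀ k a b x y → (k *ᴳ ((a *ᴳ x) +ᴳ (b *ᴳ y))) ≈ᴳ (((k *ᴳ a) *ᴳ x) +ᴳ ((k *ᴳ b) *ᴳ y))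
    factor = solve 5 (λ k a b x y → k :* (a :* x :+ b :* y) := (k :* a) :* x :+ (k :* b) :* y) ℜ.refl

    ν : ℜ
    ν = scalar (fromℕ n -ᴷ 1#)

    B²-span : (B *ᴹ B) ≈ᴹ Span ν c
    B²-span i j g = ≈-trans (B² i j g)
      (+-cong (≈-sym (scalar-* (fromℕ n -ᴷ 1#) (1ᴹ i j) g)) (∑Γᴹ-⋆ c B i j g))

-- Monodromy and gain graphs

module CoverMonodromy {V : Set} {n r : ℕ} {G : Graph V} {L : Labelling V n r}
  (isCover : IsCover G L) where
  open Graph G
  open IsCover isCover
  open Cover isCover
  open Inverse L using (strictlyInverseˡ) renaming (to to label)

  private
    -- `cross` goes from the fibre `j` to the fibre `i`, as `Block` asks for a permutation acting on
    -- columns.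
    cross : ∀ {i j} → i ≢ j → Fin r → Fin r
    cross {i} {j} i≢j b = proj₁ (neighbour (vtx j b) (i≢j ∘ sym ∘ trans (sym (fib-vtx j b))))

    cross-adjacent : ∀ {i j} (i≢j : i ≢ j) b → Adj (vtx j b) (vtx i (cross i≢j b))
    cross-adjacent {i} {j} i≢j b =
      proj₁ (proj₂ (neighbour (vtx j b) (i≢j ∘ sym ∘ trans (sym (fib-vtx j b)))))

    cross-unique : ∀ {i j} (i≢j : i ≢ j) {a b} → Adj (vtx j b) (vtx i a) → cross i≢j b ≡ a
    cross-unique {i} {j} i≢j {a} {b} =
      proj₂ (proj₂ (neighbour (vtx j b) (i≢j ∘ sym ∘ trans (sym (fib-vtx j b))))) a

  blockPermutation : ∀ {i j} → i ≢ j → Permutation′ r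
  blockPermutation i≢j = Perm.permutation (cross i≢j) (cross (i≢j ∘ sym))
    (λ a → cross-unique i≢j (symm (cross-adjacent (i≢j ∘ sym) a)))
    (λ b → cross-unique (i≢j ∘ sym) (symm (cross-adjacent i≢j b)))

  block : ∀ {i j} (i≢j : i ≢ j) → Block G L i j (blockPermutation i≢j)
  block i≢j a b = mk⇔
    (λ a~b → sym (cross-unique i≢j (symm a~b)))
    (λ { refl → symm (cross-adjacent i≢j b) })

  module _ {i₀ : Fin n} (i₀≡0 : toℕ i₀ ≡ 0) where

    diagonal : ∀ i → ∃ (DiagonalBlock G L i)
    diagonal i with toℕ i ℕ.≟ 0
    ... | yes i≡0 = Perm.id , first i≡0
    ... | no i≢0  = blockPermutation i₀≢i , later i₀≡0 i≢0 (block i₀≢i)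
      where
      i₀≢i : i₀ ≢ i
      i₀≢i refl = i≢0 i₀≡0

    normalise : Fin n → Permutation′ r
    normalise i = proj₁ (diagonal i)

    normalise-first : ∀ a → normalise i₀ ⟨$⟩ʳ a ≡ a
    normalise-first a with toℕ i₀ ℕ.≟ 0
    ... | yes _    = refl
    ... | no i₀≢0 = contradiction i₀≡0 i₀≢0

    -- The position in the fibre with respect to the normalised matrix D A D⁻¹.
    height : Fin n × Fin r → Fin r
    height (i , a) = normalise i ⟨$⟩ʳ a

    -- Traversing an edge changes the height by a generator of Π. The permutation carries the height
    -- of the end of the walk back to that of its start, because a block maps column positions to
    -- row positions.
    monodromy : ∀ {k u v} → Walk G k u v →
      ∃ λ π → InΠ G L π × π ⟨$⟩ʳ height (label v) ≡ height (label u)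
    monodromy [] = Perm.id , identity , refl
    monodromy {u = u} {v} (_∷_ {v = w} u~w w⋯v) with π , π∈Π , πv≡w ← monodromy w⋯v =
      π ∘ₚ ρ ,
      compose π∈Π (generator {σ = σ} (independent u~w)
        (proj₂ (diagonal (fib u))) (block (independent u~w)) (proj₂ (diagonal (fib w)))) ,
      (begin
        ρ ⟨$⟩ʳ (π ⟨$⟩ʳ height (label v))
          ≡⟨ cong (ρ ⟨$⟩ʳ_) πv≡w ⟩
        normalise (fib u) ⟨$⟩ʳ (σ ⟨$⟩ʳ (normalise (fib w) ⟨$⟩ˡ height (label w)))
          -- Passing from heights to labels at `w` undoes the normalisation of its fibre.
          ≡⟨ cong (λ a → normalise (fib u) ⟨$⟩ʳ (σ ⟨$⟩ʳ a)) (Perm.inverseˡ (normalise (fib w))) ⟩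
        normalise (fib u) ⟨$⟩ʳ (σ ⟨$⟩ʳ proj₂ (label w))
          ≡⟨ cong (normalise (fib u) ⟨$⟩ʳ_) (Equivalence.to (block (independent u~w) _ _)
               (subst₂ Adj (sym (vtx-label refl)) (sym (vtx-label refl)) u~w)) ⟨
        height (label u)
          ∎)
      where
      open ≡-Reasoning
      σ = blockPermutation (independent u~w)
      ρ = Perm.flip (normalise (fib w)) ∘ₚ σ ∘ₚ normalise (fib u)

    -- A walk between two vertices of the first fibre is used, since heights and labels agree there.
    connected⇒transitive : Connected G → ∀ a b → ∃ λ π → InΠ G L π × π ⟨$⟩ʳ a ≡ b
    connected⇒transitive connected a b
      with π , π∈Π , eq ← monodromy (proj₂ (connected (vtx i₀ b) (vtx i₀ a))) =
      π , π∈Π , trans (cong (π ⟨$⟩ʳ_) (sym (height-vtx a))) (trans eq (height-vtx b))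
      where
      height-vtx : ∀ c → height (label (vtx i₀ c)) ≡ c
      height-vtx c = trans (cong height (strictlyInverseˡ (i₀ , c))) (normalise-first c)

-- Gain graphs and their groups Π

module GainGraph {r n : ℕ} (Γ : FiniteAbelianGroup r) where
  open FiniteAbelianGroupProperties Γ
  open Inverse enumeration using () renaming (from to element; to to index)

  Gain : Set
  Gain = Fin n → Fin n → Carrier

  labelling : Labelling (Fin n × Carrier) n r
  labelling = rouxLabelling n

  -- The derived graph of a voltage assignment on the complete graph, with the voltages acting by
  -- left multiplication.
  IsGainGraph : Graph (Fin n × Carrier) → Gain → Set
  IsGainGraph G b = ∀ {i j g h} → Graph.Adj G (i , g) (j , h) ⇔ (i ≢ j × g ≡ b i j ∙ h)

  module _ (b : Gain) (b-inverse : ∀ {i j} → i ≢ j → b i j ∙ b j i ≡ ε) where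

    gainGraph : Graph (Fin n × Carrier)
    gainGraph = record
      { Adj    = λ (i , g) (j , h) → i ≢ j × g ≡ b i j ∙ h
      ; adj?   = λ (i , g) (j , h) → ¬? (i Fin.≟ j) ×-dec (g ≟ b i j ∙ h)
      ; symm   = λ { {i , g} {j , h} (i≢j , refl) → i≢j ∘ sym , sym (begin
          b j i ∙ (b i j ∙ h)  ≡⟨ assoc (b j i) (b i j) h ⟨
          b j i ∙ b i j ∙ h    ≡⟨ cong (_∙ h) (b-inverse (i≢j ∘ sym)) ⟩
          ε ∙ h                ≡⟨ identityˡ h ⟩
          h                    ∎) }
      ; irrefl = λ { refl (i≢i , _) → i≢i refl }
      }
      where open ≡-Reasoning

    gainGraph-isGainGraph : IsGainGraph gainGraph b
    gainGraph-isGainGraph = mk⇔ id id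

  module _ {G : Graph (Fin n × Carrier)} {b : Gain} (isGain : IsGainGraph G b) where
    open Graph G
    open ≡-Reasoning

    toGain : ∀ {i j g h} → Adj (i , g) (j , h) → i ≢ j × g ≡ b i j ∙ h
    toGain = Equivalence.to isGain

    fromGain : ∀ {i j g h} → i ≢ j → g ≡ b i j ∙ h → Adj (i , g) (j , h)
    fromGain i≢j eq = Equivalence.from isGain (i≢j , eq)

    -- Reversing the edge from (i, b i j) to (j, ε) gives ε = b j i ∙ b i j.
    gain-inverse : ∀ {i j} → i ≢ j → b i j ∙ b j i ≡ ε
    gain-inverse {i} {j} i≢j = trans (comm (b i j) (b j i))
      (sym (proj₂ (toGain (symm (fromGain i≢j (sym (identityʳ (b i j))))))))

    gain-⁻¹ : ∀ {i j} → i ≢ j → b j i ≡ b i j ⁻¹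
    gain-⁻¹ {i} {j} i≢j = inverseʳ-unique (b i j) (b j i) (gain-inverse i≢j)

    gain-isCover : IsCover G labelling
    gain-isCover = record
      { independent = λ u~v → proj₁ (toGain u~v)
      ; matching    = λ { i≢j (_ , g) (inj₁ refl) → matching i≢j g
                        ; i≢j (_ , g) (inj₂ refl) →
                            let v , (v∈ , u~v) , unique = matching (i≢j ∘ sym) g
                            in v , (swap v∈ , u~v) , λ (w∈ , u~w) → unique (swap w∈ , u~w) }
      }
      where
      swap : {A B : Set} → A ⊎ B → B ⊎ A
      swap (inj₁ x) = inj₂ x
      swap (inj₂ y) = inj₁ y

      matching : ∀ {i j} → i ≢ j → ∀ g →
        ∃! _≡_ λ v → (fibre G labelling v ≡ i ⊎ fibre G labelling v ≡ j) × Adj (i , g) v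
      matching {i} {j} i≢j g = (j , b j i ∙ g) , (inj₂ refl , fromGain i≢j (sym (begin
        b i j ∙ (b j i ∙ g)  ≡⟨ assoc (b i j) (b j i) g ⟨
        b i j ∙ b j i ∙ g    ≡⟨ cong (_∙ g) (gain-inverse i≢j) ⟩
        ε ∙ g                ≡⟨ identityˡ g ⟩
        g                    ∎))) , λ where
          (inj₁ refl , u~v) → contradiction refl (proj₁ (toGain u~v))
          (inj₂ refl , u~v) → cong (j ,_) (sym (proj₂ (toGain (symm u~v))))

    IsTranslation : Carrier → Permutation′ r → Set
    IsTranslation x π = ∀ a → element (π ⟨$⟩ʳ a) ≡ x ∙ element a

    element-injective : ∀ {a a′} → element a ≡ element a′ → a ≡ a′
    element-injective {a} {a′} eq = trans (sym (Inverse.strictlyInverseˡ enumeration a))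
      (trans (cong index eq) (Inverse.strictlyInverseˡ enumeration a′))

    block-translation : ∀ {i j} σ → Block G labelling i j σ → IsTranslation (b i j) σ
    block-translation σ isBlock a = proj₂ (toGain (Equivalence.from (isBlock _ a) refl))

    id-translation : IsTranslation ε Perm.id
    id-translation a = sym (identityˡ (element a))

    diagonal-translation : ∀ {i δ} → DiagonalBlock G labelling i δ → ∃ λ x → IsTranslation x δ
    diagonal-translation (first _)             = ε , id-translation
    diagonal-translation (later {δ = δ} _ _ isBlock) = _ , block-translation δ isBlock

    ∘ₚ-translation : ∀ {x y π ρ} → IsTranslation x π → IsTranslation y ρ → IsTranslation (y ∙ x) (π ∘ₚ ρ)
    ∘ₚ-translation {x} {y} {π} {ρ} π-x ρ-y a =
      trans (ρ-y (π ⟨$⟩ʳ a)) (trans (cong (y ∙_) (π-x a)) (sym (assoc y x (element a))))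

    flip-translation : ∀ {x π} → IsTranslation x π → IsTranslation (x ⁻¹) (Perm.flip π)
    flip-translation {x} {π} π-x a = begin
      element (π ⟨$⟩ˡ a)                    ≡⟨ \\-leftDividesʳ x (element (π ⟨$⟩ˡ a)) ⟨
      x ⁻¹ ∙ (x ∙ element (π ⟨$⟩ˡ a))       ≡⟨ cong (x ⁻¹ ∙_) (π-x (π ⟨$⟩ˡ a)) ⟨
      x ⁻¹ ∙ element (π ⟨$⟩ʳ (π ⟨$⟩ˡ a))    ≡⟨ cong (λ a → x ⁻¹ ∙ element a) (Perm.inverseʳ π) ⟩
      x ⁻¹ ∙ element a                      ∎

    -- Induction on the generation of Π: the blocks translate by gains, and translations are closed
    -- under composition and inversion. The order of factors flips because `∘ₚ` applies its left
    -- argument first.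
    Π-translation : ∀ {π} → InΠ G labelling π → ∃ λ x → IsTranslation x π
    Π-translation (generator {δᵢ = δᵢ} {σ} {δⱼ} _ Dᵢ isBlock Dⱼ)
      with x , δᵢ-x ← diagonal-translation Dᵢ | y , δⱼ-y ← diagonal-translation Dⱼ =
      _ , ∘ₚ-translation {π = Perm.flip δⱼ} {ρ = σ ∘ₚ δᵢ} (flip-translation {π = δⱼ} δⱼ-y)
            (∘ₚ-translation {π = σ} {ρ = δᵢ} (block-translation σ isBlock) δᵢ-x)
    Π-translation identity = ε , id-translation
    Π-translation (compose {π} {ρ} π∈Π ρ∈Π)
      with x , π-x ← Π-translation π∈Π | y , ρ-y ← Π-translation ρ∈Π =
      y ∙ x , ∘ₚ-translation {π = π} {ρ} π-x ρ-y
    Π-translation (inverse {π} π∈Π) with x , π-x ← Π-translation π∈Π =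
      x ⁻¹ , flip-translation {π = π} π-x
    Π-translation (respects π≈ρ π∈Π) with x , π-x ← Π-translation π∈Π =
      x , λ a → trans (cong element (sym (π≈ρ a))) (π-x a)

    gain-isAbelian : IsAbelian G labelling
    gain-isAbelian {π} {ρ} π∈Π ρ∈Π a
      with x , π-x ← Π-translation π∈Π | y , ρ-y ← Π-translation ρ∈Π = element-injective (begin
      element (ρ ⟨$⟩ʳ (π ⟨$⟩ʳ a))  ≡⟨ ∘ₚ-translation {π = π} {ρ} π-x ρ-y a ⟩
      y ∙ x ∙ element a            ≡⟨ cong (_∙ element a) (comm y x) ⟩
      x ∙ y ∙ element a            ≡⟨ ∘ₚ-translation {π = ρ} {π} ρ-y π-x a ⟨
      element (π ⟨$⟩ʳ (ρ ⟨$⟩ʳ a))  ∎)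

    -- Connectedness gives transitivity through `monodromy`; uniqueness holds because a translation
    -- is determined by one of its values.
    connected⇒regular : Fin n → Connected G → IsRegular G labelling
    connected⇒regular i connected a c = let π , π∈Π , πa≡c = transitive i in
      π , (π∈Π , πa≡c) , λ {ρ} (ρ∈Π , ρa≡c) → agree π∈Π ρ∈Π (trans πa≡c (sym ρa≡c))
      where
      transitive : Fin n → ∃ λ π → InΠ G labelling π × π ⟨$⟩ʳ a ≡ c
      -- Matching on the fibre exposes `n` as a successor, so that the first fibre can be named.
      transitive zero    = CoverMonodromy.connected⇒transitive gain-isCover {zero} refl connected a c
      transitive (suc _) = CoverMonodromy.connected⇒transitive gain-isCover {zero} refl connected a c

      agree : ∀ {π ρ} → InΠ G labelling π → InΠ G labelling ρ → π ⟨$⟩ʳ a ≡ ρ ⟨$⟩ʳ a → π Perm.≈ ρ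
      agree {π} {ρ} π∈Π ρ∈Π πa≡ρa a′
        with x , π-x ← Π-translation π∈Π | y , ρ-y ← Π-translation ρ∈Π = element-injective (begin
        element (π ⟨$⟩ʳ a′)  ≡⟨ π-x a′ ⟩
        x ∙ element a′       ≡⟨ cong (_∙ element a′) (∙-cancelʳ (element a) x y
                                  (trans (sym (π-x a)) (trans (cong element πa≡ρa) (ρ-y a)))) ⟩
        y ∙ element a′       ≡⟨ ρ-y a′ ⟨
        element (ρ ⟨$⟩ʳ a′)  ∎)

-- Roux and their graphs

module RouxGraphs (K : CommutativeRing 0ℓ 0ℓ)
  (fromℕ-injective : ∀ {m n} →
    CommutativeRing._≈_ K (RouxOver.fromℕ K m) (RouxOver.fromℕ K n) → m ≡ n)
  {r n : ℕ} (Γ : FiniteAbelianGroup r) where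
  open CommutativeRing K
    using (_≈_; 0#; 1#; +-cong; +-congˡ; *-cong; *-congˡ; *-identityˡ; *-identityʳ; zeroˡ; zeroʳ;
           setoid)
    renaming (Carrier to Scalar; _+_ to _+ᴷ_; _*_ to _*ᴷ_; _-_ to _-ᴷ_; refl to ≈-refl; sym to ≈-sym;
              trans to ≈-trans; reflexive to ≈-reflexive; +-identityˡ to +ᴷ-identityˡ)
  open RouxOver K
  open GroupRing K Γ
  open FiniteAbelianGroupProperties Γ
  open Inverse enumeration using () renaming (from to element; to to index)
  open CommutativeRing groupRing-commutativeRing using ()
    renaming (Carrier to ℜ; _≈_ to _≈ᴳ_; _*_ to _*ᴳ_; 0# to 0ᴳ; 1# to 1ᴳ)
  open MatrixAlgebra (groupRing Γ) n
  open GainGraph {r} {n} Γ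
  open Labelled labelling
  open SetoidReasoning setoid
  private
    module Mᴳ = MatrixProperties groupRing-commutativeRing {n}
    module ∑ᴷ = SemiringSum (CommutativeRing.semiring K)
    module Mult = SemiringMult (CommutativeRing.semiring K)

  1≉0 : ¬ 1# ≈ 0#
  1≉0 1≈0 = contradiction (fromℕ-injective {1} {0} (≈-trans (Mult.×-homo-1 1#) 1≈0)) ℕ.1+n≢0

  fromℕ-+ : ∀ k l → fromℕ (k + l) ≈ fromℕ k +ᴷ fromℕ l
  fromℕ-+ = Mult.×-homo-+ 1#

  fromℕ-sum : ∀ {m} (f : Fin m → ℕ) → fromℕ (sum f) ≈ ∑ᴷ.sum (fromℕ ∘ f)
  fromℕ-sum {zero}  f = ≈-refl
  fromℕ-sum {suc m} f = ≈-trans (fromℕ-+ (f zero) (sum (f ∘ suc))) (+-congˡ (fromℕ-sum (f ∘ suc)))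

  indicator : {P : Set} → Dec P → Scalar
  indicator P? = if does P? then 1# else 0#

  module _ {P : Set} (P? : Dec P) where

    indicator-true : P → indicator P? ≈ 1#
    indicator-true p = ≈-reflexive (cong (if_then 1# else 0#) (dec-true P? p))

    indicator-false : ¬ P → indicator P? ≈ 0#
    indicator-false ¬p = ≈-reflexive (cong (if_then 1# else 0#) (dec-false P? ¬p))

    fromℕ-𝟙 : fromℕ (𝟙 P?) ≈ indicator P?
    fromℕ-𝟙 with does P?
    ... | true  = Mult.×-homo-1 1#
    ... | false = ≈-refl

  indicator≈1 : {P : Set} (P? : Dec P) → indicator P? ≈ 1# → P
  indicator≈1 (yes p) _   = p
  indicator≈1 (no _)  0≈1 = contradiction (≈-sym 0≈1) 1≉0

  indicator-× : {P Q : Set} (P? : Dec P) (Q? : Dec Q) →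
    indicator (P? ×-dec Q?) ≈ indicator P? *ᴷ indicator Q?
  indicator-× P? Q? with does P?
  ... | true  = ≈-sym (*-identityˡ _)
  ... | false = ≈-sym (zeroˡ _)

  -- The Cayley entry of `x` is 1 exactly for x = g h⁻¹.
  lift-entry : ∀ (B : Matrix) i g j h → ⌈_⌋ Γ B (i , g) (j , h) ≈ B i j (g ∙ h ⁻¹)
  lift-entry B i g j h = ≈-trans
    (∑-single (g ∙ h ⁻¹) λ x x≢ → ≈-trans
      (*-congˡ {B i j x} (indicator-false (x ∙ h ≟ g) λ eq → x≢ (x≈z//y x h g eq))) (zeroʳ _))
    (≈-trans
      (*-congˡ {B i j (g ∙ h ⁻¹)} (indicator-true (g ∙ h ⁻¹ ∙ h ≟ g) (//-rightDividesˡ h g)))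
      (*-identityʳ _))

  record HasGain (B : Matrix) (b : Gain) : Set where
    field
      diagonal    : ∀ i → B i i ≈ᴳ 0ᴳ
      offDiagonal : ∀ {i j} → i ≢ j → B i j ≈ᴳ δ (b i j)

  R1∧R2⇒HasGain : ∀ {B} → R1 Γ B → R2 Γ B → ∃ (HasGain B)
  R1∧R2⇒HasGain {B} r1 r2 = b , record { diagonal = r1 ; offDiagonal = off }
    where
    b : Gain
    b i j with i Fin.≟ j
    -- No gain is prescribed on the diagonal; `ε` is a placeholder.
    ... | yes _  = ε
    ... | no i≢j = proj₁ (r2 i j i≢j)

    off : ∀ {i j} → i ≢ j → B i j ≈ᴳ δ (b i j)
    -- The element given by (R2) may depend on the proof of `i ≢ j`, so the test that defines `b` is
    -- repeated here.
    off {i} {j} i≢j with i Fin.≟ j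
    ... | yes i≡j = contradiction i≡j i≢j
    ... | no i≢j′ = proj₂ (r2 i j i≢j′)

  module _ {B : Matrix} {b : Gain} (hasGain : HasGain B b) where
    open HasGain hasGain

    -- (R3) equates two group elements inside the group ring; comparing coefficients at `ε` and
    -- using 1 ≠ 0 gives equality in Γ.
    R3⇒inverse : R3 Γ B → ∀ {i j} → i ≢ j → b i j ∙ b j i ≡ ε
    R3⇒inverse r3 {i} {j} i≢j = indicator≈1 (b i j ∙ b j i ≟ ε) (begin
      δ (b i j ∙ b j i) ε          ≈⟨ δ-δ (b i j) (b j i) ε ⟨
      (δ (b i j) *ᴳ δ (b j i)) ε   ≈⟨ *ᴳ-cong (offDiagonal i≢j) (offDiagonal (i≢j ∘ sym)) ε ⟨
      (B i j *ᴳ B j i) ε           ≈⟨ proj₁ (r3 i j i≢j) ε ⟩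
      1ᴳ ε                         ≈⟨ δ-≡ refl ⟩
      1#                           ∎)

    inverse⇒R3 : (∀ {i j} → i ≢ j → b i j ∙ b j i ≡ ε) → R3 Γ B
    inverse⇒R3 b-inverse i j i≢j = product i≢j , product (i≢j ∘ sym)
      where
      product : ∀ {i j} → i ≢ j → (B i j *ᴳ B j i) ≈ᴳ 1ᴳ
      product {i} {j} i≢j g = begin
        (B i j *ᴳ B j i) g          ≈⟨ *ᴳ-cong (offDiagonal i≢j) (offDiagonal (i≢j ∘ sym)) g ⟩
        (δ (b i j) *ᴳ δ (b j i)) g  ≈⟨ δ-δ (b i j) (b j i) g ⟩
        δ (b i j ∙ b j i) g         ≈⟨ ≈-reflexive (cong (λ x → δ x g) (b-inverse i≢j)) ⟩
        1ᴳ g                        ∎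

    adjacencyMatrix⇒gainGraph : ∀ {G} → IsAdjacencyMatrix G (⌈_⌋ Γ B) → IsGainGraph G b
    adjacencyMatrix⇒gainGraph {G} A {i} {j} {g} {h} = mk⇔ to from
      where
      open Graph G

      to : Adj (i , g) (j , h) → i ≢ j × g ≡ b i j ∙ h
      to u~v = i≢j , trans (sym (//-rightDividesˡ h g)) (cong (_∙ h) (sym
        (indicator≈1 (b i j ≟ g ∙ h ⁻¹) (≈-trans (≈-sym (offDiagonal i≢j (g ∙ h ⁻¹))) entry≈1))))
        where
        entry≈1 : B i j (g ∙ h ⁻¹) ≈ 1#
        entry≈1 = ≈-trans (≈-sym (lift-entry B i g j h))
          (≈-trans (A (i , g) (j , h)) (indicator-true (adj? (i , g) (j , h)) u~v))

        i≢j : i ≢ j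
        i≢j refl = 1≉0 (≈-trans (≈-sym entry≈1) (diagonal i (g ∙ h ⁻¹)))

      from : i ≢ j × g ≡ b i j ∙ h → Adj (i , g) (j , h)
      from (i≢j , refl) = indicator≈1 (adj? (i , g) (j , h)) (begin
        indicator (adj? (i , g) (j , h))  ≈⟨ A (i , g) (j , h) ⟨
        ⌈_⌋ Γ B (i , g) (j , h)           ≈⟨ lift-entry B i g j h ⟩
        B i j (g ∙ h ⁻¹)                  ≈⟨ offDiagonal i≢j (g ∙ h ⁻¹) ⟩
        δ (b i j) (g ∙ h ⁻¹)              ≈⟨ δ-≡ (sym (//-rightDividesʳ h (b i j))) ⟩
        1#                                ∎)

    gainGraph⇒adjacencyMatrix : ∀ {G} → IsGainGraph G b → IsAdjacencyMatrix G (⌈_⌋ Γ B)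
    gainGraph⇒adjacencyMatrix {G} isGain (i , g) (j , h) =
      ≈-trans (lift-entry B i g j h) (entry (i Fin.≟ j))
      where
      open Graph G

      entry : Dec (i ≡ j) → B i j (g ∙ h ⁻¹) ≈ indicator (adj? (i , g) (j , h))
      entry (yes refl) = ≈-trans (diagonal i (g ∙ h ⁻¹)) (≈-sym
        (indicator-false (adj? (i , g) (j , h)) λ u~v → proj₁ (Equivalence.to isGain u~v) refl))
      entry (no i≢j) = ≈-trans (offDiagonal i≢j (g ∙ h ⁻¹)) (≈-reflexive
        (cong (if_then 1# else 0#) (does-⇔ (mk⇔
          (λ eq → Equivalence.from isGain
            (i≢j , trans (sym (//-rightDividesˡ h g)) (cong (_∙ h) (sym eq))))
          (λ u~v → x≈z//y (b i j) h g (sym (proj₂ (Equivalence.to isGain u~v)))))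
          (b i j ≟ g ∙ h ⁻¹) (adj? (i , g) (j , h)))))

  -- The column (j, ε) of ⌈ B ⌋ lists the coefficients of `B i j`. They vanish for i = j by
  -- independence, and otherwise are 1 exactly at the unique neighbour in the fibre `i`.
  cover⇒R1∧R2 : ∀ {B G} → IsAdjacencyMatrix G (⌈_⌋ Γ B) → IsCover G labelling → R1 Γ B × R2 Γ B
  cover⇒R1∧R2 {B} {G} A isCover = r1 , r2
    where
    open Graph G
    open Cover isCover

    entry : ∀ i j g → B i j g ≈ indicator (adj? (i , g) (j , ε))
    entry i j g = begin
      B i j g                           ≈⟨ ≈-reflexive (cong (B i j) (trans (cong (g ∙_) ε⁻¹≈ε) (identityʳ g))) ⟨
      B i j (g ∙ ε ⁻¹)                  ≈⟨ lift-entry B i g j ε ⟨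
      ⌈_⌋ Γ B (i , g) (j , ε)           ≈⟨ A (i , g) (j , ε) ⟩
      indicator (adj? (i , g) (j , ε))  ∎

    r1 : R1 Γ B
    r1 i g = ≈-trans (entry i i g)
      (indicator-false (adj? (i , g) (i , ε)) λ u~v → IsCover.independent isCover u~v refl)

    r2 : R2 Γ B
    r2 i j i≢j with a , v~a , unique ← neighbour (j , ε) (i≢j ∘ sym) =
      element a , λ g → ≈-trans (entry i j g) (≈-reflexive (cong (if_then 1# else 0#)
        (does-⇔ (mk⇔
          (λ g~v → trans (cong element (unique (index g)
            (subst (λ x → Adj (j , ε) (i , x)) (sym (Inverse.strictlyInverseʳ enumeration g)) (symm g~v))))
            (Inverse.strictlyInverseʳ enumeration g))
          (λ { refl → symm v~a }))
          (adj? (i , g) (j , ε)) (element a ≟ g))))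

  module _ {G : Graph (Fin n × Carrier)} where
    open Graph G

    #common : Fin n × Carrier → Fin n × Carrier → ℕ
    #common u v = # λ w → adj? u w ×-dec adj? v w

    -- ⌈ B ⌋ ⌈ B ⌋ = ⌈ B B ⌋, and the entries of the left-hand side count common neighbours.
    #common-entry : ∀ {B} → IsAdjacencyMatrix G (⌈_⌋ Γ B) →
      ∀ i g j h → fromℕ (#common (i , g) (j , h)) ≈ (B *ᴹ B) i j (g ∙ h ⁻¹)
    #common-entry {B} A i g j h = begin
      fromℕ (#common (i , g) (j , h))
        ≈⟨ ≈-trans (fromℕ-sum (λ k → sum λ a → 𝟙 (both? (k , element a)))) (∑ᴷ.sum-cong-≋ λ k → fromℕ-sum (λ a → 𝟙 (both? (k , element a)))) ⟩
      ∑ᴷ.sum (λ k → ∑Γ Γ λ x → fromℕ (𝟙 (both? (k , x))))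
        ≈⟨ ∑ᴷ.sum-cong-≋ (λ k → ∑-cong λ x → factor (k , x)) ⟩
      ∑ᴷ.sum (λ k → ∑Γ Γ λ x → B i k (g ∙ x ⁻¹) *ᴷ B k j (x ∙ h ⁻¹))
        -- The substitution y = x⁻¹ g turns the sum over intermediate positions `x` into a
        -- convolution in the group ring.
        ≈⟨ ∑ᴷ.sum-cong-≋ (λ k → ∑-cong λ x → *-cong
             (≈-reflexive (cong (B i k) (comm g (x ⁻¹))))
             (≈-reflexive (cong (B k j) (trans
               (cong (_∙ h ⁻¹) (sym (Inverse.strictlyInverseˡ (reflection g) x)))
               (assoc ((x ⁻¹ ∙ g) ⁻¹) g (h ⁻¹)))))) ⟩
      ∑ᴷ.sum (λ k → ∑Γ Γ λ x → B i k (x ⁻¹ ∙ g) *ᴷ B k j ((x ⁻¹ ∙ g) ⁻¹ ∙ (g ∙ h ⁻¹)))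
        ≈⟨ ∑ᴷ.sum-cong-≋ (λ k → ∑-reindex (λ y → B i k y *ᴷ B k j (y ⁻¹ ∙ (g ∙ h ⁻¹))) (reflection g)) ⟨
      ∑ᴷ.sum (λ k → (B i k *ᴳ B k j) (g ∙ h ⁻¹))
        ≈⟨ ≈-reflexive (RouxAlgebra.sum-apply K Γ B (λ k → B i k *ᴳ B k j) (g ∙ h ⁻¹)) ⟨
      (B *ᴹ B) i j (g ∙ h ⁻¹)
        ∎
      where
      both? : Decidable (λ w → Adj (i , g) w × Adj (j , h) w)
      both? w = adj? (i , g) w ×-dec adj? (j , h) w

      factor : ∀ w → fromℕ (𝟙 (both? w))
        ≈ B i (proj₁ w) (g ∙ proj₂ w ⁻¹) *ᴷ B (proj₁ w) j (proj₂ w ∙ h ⁻¹)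
      factor (k , x) = begin
        fromℕ (𝟙 (both? (k , x)))
          ≈⟨ fromℕ-𝟙 (both? (k , x)) ⟩
        indicator (both? (k , x))
          ≈⟨ indicator-× (adj? (i , g) (k , x)) (adj? (j , h) (k , x)) ⟩
        indicator (adj? (i , g) (k , x)) *ᴷ indicator (adj? (j , h) (k , x))
          ≈⟨ *-congˡ {indicator (adj? (i , g) (k , x))} (≈-reflexive (cong (if_then 1# else 0#)
               (does-⇔ (mk⇔ symm symm) (adj? (j , h) (k , x)) (adj? (k , x) (j , h))))) ⟩
        indicator (adj? (i , g) (k , x)) *ᴷ indicator (adj? (k , x) (j , h))
          ≈⟨ *-cong (A (i , g) (k , x)) (A (k , x) (j , h)) ⟨
        ⌈_⌋ Γ B (i , g) (k , x) *ᴷ ⌈_⌋ Γ B (k , x) (j , h)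
          ≈⟨ *-cong (lift-entry B i g k x) (lift-entry B k x j h) ⟩
        B i k (g ∙ x ⁻¹) *ᴷ B k j (x ∙ h ⁻¹)
          ∎

  parametersRHS : Matrix → (Carrier → Scalar) → Matrix
  parametersRHS B c = (_·ᴹ_ Γ (fromℕ n -ᴷ 1#) 1ᴹ) +ᴹ ∑Γᴹ Γ (λ g → _·ᴹ_ Γ (c g) (_⋆_ Γ g B))

  module _ {B : Matrix} {b : Gain} (hasGain : HasGain B b) (c : Carrier → Scalar) where
    open HasGain hasGain

    parametersRHS-diagonal : ∀ i g → parametersRHS B c i i g ≈ (fromℕ n -ᴷ 1#) *ᴷ 1ᴳ g
    parametersRHS-diagonal i g = ≈-trans
      (+-cong (*-congˡ {fromℕ n -ᴷ 1#} (Mᴳ.1ᴹ-≡ {i} refl g))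
        (≈-trans (RouxAlgebra.∑Γᴹ-⋆ K Γ B c B i i g)
                 (∑-zero λ h → ≈-trans (*-congˡ {c h} (diagonal i (h ⁻¹ ∙ g))) (zeroʳ (c h)))))
      (CommutativeRing.+-identityʳ K _)

    -- Off the diagonal only the second summand remains, and multiplying ∑ c_g g by the group
    -- element `b i j` translates the parameters.
    parametersRHS-offDiagonal : ∀ {i j} → i ≢ j → ∀ g → parametersRHS B c i j g ≈ c (b i j ⁻¹ ∙ g)
    parametersRHS-offDiagonal {i} {j} i≢j g = begin
      parametersRHS B c i j g
        ≈⟨ +-cong (≈-trans (*-congˡ {fromℕ n -ᴷ 1#} (Mᴳ.1ᴹ-≢ i≢j g)) (zeroʳ _))
                  (RouxAlgebra.∑Γᴹ-⋆ K Γ B c B i j g) ⟩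
      0# +ᴷ (c *ᴳ B i j) g      ≈⟨ +ᴷ-identityˡ _ ⟩
      (c *ᴳ B i j) g            ≈⟨ *ᴳ-cong {c} {c} (λ _ → ≈-refl) (offDiagonal i≢j) g ⟩
      (c *ᴳ δ (b i j)) g        ≈⟨ *ᴳ-comm c (δ (b i j)) g ⟩
      (δ (b i j) *ᴳ c) g        ≈⟨ δ-* (b i j) c g ⟩
      c (b i j ⁻¹ ∙ g)          ∎

  drackNParameters-≢ε : ∀ c {x} → x ≢ ε → drackNParameters Γ n c x ≈ fromℕ c
  drackNParameters-≢ε c {x} x≢ε = ≈-reflexive (cong
    (if_then fromℕ n -ᴷ fromℕ c *ᴷ (fromℕ r -ᴷ 1#) -ᴷ fromℕ 2 else fromℕ c) (dec-false (x ≟ ε) x≢ε))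

  drackNParameters-ε : ∀ c {x} → x ≡ ε →
    drackNParameters Γ n c x ≈ fromℕ n -ᴷ fromℕ c *ᴷ (fromℕ r -ᴷ 1#) -ᴷ fromℕ 2
  drackNParameters-ε c {x} x≡ε = ≈-reflexive (cong
    (if_then fromℕ n -ᴷ fromℕ c *ᴷ (fromℕ r -ᴷ 1#) -ᴷ fromℕ 2 else fromℕ c) (dec-true (x ≟ ε) x≡ε))

-- Covers from (R1)-(R3) and graphs of roux

module RouxTheorems (K : CommutativeRing 0ℓ 0ℓ)
  (fromℕ-injective : ∀ {m n} →
    CommutativeRing._≈_ K (RouxOver.fromℕ K m) (RouxOver.fromℕ K n) → m ≡ n) where
  open CommutativeRing K
    using (_≈_; 0#)
    renaming (Carrier to Scalar; sym to ≈-sym; trans to ≈-trans; reflexive to ≈-reflexive)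
  open RouxOver K

  module _ {r n : ℕ} (Γ : FiniteAbelianGroup r) (B : SquareMatrix (Fin n) (FiniteAbelianGroup.Carrier Γ → Scalar)) where
    open RouxGraphs K fromℕ-injective {r} {n} Γ
    open FiniteAbelianGroupProperties Γ
    open GainGraph {r} {n} Γ
    open Labelled labelling

    -- (R1) corresponds to independent fibres, (R2) to unique neighbours and (R3) to the symmetry of
    -- adjacency; the cover is abelian because its blocks are translations of Γ.
    abelian-cover⇔R1-R3 : (R1 Γ B × R2 Γ B × R3 Γ B) ⇔
      (∃ λ G → IsAdjacencyMatrix G (⌈_⌋ Γ B) × IsCover G labelling × IsAbelian G labelling)
    abelian-cover⇔R1-R3 = mk⇔ to from
      where
      to : R1 Γ B × R2 Γ B × R3 Γ B →
        ∃ λ G → IsAdjacencyMatrix G (⌈_⌋ Γ B) × IsCover G labelling × IsAbelian G labelling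
      to (r1 , r2 , r3) with b , hasGain ← R1∧R2⇒HasGain r1 r2 =
        G , gainGraph⇒adjacencyMatrix hasGain {G} isGain , gain-isCover {G} {b} isGain ,
        λ {π} {ρ} → gain-isAbelian {G} {b} isGain {π} {ρ}
        where
        G : Graph (Fin n × Carrier)
        G = gainGraph b (R3⇒inverse hasGain r3)

        isGain : IsGainGraph G b
        isGain = gainGraph-isGainGraph b (R3⇒inverse hasGain r3)

      from : (∃ λ G → IsAdjacencyMatrix G (⌈_⌋ Γ B) × IsCover G labelling × IsAbelian G labelling) →
        R1 Γ B × R2 Γ B × R3 Γ B
      from (G , A , isCover , _)
        with r1 , r2 ← cover⇒R1∧R2 {B} {G} A isCover
        with b , hasGain ← R1∧R2⇒HasGain r1 r2 =
        r1 , r2 , inverse⇒R3 hasGain (gain-inverse {G} {b} (adjacencyMatrix⇒gainGraph hasGain {G} A))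

    module RouxGraph (isRoux : IsRoux Γ B) (c : Carrier → Scalar) (parameters : HasRouxParameters Γ B c)
      (G : Graph (Fin n × Carrier)) (A : IsRouxGraph Γ B G) where
      open Graph G

      private
        gain : ∃ (HasGain B)
        gain = R1∧R2⇒HasGain (proj₁ isRoux) (proj₁ (proj₂ isRoux))

        b : Gain
        b = proj₁ gain

        hasGain : HasGain B b
        hasGain = proj₂ gain

        isGain : IsGainGraph G b
        isGain = adjacencyMatrix⇒gainGraph hasGain {G} A

      isCover : IsCover G labelling
      isCover = gain-isCover {G} {b} isGain

      isAbelian : IsAbelian G labelling
      isAbelian {π} {ρ} = gain-isAbelian {G} {b} isGain {π} {ρ}

      open Cover isCover using (common?)
      open CoverDistance isCover

      #common-parameter : ∀ {i j} → i ≢ j → ∀ g h →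
        fromℕ (# (common? (i , g) (j , h))) ≈ c (b i j ⁻¹ ∙ (g ∙ h ⁻¹))
      #common-parameter {i} {j} i≢j g h = ≈-trans (#common-entry {G} {B} A i g j h)
        (≈-trans (parameters i j (g ∙ h ⁻¹)) (parametersRHS-offDiagonal hasGain c i≢j (g ∙ h ⁻¹)))

      quotient≢ε : ∀ {i j g h} → i ≢ j → ¬ Adj (i , g) (j , h) → b i j ⁻¹ ∙ (g ∙ h ⁻¹) ≢ ε
      quotient≢ε {i} {j} {g} {h} i≢j u≁v quotient≡ε = u≁v (fromGain {G} {b} isGain i≢j
        (trans (sym (//-rightDividesˡ h g)) (cong (_∙ h)
          (trans (sym (\\-leftDividesˡ (b i j) (g ∙ h ⁻¹)))
            (trans (cong (b i j ∙_) quotient≡ε) (identityʳ (b i j)))))))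

      module _ (2≤n : 2 ≤ n) where

        private
          inhabited : ∀ {m} → 2 ≤ m → Fin m
          inhabited (s≤s _) = zero

        -- A walk of length 3 between (i , g) and (i , ε) ends in an edge from
        -- some (k , b k i), and (i , g) and (k , b k i) have c g common neighbours.
        diameter⇒nonzero : Diameter G 3 → ∀ g → g ≢ ε → ¬ (c g ≈ 0#)
        diameter⇒nonzero (bounded , _) g g≢ε cg≈0
          with i ← inhabited 2≤n
          with _ , (walk , _) , k≤3 ← bounded (i , g) (i , ε) =
          -- The walk has length exactly 3: the diameter bounds it above, and its distinct ends in
          -- one fibre bound it below.
          impossible walk k≤3 (3≤walk refl (g≢ε ∘ cong proj₂) walk)
          where
          impossible : ∀ {i k} → Walk G k (i , g) (i , ε) → k ≤ 3 → ¬ 3 ≤ k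
          impossible (_∷_ _ []) _ (s≤s ())
          impossible (_∷_ _ (_∷_ _ [])) _ (s≤s (s≤s ()))
          impossible (_∷_ _ (_∷_ _ (_∷_ _ (_∷_ _ _)))) (s≤s (s≤s (s≤s ()))) _
          impossible {i} (_∷_ {v = x} u~x (_∷_ {v = k , y} x~y (_∷_ y~v []))) _ _ =
            #≡0⇒∄ (common? (i , g) (k , y)) (fromℕ-injective (≈-trans count≈cg cg≈0)) x
              (u~x , symm x~y)
            where
            k≢i : k ≢ i
            k≢i = proj₁ (toGain {G} {b} isGain y~v)

            y⁻¹≡ : y ⁻¹ ≡ b i k
            y⁻¹≡ = trans
              (cong _⁻¹ (trans (proj₂ (toGain {G} {b} isGain y~v)) (identityʳ (b k i))))
              (sym (gain-⁻¹ {G} {b} isGain k≢i))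

            count≈cg : fromℕ (# (common? (i , g) (k , y))) ≈ c g
            -- As `y` is `b k i`, its inverse `b i k` cancels against the factor `b i k ⁻¹`, and the
            -- parameter index is `g`.
            count≈cg = ≈-trans (#common-parameter (k≢i ∘ sym) g y) (≈-reflexive (cong c
              (trans (cong (λ z → b i k ⁻¹ ∙ z) (trans (cong (g ∙_) y⁻¹≡) (comm g (b i k))))
                (\\-leftDividesʳ (b i k) g))))

        module _ (nonzero : ∀ g → g ≢ ε → ¬ (c g ≈ 0#)) where

          linked : ∀ {u v} → fibre G labelling u ≢ fibre G labelling v → ¬ Adj u v →
            ∃ λ w → Adj u w × Adj w v
          linked {i , g} {j , h} i≢j u≁v
            with w , u~w , v~w ← #≢0⇒∃ (common? (i , g) (j , h)) (λ #≡0 →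
              nonzero (b i j ⁻¹ ∙ (g ∙ h ⁻¹)) (quotient≢ε i≢j u≁v)
                (≈-trans (≈-sym (#common-parameter i≢j g h)) (≈-reflexive (cong fromℕ #≡0)))) =
            w , u~w , symm v~w

          isAntipodalCover : 2 ≤ r → IsAntipodalCover G labelling
          isAntipodalCover = antipodal-cover 2≤n linked

          isRegular : 2 ≤ r → IsRegular G labelling
          isRegular 2≤r = connected⇒regular {G} {b} isGain (inhabited 2≤n)
            (IsAntipodal.connected (IsAntipodalCover.isAntipodal (isAntipodalCover 2≤r)))

          isDRACKN : 2 ≤ r → ∀ {k} → (∀ g → g ≢ ε → c g ≈ fromℕ k) → IsDRACKN G labelling k
          isDRACKN 2≤r {k} c≈k = record
            { isAntipodalCover  = isAntipodalCover 2≤r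
            ; isDistanceRegular = distance-regular 2≤n linked (common-determined common-remote)
            ; commonNeighbours  = λ {u} {v} u-v → subst (HasCardinality _)
                (at-2 (position-dist (dist-distance 2≤n linked u-v)))
                (#-HasCardinality (common? u v))
            }
            where
            common-remote : ∀ {u v} → fibre G labelling u ≢ fibre G labelling v → ¬ Adj u v →
              # (common? u v) ≡ k
            common-remote {i , g} {j , h} i≢j u≁v = fromℕ-injective
              (≈-trans (#common-parameter i≢j g h) (c≈k _ (quotient≢ε i≢j u≁v)))

            at-2 : ∀ {u v} → Position u v 2 → # (common? u v) ≡ k
            at-2 (remote u≢v u≁v) = common-remote u≢v u≁v

        -- The parameter at `ε` counts common neighbours of adjacent vertices, which says nothing
        -- about remote pairs: for the hexagon, with n = 3 and r = 2, it is 0 although the diameter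
        -- is 3. Hence the restriction to `g ≢ ε`. For r ≥ 2 a fibre contains two vertices, which
        -- are then at distance 3.
        diameter⇔nonzero : 2 ≤ r → Diameter G 3 ⇔ (∀ g → g ≢ ε → ¬ (c g ≈ 0#))
        diameter⇔nonzero 2≤r = mk⇔ diameter⇒nonzero λ nonzero → diameter-3 2≤n (linked nonzero) 2≤r

-- The roux of a gain graph

module GainGraphRoux (K : CommutativeRing 0ℓ 0ℓ)
  (fromℕ-injective : ∀ {m n} →
    CommutativeRing._≈_ K (RouxOver.fromℕ K m) (RouxOver.fromℕ K n) → m ≡ n)
  {r n : ℕ} (Γ : FiniteAbelianGroup r) where
  open CommutativeRing K
    using (_≈_; 0#; 1#; +-cong; +-congˡ; *-congˡ; *-identityʳ; zeroʳ; setoid)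
    renaming (Carrier to Scalar; _+_ to _+ᴷ_; _*_ to _*ᴷ_; _-_ to _-ᴷ_; refl to ≈-refl; sym to ≈-sym;
              trans to ≈-trans; reflexive to ≈-reflexive; +-comm to +ᴷ-comm; +-assoc to +ᴷ-assoc;
              *-comm to *ᴷ-comm)
  open RouxOver K
  open SetoidReasoning setoid
  open RouxGraphs K fromℕ-injective {r} {n} Γ
  open GroupRing K Γ
  open FiniteAbelianGroupProperties Γ
  open MatrixAlgebra (groupRing Γ) n
  open GainGraph {r} {n} Γ
  open Labelled labelling
  private
    module Mult = SemiringMult (CommutativeRing.semiring K)
    module +ᴷ = AbelianGroupProperties (CommutativeRing.+-abelianGroup K)

  module _ (b : Gain) where

    private
      -- The decision is an explicit argument, so that the proofs about the matrix can examine it by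
      -- cases.
      entry : ∀ i j → Dec (i ≡ j) → Carrier → Scalar
      entry i j (yes _) _ = 0#
      entry i j (no _)  g = δ (b i j) g

    gainMatrix : Matrix
    gainMatrix i j = entry i j (i Fin.≟ j)

    gainMatrix-hasGain : HasGain gainMatrix b
    gainMatrix-hasGain = record
      { diagonal = λ i g → diag i g (i Fin.≟ i) ; offDiagonal = λ {i} {j} i≢j g → off i≢j g (i Fin.≟ j) }
      where
      diag : ∀ i g (i≟i : Dec (i ≡ i)) → entry i i i≟i g ≈ 0#
      diag i g (yes _)  = ≈-refl
      diag i g (no i≢i) = contradiction refl i≢i

      off : ∀ {i j} → i ≢ j → ∀ g (i≟j : Dec (i ≡ j)) → entry i j i≟j g ≈ δ (b i j) g
      off i≢j g (yes i≡j) = contradiction i≡j i≢j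
      off i≢j g (no _)    = ≈-refl

  module _ {G : Graph (Fin n × Carrier)} {b : Gain} (isGain : IsGainGraph G b) (c : ℕ) where
    open Graph G
    open Cover (gain-isCover {G} {b} isGain)

    private
      B : Matrix
      B = gainMatrix b

      hasGain : HasGain B b
      hasGain = gainMatrix-hasGain b

    gainMatrix-adjacency : IsAdjacencyMatrix G (⌈_⌋ Γ B)
    gainMatrix-adjacency = gainGraph⇒adjacencyMatrix hasGain {G} isGain

    -- Solves the subtraction-free count of `common-adjacent` for the parameter at the identity.
    solve-parameter : ∀ {k} → k + r * c + 2 ≡ n + c →
      fromℕ k ≈ fromℕ n -ᴷ fromℕ c *ᴷ (fromℕ r -ᴷ 1#) -ᴷ fromℕ 2
    -- Both subtracted terms move to the left, and a further `fromℕ c` is added so that c(r - 1) + c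
    -- = c r.
    solve-parameter {k} eq = +ᴷ.x≈z//y _ _ _ (+ᴷ.x≈z//y _ _ _ (+ᴷ.∙-cancelʳ (fromℕ c) _ _ (begin
      fromℕ k +ᴷ fromℕ 2 +ᴷ C *ᴷ (R -ᴷ 1#) +ᴷ C
        ≈⟨ +ᴷ-assoc (fromℕ k +ᴷ fromℕ 2) (C *ᴷ (R -ᴷ 1#)) C ⟩
      fromℕ k +ᴷ fromℕ 2 +ᴷ (C *ᴷ (R -ᴷ 1#) +ᴷ C)
        ≈⟨ +-congˡ {fromℕ k +ᴷ fromℕ 2} (≈-trans
             (+-cong (RingProperties.x[y-z]≈xy-xz (CommutativeRing.ring K) C R 1#) (≈-sym (*-identityʳ C)))
             (+ᴷ.//-rightDividesˡ (C *ᴷ 1#) (C *ᴷ R))) ⟩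
      fromℕ k +ᴷ fromℕ 2 +ᴷ C *ᴷ R
        ≈⟨ +-cong (fromℕ-+ k 2) (≈-trans (Mult.×1-homo-* r c) (*ᴷ-comm R C)) ⟨
      fromℕ (k + 2) +ᴷ fromℕ (r * c)
        ≈⟨ fromℕ-+ (k + 2) (r * c) ⟨
      fromℕ (k + 2 + r * c)
        ≈⟨ ≈-reflexive (cong fromℕ (trans (swap k 2 (r * c)) eq)) ⟩
      fromℕ (n + c)
        ≈⟨ fromℕ-+ n c ⟩
      fromℕ n +ᴷ C
        ∎)))
      where
      C = fromℕ c
      R = fromℕ r

      swap : ∀ x y z → x + y + z ≡ x + z + y
      swap = solve-∀

    module _ (common-remote : ∀ {u v} → fib u ≢ fib v → ¬ Adj u v → # (common? u v) ≡ c) where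

      -- The coefficient at `g` of entry (i, j) on the left counts the common neighbours of (i, g)
      -- and (j, ε). The cases are one fibre (n - 1 or 0), an edge (the parameter at `ε`) and a
      -- remote pair (c).
      gainMatrix-parameters : HasRouxParameters Γ B (drackNParameters Γ n c)
      gainMatrix-parameters i j g = begin
        (B *ᴹ B) i j g
          ≈⟨ ≈-reflexive (cong ((B *ᴹ B) i j) (trans (cong (g ∙_) ε⁻¹≈ε) (identityʳ g))) ⟨
        (B *ᴹ B) i j (g ∙ ε ⁻¹)
          ≈⟨ #common-entry {G} {B} gainMatrix-adjacency i g j ε ⟨
        fromℕ (# (common? (i , g) (j , ε)))
          ≈⟨ count (i Fin.≟ j) ⟩
        parametersRHS B (drackNParameters Γ n c) i j g
          ∎
        where
        same : ∀ i (g≟ε : Dec (g ≡ ε)) → fromℕ (# (common? (i , g) (i , ε))) ≈ (fromℕ n -ᴷ 1#) *ᴷ δ ε g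
        same i (yes refl) = ≈-trans
          (+ᴷ.x≈z//y _ _ _ (≈-trans (+ᴷ-comm (fromℕ (# (common? (i , ε) (i , ε)))) 1#)
            (≈-reflexive (cong fromℕ (common-self (i , ε))))))
          (≈-sym (≈-trans (*-congˡ {fromℕ n -ᴷ 1#} (δ-≡ refl)) (*-identityʳ _)))
        same i (no g≢ε) = ≈-trans
          (≈-reflexive (cong fromℕ (common-same-fibre {i , g} {i , ε} refl (g≢ε ∘ cong proj₂))))
          (≈-sym (≈-trans (*-congˡ {fromℕ n -ᴷ 1#} (δ-≢ (g≢ε ∘ sym))) (zeroʳ _)))

        distinct : i ≢ j → Dec (Adj (i , g) (j , ε)) →
          fromℕ (# (common? (i , g) (j , ε))) ≈ drackNParameters Γ n c (b i j ⁻¹ ∙ g)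
        distinct i≢j (yes u~v) = ≈-trans
          (solve-parameter (common-adjacent common-remote u~v))
          (≈-sym (drackNParameters-ε c (trans
            (cong (b i j ⁻¹ ∙_) (proj₂ (toGain {G} {b} isGain u~v))) (\\-leftDividesʳ (b i j) ε))))
        distinct i≢j (no u≁v) = ≈-trans
          (≈-reflexive (cong fromℕ (common-remote {i , g} {j , ε} i≢j u≁v)))
          (≈-sym (drackNParameters-≢ε c λ eq → u≁v (fromGain {G} {b} isGain i≢j
            (trans (sym (\\-leftDividesˡ (b i j) g)) (cong (b i j ∙_) eq)))))

        count : Dec (i ≡ j) → fromℕ (# (common? (i , g) (j , ε))) ≈ parametersRHS B (drackNParameters Γ n c) i j g
        count (yes refl) = ≈-trans (same i (g ≟ ε)) (≈-sym (parametersRHS-diagonal hasGain (drackNParameters Γ n c) i g))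
        count (no i≢j)   = ≈-trans (distinct i≢j (adj? (i , g) (j , ε)))
          (≈-sym (parametersRHS-offDiagonal hasGain (drackNParameters Γ n c) i≢j g))

      gainMatrix-isRoux : IsRoux Γ B
      gainMatrix-isRoux =
        HasGain.diagonal hasGain ,
        (λ i j i≢j → b i j , HasGain.offDiagonal hasGain i≢j) ,
        inverse⇒R3 hasGain (gain-inverse {G} {b} isGain) ,
        RouxAlgebra.parameters⇒R4 K Γ B {drackNParameters Γ n c} gainMatrix-parameters

-- From regular abelian covers to roux

module RegularGroup {V : Set} {n r : ℕ} {G : Graph V} {L : Labelling V n r}
  (isRegular : IsRegular G L) (isAbelian : IsAbelian G L) (o : Fin r) where

  private
    moving : Fin r → Permutation′ r
    moving a = proj₁ (isRegular o a)

    moving∈Π : ∀ a → InΠ G L (moving a)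
    moving∈Π a = proj₁ (proj₁ (proj₂ (isRegular o a)))

    moving-o : ∀ a → moving a ⟨$⟩ʳ o ≡ a
    moving-o a = proj₂ (proj₁ (proj₂ (isRegular o a)))

  infixl 7 _∙_
  -- The group law of Π transported along its orbit map at `o`: `moving a` is the only element of Π
  -- that takes `o` to `a`.
  _∙_ : Fin r → Fin r → Fin r
  a ∙ b = moving a ⟨$⟩ʳ b

  -- By regularity, `π` and `moving (π ⟨$⟩ʳ o)` agree everywhere because they agree at `o`.
  Π-acts : ∀ {π} → InΠ G L π → ∀ a → π ⟨$⟩ʳ a ≡ (π ⟨$⟩ʳ o) ∙ a
  Π-acts {π} π∈Π a = sym (proj₂ (proj₂ (isRegular o (π ⟨$⟩ʳ o))) (π∈Π , refl) a)

  private
    comm : ∀ a b → a ∙ b ≡ b ∙ a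
    comm a b = trans (cong (a ∙_) (sym (moving-o b)))
      (trans (isAbelian (moving∈Π b) (moving∈Π a) o) (cong (b ∙_) (moving-o a)))

    identityˡ : ∀ a → o ∙ a ≡ a
    identityˡ a = sym (Π-acts identity a)

    inverseʳ : ∀ a → a ∙ (moving a ⟨$⟩ˡ o) ≡ o
    inverseʳ a = Perm.inverseʳ (moving a)

  regularGroup : FiniteAbelianGroup r
  regularGroup = record
    { Carrier        = Fin r
    ; _∙_            = _∙_
    ; ε              = o
    ; _⁻¹            = λ a → moving a ⟨$⟩ˡ o
    ; isAbelianGroup = record
      { isGroup = record
        { isMonoid = record
          { isSemigroup = record
            { isMagma = isMagma _∙_
            -- The composite of `moving b` and `moving a` takes `o` to a ∙ b, hence acts as
            -- translation by a ∙ b.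
            ; assoc   = λ a b c → sym (trans
                (Π-acts (compose (moving∈Π b) (moving∈Π a)) c)
                (cong (λ x → (a ∙ x) ∙ c) (moving-o b)))
            }
          ; identity = identityˡ , moving-o
          }
        ; inverse = (λ a → trans (comm (moving a ⟨$⟩ˡ o) a) (inverseʳ a)) , inverseʳ
        ; ⁻¹-cong = cong λ a → moving a ⟨$⟩ˡ o
        }
      ; comm = comm
      }
    ; enumeration = ↔-id (Fin r)
    }

module NormalisedCover {V : Set} {n r : ℕ} {G : Graph V} {L : Labelling V n r}
  (isCover : IsCover G L) (isRegular : IsRegular G L) (isAbelian : IsAbelian G L)
  {i₀ : Fin n} (i₀≡0 : toℕ i₀ ≡ 0) (o : Fin r) where
  open Graph G
  open IsCover isCover
  open Cover isCover
  open CoverMonodromy isCover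
  open RegularGroup {G = G} {L} isRegular isAbelian o
  open Inverse L using (strictlyInverseˡ) renaming (to to label)

  private
    N : Fin n → Permutation′ r
    N = normalise i₀≡0

  normalisedBlock : ∀ {i j} → i ≢ j → Permutation′ r
  normalisedBlock {i} {j} i≢j = Perm.flip (N j) ∘ₚ blockPermutation i≢j ∘ₚ N i

  normalisedBlock-acts : ∀ {i j} (i≢j : i ≢ j) a →
    normalisedBlock i≢j ⟨$⟩ʳ a ≡ (normalisedBlock i≢j ⟨$⟩ʳ o) ∙ a
  normalisedBlock-acts {i} {j} i≢j = Π-acts {normalisedBlock i≢j}
    (generator {σ = blockPermutation i≢j} i≢j
      (proj₂ (diagonal i₀≡0 i)) (block i≢j) (proj₂ (diagonal i₀≡0 j)))

  gain : Fin n → Fin n → Fin r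
  gain i j with i Fin.≟ j
  -- The default on the diagonal is the identity of the group.
  ... | yes _  = o
  ... | no i≢j = normalisedBlock i≢j ⟨$⟩ʳ o

  -- Applying the diagonal block of D to each fibre turns the adjacency matrix into D A D⁻¹.
  relabel : V ↔ (Fin n × Fin r)
  relabel = mk↔ₛ′
    (λ v → fib v , N (fib v) ⟨$⟩ʳ proj₂ (label v))
    (λ (i , a) → vtx i (N i ⟨$⟩ˡ a))
    (λ (i , a) → trans
      (cong (λ (j , b) → j , N j ⟨$⟩ʳ b) (strictlyInverseˡ (i , (N i ⟨$⟩ˡ a))))
      (cong (i ,_) (Perm.inverseʳ (N i))))
    (λ v → trans (cong (vtx (fib v)) (Perm.inverseˡ (N (fib v)))) (vtx-label refl))

  private
    at : Fin n × Fin r → V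
    at = Inverse.from relabel

    at-relabel : ∀ v → at (Inverse.to relabel v) ≡ v
    at-relabel = Inverse.strictlyInverseʳ relabel

  relabelled : Graph (Fin n × Fin r)
  relabelled = record
    { Adj    = λ u v → Adj (at u) (at v)
    ; adj?   = λ u v → adj? (at u) (at v)
    ; symm   = symm
    ; irrefl = λ { refl → irrefl refl }
    }

  relabel-≅ : G ≅ relabelled
  relabel-≅ = relabel , λ u v → mk⇔
    (subst₂ Adj (sym (at-relabel u)) (sym (at-relabel v)))
    (subst₂ Adj (at-relabel u) (at-relabel v))

  -- The blocks of D A D⁻¹ lie in Π, so each of them is the translation by its value at `o`.
  relabelled-isGainGraph : GainGraph.IsGainGraph regularGroup relabelled gain
  relabelled-isGainGraph {i} {j} {a} {b} = mk⇔ to from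
    where
    unnormalise : ∀ (i≢j : i ≢ j) →
      (N i ⟨$⟩ˡ a) ≡ blockPermutation i≢j ⟨$⟩ʳ (N j ⟨$⟩ˡ b) ⇔ a ≡ normalisedBlock i≢j ⟨$⟩ʳ b
    unnormalise i≢j = mk⇔
      (λ eq → trans (sym (Perm.inverseʳ (N i))) (cong (N i ⟨$⟩ʳ_) eq))
      (λ eq → trans (cong (N i ⟨$⟩ˡ_) eq) (Perm.inverseˡ (N i)))

    to : Adj (at (i , a)) (at (j , b)) → i ≢ j × a ≡ gain i j ∙ b
    to u~v with i Fin.≟ j
    ... | yes refl = contradiction (trans (fib-vtx i _) (sym (fib-vtx i _))) (independent u~v)
    ... | no i≢j   = i≢j , trans
      (Equivalence.to (unnormalise i≢j) (Equivalence.to (block i≢j _ _) u~v))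
      (normalisedBlock-acts i≢j b)

    from : i ≢ j × a ≡ gain i j ∙ b → Adj (at (i , a)) (at (j , b))
    from (i≢j , eq) with i Fin.≟ j
    ... | yes i≡j = contradiction i≡j i≢j
    ... | no i≢j′ = Equivalence.from (block i≢j′ _ _)
      (Equivalence.from (unnormalise i≢j′) (trans eq (sym (normalisedBlock-acts i≢j′ b))))

  module _ {c : ℕ}
    (common-remote : ∀ {u v} → fib u ≢ fib v → ¬ Adj u v → HasCardinality (λ w → Adj u w × Adj v w) c) where

    relabelled-common-remote : ∀ {u v} → proj₁ u ≢ proj₁ v → ¬ Graph.Adj relabelled u v →
      HasCardinality (λ w → Graph.Adj relabelled u w × Graph.Adj relabelled v w) c
    relabelled-common-remote {i , a} {j , b} i≢j u≁v = HasCardinality-↔ relabel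
      (HasCardinality-cong
        (λ w → mk⇔
          (λ (u~w , v~w) → subst (Adj (at (i , a))) (sym (at-relabel w)) u~w ,
                           subst (Adj (at (j , b))) (sym (at-relabel w)) v~w)
          (λ (u~w , v~w) → subst (Adj (at (i , a))) (at-relabel w) u~w ,
                           subst (Adj (at (j , b))) (at-relabel w) v~w))
        (common-remote
          (λ eq → i≢j (trans (sym (fib-vtx i _)) (trans eq (fib-vtx j _)))) u≁v))

drackn⇒roux : (K : CommutativeRing 0ℓ 0ℓ) →
  (∀ {m n} → CommutativeRing._≈_ K (RouxOver.fromℕ K m) (RouxOver.fromℕ K n) → m ≡ n) →
  ∀ {V : Set} {n r c : ℕ} (G : Graph V) (L : Labelling V n r) →
  IsDRACKN G L c → IsRegular G L → IsAbelian G L →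
  ∃ λ (Γ : FiniteAbelianGroup r) →
  ∃ λ (B : SquareMatrix (Fin n) (FiniteAbelianGroup.Carrier Γ → CommutativeRing.Carrier K)) →
    RouxOver.IsRoux K Γ B × RouxOver.HasRouxParameters K Γ B (RouxOver.drackNParameters K Γ n c) ×
    (∃ λ (H : Graph (Fin n × FiniteAbelianGroup.Carrier Γ)) → RouxOver.IsRouxGraph K Γ B H × (G ≅ H))
drackn⇒roux K fromℕ-injective {n = n} {r} {c} G L isDRACKN isRegular isAbelian =
  regularGroup , M.gainMatrix gain ,
  M.gainMatrix-isRoux {relabelled} {gain} relabelled-isGainGraph c common-remote ,
  M.gainMatrix-parameters {relabelled} {gain} relabelled-isGainGraph c common-remote ,
  relabelled , M.gainMatrix-adjacency {relabelled} {gain} relabelled-isGainGraph c , relabel-≅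
  where
  open IsDRACKN isDRACKN
  open IsAntipodalCover isAntipodalCover

  someLabel : Fin n × Fin r
  -- The diameter is attained by some pair of vertices; this supplies a first fibre and a base
  -- point.
  someLabel = Inverse.to L (proj₁ (proj₂ (IsAntipodal.isDiameter isAntipodal)))

  firstFibre : ∀ {m} → Fin m → ∃ λ (i : Fin m) → toℕ i ≡ 0
  firstFibre zero    = zero , refl
  firstFibre (suc _) = zero , refl

  open RegularGroup {G = G} {L} isRegular isAbelian (proj₂ someLabel)
  open NormalisedCover isCover isRegular isAbelian
    (proj₂ (firstFibre (proj₁ someLabel))) (proj₂ someLabel)
  module M = GainGraphRoux K fromℕ-injective {r} {n} regularGroup

  common-remote : ∀ {u v} → proj₁ u ≢ proj₁ v → ¬ Graph.Adj relabelled u v →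
    Labelled.# (GainGraph.labelling regularGroup)
      (λ w → Graph.adj? relabelled u w ×-dec Graph.adj? relabelled v w) ≡ c
  common-remote {u} {v} u≢v u≁v = Labelled.HasCardinality⇒# (GainGraph.labelling regularGroup)
    (λ w → Graph.adj? relabelled u w ×-dec Graph.adj? relabelled v w)
    (relabelled-common-remote
      (λ u≢v u≁v → commonNeighbours (CoverDistance.remote-distance isCover isAntipodal u≢v u≁v))
      u≢v u≁v)

-- The complex numbers have characteristic 0

module Characteristic0 (K : CommutativeRing 0ℓ 0ℓ) where
  open CommutativeRing K using (_≈_; 0#) renaming (sym to ≈-sym)
  open RouxOver K using (fromℕ)

  fromℕ-injective : (∀ m → ¬ fromℕ (suc m) ≈ 0#) → ∀ {m n} → fromℕ m ≈ fromℕ n → m ≡ n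
  fromℕ-injective suc≉0 {zero}  {zero}  _  = refl
  fromℕ-injective suc≉0 {zero}  {suc n} eq = contradiction (≈-sym eq) (suc≉0 n)
  fromℕ-injective suc≉0 {suc m} {zero}  eq = contradiction eq (suc≉0 m)
  fromℕ-injective suc≉0 {suc m} {suc n} eq = cong suc (fromℕ-injective suc≉0
    (AbelianGroupProperties.∙-cancelˡ (CommutativeRing.+-abelianGroup K) _ _ _ eq))

private
  module RouxOverℂ = RouxOver ℂ-commutativeRing

re-fromℕ : ℕ → ℕ → ℚ
re-fromℕ m = seq (re (RouxOverℂ.fromℕ m))

re-fromℕ-nonNegative : ∀ m k → 0ℚ ℚ.≤ re-fromℕ m k
re-fromℕ-nonNegative zero    k = ℚ.≤-refl
re-fromℕ-nonNegative (suc m) k =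
  ℚ.+-mono-≤ (ℚ.<⇒≤ (ℚ.positive⁻¹ 1ℚ)) (re-fromℕ-nonNegative m k)

-- The sequence of the real part of m + 1 is at least 1 at every index, so it is never within 1 of
-- the zero sequence.
ℂ-characteristic-0 : ∀ m → ¬ RouxOverℂ.fromℕ (suc m) ≈ᶜ 0ᶜ
ℂ-characteristic-0 m eq with N , close ← null (re-≈ eq) 1ℚ (ℚ.positive⁻¹ 1ℚ) =
  ℚ.<-irrefl refl (begin-strict
    1ℚ                          ≤⟨ ℚ.+-mono-≤ (ℚ.≤-refl {1ℚ}) (re-fromℕ-nonNegative m N) ⟩
    re-fromℕ (suc m) N          ≡⟨ ℚ.0≤p⇒∣p∣≡p (re-fromℕ-nonNegative (suc m) N) ⟨
    ℚ.∣ re-fromℕ (suc m) N ∣    ≡⟨ cong ℚ.∣_∣ (ℚ.+-identityʳ (re-fromℕ (suc m) N)) ⟨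
    ℚ.∣ re-fromℕ (suc m) N ℚ.- 0ℚ ∣ <⟨ close N ℕ.≤-refl ⟩
    1ℚ                          ∎)
  where open ℚ.≤-Reasoning

ℂ-fromℕ-injective : ∀ {m n} → RouxOverℂ.fromℕ m ≈ᶜ RouxOverℂ.fromℕ n → m ≡ n
ℂ-fromℕ-injective {m} {n} =
  Characteristic0.fromℕ-injective ℂ-commutativeRing ℂ-characteristic-0 {m} {n}

open Defs using (R1; R2; R3; IsAdjacencyMatrix; ⌈_⌋; IsRoux; HasRouxParameters; IsRouxGraph; drackNParameters)

theorem4p2 :
    -- (a)
    (∀ {V : Set} {n r c : ℕ} (G : Graph V) (L : Labelling V n r) →
      IsDRACKN G L c → IsRegular G L → IsAbelian G L →
      ∃ λ (Γ : FiniteAbelianGroup r) → ∃ λ (B : SquareMatrix (Fin n) ℂ[ Γ ]) →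
        IsRoux Γ B × HasRouxParameters Γ B (drackNParameters Γ n c) ×
        (∃ λ (H : Graph (Fin n × FiniteAbelianGroup.Carrier Γ)) →
          IsRouxGraph Γ B H × (G ≅ H)))
  × -- (b)
    (∀ {r n : ℕ} (Γ : FiniteAbelianGroup r) (B : SquareMatrix (Fin n) ℂ[ Γ ]) →
      (R1 Γ B × R2 Γ B × R3 Γ B) ⇔
      (∃ λ (G : Graph (Fin n × FiniteAbelianGroup.Carrier Γ)) →
        IsAdjacencyMatrix G (⌈_⌋ Γ B) ×
        IsCover G (FiniteAbelianGroup.rouxLabelling Γ n) ×
        IsAbelian G (FiniteAbelianGroup.rouxLabelling Γ n)))
  × -- (c)
    (∀ {r n : ℕ} (Γ : FiniteAbelianGroup r) (B : SquareMatrix (Fin n) ℂ[ Γ ])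
      (c : FiniteAbelianGroup.Carrier Γ → ℂ)
      (G : Graph (Fin n × FiniteAbelianGroup.Carrier Γ)) →
      2 ≤ r → 2 ≤ n → IsRoux Γ B → HasRouxParameters Γ B c → IsRouxGraph Γ B G →
      (Diameter G 3 ⇔ (∀ g → g ≢ FiniteAbelianGroup.ε Γ → ¬ (c g ≈ᶜ 0ᶜ))) ×
      (Diameter G 3 →
        IsAntipodalCover G (FiniteAbelianGroup.rouxLabelling Γ n) ×
        IsRegular G (FiniteAbelianGroup.rouxLabelling Γ n)))
  × -- (d)
    (∀ {r n c : ℕ} (Γ : FiniteAbelianGroup r) (B : SquareMatrix (Fin n) ℂ[ Γ ])
      (G : Graph (Fin n × FiniteAbelianGroup.Carrier Γ)) →
      2 ≤ r → 2 ≤ n → IsRoux Γ B → HasRouxParameters Γ B (drackNParameters Γ n c) →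
      c ≢ 0 → IsRouxGraph Γ B G →
      IsDRACKN G (FiniteAbelianGroup.rouxLabelling Γ n) c ×
      IsRegular G (FiniteAbelianGroup.rouxLabelling Γ n) ×
      IsAbelian G (FiniteAbelianGroup.rouxLabelling Γ n))
theorem4p2 =
  drackn⇒roux ℂ-commutativeRing ℂ-inj ,
  abelian-cover⇔R1-R3 ,
  (λ Γ B c G 2≤r 2≤n isRoux parameters A →
    let open RouxGraph Γ B isRoux c parameters G A in
    diameter⇔nonzero 2≤n 2≤r ,
    λ diameter-3 → let nonzero = diameter⇒nonzero 2≤n diameter-3 in
      isAntipodalCover 2≤n nonzero 2≤r , isRegular 2≤n nonzero 2≤r) ,
  λ {r} {n} {c} Γ B G 2≤r 2≤n isRoux parameters c≢0 A →
    let open RouxGraph Γ B isRoux (drackNParameters Γ n c) parameters G A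
        ≈c = λ g g≢ε → RouxGraphs.drackNParameters-≢ε ℂ-commutativeRing ℂ-inj {r} {n} Γ c {g} g≢ε
        -- Injectivity of `fromℕ` turns c ≠ 0 into nonzero parameters away from the identity.
        nonzero = λ g g≢ε cg≈0 → c≢0 (ℂ-fromℕ-injective {c} {0}
          (CommutativeRing.trans ℂ-commutativeRing
            (CommutativeRing.sym ℂ-commutativeRing (≈c g g≢ε)) cg≈0))
    in isDRACKN 2≤n nonzero 2≤r ≈c , isRegular 2≤n nonzero 2≤r , λ {π} {ρ} → isAbelian {π} {ρ}
  where
  ℂ-inj : ∀ {m n} → RouxOverℂ.fromℕ m ≈ᶜ RouxOverℂ.fromℕ n → m ≡ n
  ℂ-inj {m} {n} = ℂ-fromℕ-injective {m} {n}

  open RouxTheorems ℂ-commutativeRing ℂ-inj
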